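{- There is an absolute constant $c>0$ such that for all $n$ and all $\varepsilon$ with $c>\varepsilon\ge 1/\sqrt{n}$, any non-adaptive (possibly two-sided error) $\varepsilon$-testing algorithm for whether an unknown $f:\{0,1\}^n\to\{0,1\}$ is intersecting versus $\varepsilon$-far from intersecting must make $2^{\Omega(n^{1/4}/\sqrt{\varepsilon})}$ queries to $f$.
   Context: Identify $x\in\{0,1\}^n$ with the subset $\{i:x_i=1\}$ of $[n]$. A function $f:\{0,1\}^n\to\{0,1\}$ is intersecting if whenever $f(x)=f(y)=1$ there is $i$ with $x_i=y_i=1$. The distance between $f,g$ is $\Pr_{\mathbf{x}}[f(\mathbf{x})\ne g(\mathbf{x})]$ for uniform $\mathbf{x}$; $f$ is $\varepsilon$-far from intersecting if its distance to every intersecting function is at least $\varepsilon$. An $\varepsilon$-testing algorithm accepts with probability at least $2/3$ every intersecting $f$ and rejects with probability at least $2/3$ every $f$ that is $\varepsilon$-far from intersecting; it is non-adaptive if its queries do not depend on answers to earlier queries.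
   Formalization: The distance parameter ε and the probabilities used by the randomized testing algorithm are taken to be rational numbers rather than arbitrary reals. -}

module Defs where

open import Data.Bool using (Bool; true; false; if_then_else_)
open import Data.Nat as ℕ using (ℕ; zero; suc)
open import Data.Integer using (+_)
open import Data.Fin using (Fin)
open import Data.Vec using (Vec; []; _∷_; lookup; map)
open import Data.List as List using (List; []; _∷_; _++_)
open import Data.Product using (Σ; ∃; _×_; _,_; proj₁; proj₂)
open import Data.Rational using (ℚ; 0ℚ; _+_; _*_; _≤_; _/_)
open import Relation.Binary.PropositionalEquality using (_≡_; _≢_)
open import Data.List.Relation.Unary.All using (All)

-- Points of the cube {0,1}^n, identified with subsets of [n] via x_i = true.
Point : ℕ → Set
Point n = Vec Bool n

BoolFun : ℕ → Set
BoolFun n = Point n → Bool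

allPoints : (n : ℕ) → List (Point n)
allPoints zero = [] ∷ []
allPoints (suc n) = List.map (true ∷_) (allPoints n) ++ List.map (false ∷_) (allPoints n)

Intersecting : {n : ℕ} → BoolFun n → Set
Intersecting {n} f = (x y : Point n) → f x ≡ true → f y ≡ true →
  ∃ λ (i : Fin n) → lookup x i ≡ true × lookup y i ≡ true

differ : Bool → Bool → Bool
differ true true = false
differ false false = false
differ _ _ = true

-- Number of points where f and g differ; the distance is diffCount f g / 2^n.
diffCount : {n : ℕ} → BoolFun n → BoolFun n → ℕ
diffCount {n} f g = List.length (List.filterᵇ (λ x → differ (f x) (g x)) (allPoints n))

ℕtoℚ : ℕ → ℚ
ℕtoℚ m = + m / 1

-- f is ε-far from intersecting: Pr_x[f x ≠ g x] ≥ ε for every intersecting g,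
-- written multiplicatively as ε · 2^n ≤ #{x : f x ≠ g x}.
Far : {n : ℕ} → ℚ → BoolFun n → Set
Far {n} ε f = (g : BoolFun n) → Intersecting g →
  ε * ℕtoℚ (2 ℕ.^ n) ≤ ℕtoℚ (diffCount f g)

-- A deterministic non-adaptive algorithm making q queries: a fixed tuple of
-- q query points and a decision rule applied to the q answers (true = accept).
record DetAlg (n q : ℕ) : Set where
  constructor detAlg
  field
    queries : Vec (Point n) q
    decide  : Vec Bool q → Bool

runDet : {n q : ℕ} → DetAlg n q → BoolFun n → Bool
runDet A f = DetAlg.decide A (map f (DetAlg.queries A))

record RandAlg (n q : ℕ) : Set where
  constructor randAlg
  field
    support   : List (ℚ × DetAlg n q)
    nonneg    : All (λ p → 0ℚ ≤ proj₁ p) support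
    sumsToOne : List.foldr (λ p s → proj₁ p + s) 0ℚ support ≡ + 1 / 1

accProb : {n q : ℕ} → RandAlg n q → BoolFun n → ℚ
accProb T f = List.foldr
  (λ p s → (if runDet (proj₂ p) f then proj₁ p else 0ℚ) + s) 0ℚ (RandAlg.support T)

IsTester : {n q : ℕ} → ℚ → RandAlg n q → Set
IsTester {n} ε T =
  ((f : BoolFun n) → Intersecting f → + 2 / 3 ≤ accProb T f) ×
  ((f : BoolFun n) → Far ε f → accProb T f ≤ + 1 / 3)

{-# OPTIONS --safe #-}
-- By Yao's principle it suffices to hide a pairing from non-adaptive queries. A point of the cube
-- has a type (α or γ), action coordinates u, one at a secret place in each of a = Θ(s²) rows, and
-- control coordinates v, all the others. 2^t random terms of length t + 1 in the control
-- coordinates, t = Θ(s²), split the points of a layer band of mass Θ(ε) by the unique term they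
-- satisfy (Talagrand's construction); f equals 1 only at points with light u, where it is given by
-- a random bit per term. For an α-point and a γ-point that are disjoint, the control part of the
-- first is below the complement of that of the second, so both have the same unique term. Giving
-- opposite bits to the two types makes f intersecting; giving them equal bits makes it Θ(ε)-far.
-- To tell the cases apart, a tester must query two points of different types, both light, with the
-- same term. If their control parts are far from complementary, a common term has probability
-- 2^-s over the terms; otherwise the picked coordinates of the secret must deviate by 2s, which
-- has probability 2^-s over the secret. Hence about 2^(s/2) queries are needed.
module Submission where

open import Defs
open import Data.Nat as ℕ using (ℕ; suc)

-- The exponent comes from balancing three scales. Light action parts must lie s below the middle
-- and still have constant mass, which forces a = Θ(s²) rows. Control parts count as far from
-- complementary once they agree on a 1/h share of the coordinates, h = 64 s, because a rows of
-- length Θ(β) compare with s β agreements in that ratio; a term needs length t = s h = Θ(s²) to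
-- turn such a share into a factor 2^-s. With terms that long, only points within O(m/t) of the
-- middle have a unique term with constant probability, so the band has width ρ = Θ(m/s²). Its mass
-- Θ(ρ/√m) has to be Θ(ε), which gives s⁴ = Θ(m/ε²), that is s = Θ(n^(1/4)/√ε). With a bare random
-- bit per term the distance would be large only on average over the bits. Four marking coordinates
-- give every point a parity as well, and f takes opposite values on the two parities of a term, so
-- the distance bound holds for every choice of bits. All probabilities are counts over explicit
-- lists with the denominators multiplied out, so the combinatorics stays in ℕ; rationals enter only
-- when the weights of the tester are cleared of denominators.

module Counting where
  open import Data.Bool using (Bool; true; false; not; _∧_; _∨_; _xor_; if_then_else_; T)
  open import Data.Bool.Properties using (T-∧; T-≡; ∧-comm; ∧-inverseʳ; ∧-conicalˡ; ∧-conicalʳ; ∨-zeroʳ)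
  open import Data.Empty using (⊥; ⊥-elim)
  open import Data.Fin as Fin using (Fin; zero; suc)
  open import Data.List as List using (List; []; _∷_; length; downFrom)
  open import Data.List.Properties using (length-tabulate; map-tabulate)
  open import Data.Maybe as Maybe using (Maybe; just; nothing; is-just)
  open import Data.Nat
  open import Data.Nat.Combinatorics using (_C_; nCk≡nC[n∸k]; nCk+nC[k+1]≡[n+1]C[k+1]; k>n⇒nCk≡0; nC1≡n)
  open import Data.Nat.DivMod
  open import Data.Nat.Properties
  open import Data.Nat.Tactic.RingSolver using (solve-∀)
  open import Data.Product using (∃; _×_; _,_; proj₁; proj₂)
  open import Data.Sum using (_⊎_; inj₁; inj₂)
  open import Data.Vec as Vec using (Vec; []; _∷_; _++_; lookup; take; drop; removeAt; insertAt; zipWith; toList; tabulate)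
  open import Data.Vec.Membership.Propositional using (_∈_)
  open import Data.Vec.Properties using (lookup-map; lookup-zipWith; lookup∘tabulate; take-zipWith; drop-zipWith;
    take++drop≡id; insertAt-lookup; removeAt-insertAt; length-toList)
  open import Data.Vec.Relation.Binary.Pointwise.Inductive as Pointwise using (Pointwise; []; _∷_)
  open import Data.Vec.Relation.Unary.Any using (here; there)
  open import Function using (_∘_; id; Equivalence)
  open import Relation.Nullary using (¬_; yes; no; contradiction; ⌊_⌋)
  open import Relation.Binary.PropositionalEquality

  -- Finite sums

  ∑ : {X : Set} → List X → (X → ℕ) → ℕ
  ∑ []       f = 0
  ∑ (x ∷ xs) f = f x + ∑ xs f

  syntax ∑ xs (λ x → e) = ∑[ x ← xs ] e
  infixr 5 ∑

  ∑-cong : {X : Set} (xs : List X) {f g : X → ℕ} → (∀ x → f x ≡ g x) → ∑ xs f ≡ ∑ xs g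
  ∑-cong []       f≡g = refl
  ∑-cong (x ∷ xs) f≡g = cong₂ _+_ (f≡g x) (∑-cong xs f≡g)

  ∑-mono : {X : Set} (xs : List X) {f g : X → ℕ} → (∀ x → f x ≤ g x) → ∑ xs f ≤ ∑ xs g
  ∑-mono []       f≤g = z≤n
  ∑-mono (x ∷ xs) f≤g = +-mono-≤ (f≤g x) (∑-mono xs f≤g)

  ∑-zero : {X : Set} (xs : List X) → ∑ xs (λ _ → 0) ≡ 0
  ∑-zero []       = refl
  ∑-zero (x ∷ xs) = ∑-zero xs

  +-interchange : ∀ a b c d → (a + b) + (c + d) ≡ (a + c) + (b + d)
  +-interchange = solve-∀

  ∑-+ : {X : Set} (xs : List X) (f g : X → ℕ) → ∑ xs (λ x → f x + g x) ≡ ∑ xs f + ∑ xs g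
  ∑-+ []       f g = refl
  ∑-+ (x ∷ xs) f g =
    trans (cong (f x + g x +_) (∑-+ xs f g)) (+-interchange (f x) (g x) (∑ xs f) (∑ xs g))

  ∑-*ˡ : {X : Set} (xs : List X) (c : ℕ) (f : X → ℕ) → ∑ xs (λ x → c * f x) ≡ c * ∑ xs f
  ∑-*ˡ []       c f = sym (*-zeroʳ c)
  ∑-*ˡ (x ∷ xs) c f = trans (cong (c * f x +_) (∑-*ˡ xs c f)) (sym (*-distribˡ-+ c (f x) _))

  ∑-*ʳ : {X : Set} (xs : List X) (f : X → ℕ) (c : ℕ) → ∑ xs (λ x → f x * c) ≡ ∑ xs f * c
  ∑-*ʳ xs f c = trans (∑-cong xs (λ x → *-comm (f x) c)) (trans (∑-*ˡ xs c f) (*-comm c _))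

  ∑-const : {X : Set} (xs : List X) (c : ℕ) → ∑ xs (λ _ → c) ≡ length xs * c
  ∑-const []       c = refl
  ∑-const (x ∷ xs) c = cong (c +_) (∑-const xs c)

  ∑-swap : {X Y : Set} (xs : List X) (ys : List Y) (f : X → Y → ℕ) →
           ∑ xs (λ x → ∑ ys (f x)) ≡ ∑ ys (λ y → ∑ xs (λ x → f x y))
  ∑-swap []       ys f = sym (∑-zero ys)
  ∑-swap (x ∷ xs) ys f =
    trans (cong (∑ ys (f x) +_) (∑-swap xs ys f)) (sym (∑-+ ys (f x) _))

  ∑-++ : {X : Set} (xs ys : List X) (f : X → ℕ) → ∑ (xs List.++ ys) f ≡ ∑ xs f + ∑ ys f
  ∑-++ []       ys f = refl
  ∑-++ (x ∷ xs) ys f = trans (cong (f x +_) (∑-++ xs ys f)) (sym (+-assoc (f x) _ _))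

  ∑-map : {X Y : Set} (h : X → Y) (xs : List X) (f : Y → ℕ) → ∑ (List.map h xs) f ≡ ∑ xs (f ∘ h)
  ∑-map h []       f = refl
  ∑-map h (x ∷ xs) f = cong (f (h x) +_) (∑-map h xs f)

  -- The averaging principle of the probabilistic method; it later fixes first the secret and then
  -- the terms.
  ∑-<⇒∃ : {X : Set} (xs : List X) (f g : X → ℕ) → ∑ xs f < ∑ xs g → ∃ λ x → f x < g x
  ∑-<⇒∃ (x ∷ xs) f g lt with f x <? g x
  ... | yes fx<gx = x , fx<gx
  ... | no  fx≮gx = ∑-<⇒∃ xs f g (≰⇒> λ gs≤fs → <⇒≱ lt (+-mono-≤ (≮⇒≥ fx≮gx) gs≤fs))

  𝟙 : Bool → ℕ
  𝟙 true  = 1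
  𝟙 false = 0

  𝟙≤1 : ∀ b → 𝟙 b ≤ 1
  𝟙≤1 true  = ≤-refl
  𝟙≤1 false = z≤n

  -- The product space of n independent uniform draws from `xs`. Terms, families of terms and
  -- secrets are all sampled this way.
  vecs : {X : Set} → List X → (n : ℕ) → List (Vec X n)
  vecs xs zero    = [] ∷ []
  vecs xs (suc n) = List.concatMap (λ x → List.map (x ∷_) (vecs xs n)) xs

  ∑-vecs : {X : Set} (xs : List X) (n : ℕ) (f : Vec X (suc n) → ℕ) →
           ∑ (vecs xs (suc n)) f ≡ ∑ xs (λ x → ∑ (vecs xs n) (λ v → f (x ∷ v)))
  ∑-vecs {X} xs n f = go xs
    where
    go : (ys : List X) → ∑ (List.concatMap (λ x → List.map (x ∷_) (vecs xs n)) ys) f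
         ≡ ∑ ys (λ x → ∑ (vecs xs n) (λ v → f (x ∷ v)))
    go []       = refl
    go (y ∷ ys) = trans (∑-++ (List.map (y ∷_) (vecs xs n)) _ f)
      (cong₂ _+_ (∑-map (y ∷_) (vecs xs n) f) (go ys))

  length≡∑1 : {X : Set} (xs : List X) → length xs ≡ ∑ xs (λ _ → 1)
  length≡∑1 []       = refl
  length≡∑1 (x ∷ xs) = cong suc (length≡∑1 xs)

  length-vecs : {X : Set} (xs : List X) (n : ℕ) → length (vecs xs n) ≡ length xs ^ n
  length-vecs xs zero    = refl
  length-vecs xs (suc n) = begin
    length (vecs xs (suc n))                         ≡⟨ length≡∑1 (vecs xs (suc n)) ⟩
    ∑ (vecs xs (suc n)) (λ _ → 1)                    ≡⟨ ∑-vecs xs n (λ _ → 1) ⟩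
    ∑ xs (λ x → ∑ (vecs xs n) (λ _ → 1))             ≡⟨ ∑-const xs _ ⟩
    length xs * ∑ (vecs xs n) (λ _ → 1)              ≡⟨ cong (length xs *_) (sym (length≡∑1 (vecs xs n))) ⟩
    length xs * length (vecs xs n)                   ≡⟨ cong (length xs *_) (length-vecs xs n) ⟩
    length xs * length xs ^ n                        ∎
    where open ≡-Reasoning

  ∑-cube : (n : ℕ) (f : Vec Bool (suc n) → ℕ) →
           ∑ (allPoints (suc n)) f ≡
           ∑ (allPoints n) (λ v → f (true ∷ v)) + ∑ (allPoints n) (λ v → f (false ∷ v))
  ∑-cube n f = trans (∑-++ (List.map (true ∷_) (allPoints n)) _ f)
    (cong₂ _+_ (∑-map (true ∷_) (allPoints n) f) (∑-map (false ∷_) (allPoints n) f))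

  ∑-cube-const : (n c : ℕ) → ∑ (allPoints n) (λ _ → c) ≡ 2 ^ n * c
  ∑-cube-const zero    c = refl
  ∑-cube-const (suc n) c = begin
    ∑ (allPoints (suc n)) (λ _ → c)     ≡⟨ ∑-cube n (λ _ → c) ⟩
    ∑ (allPoints n) (λ _ → c) + ∑ (allPoints n) (λ _ → c)
      ≡⟨ cong₂ _+_ (∑-cube-const n c) (∑-cube-const n c) ⟩
    2 ^ n * c + 2 ^ n * c               ≡⟨ lemma (2 ^ n) c ⟩
    2 * 2 ^ n * c                       ∎
    where
    open ≡-Reasoning
    lemma : ∀ x y → x * y + x * y ≡ 2 * x * y
    lemma = solve-∀

  ∑-cube-++ : (m n : ℕ) (f : Vec Bool (m + n) → ℕ) →
              ∑ (allPoints (m + n)) f ≡ ∑ (allPoints m) (λ x → ∑ (allPoints n) (λ y → f (x Vec.++ y)))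
  ∑-cube-++ zero    n f = sym (+-identityʳ _)
  ∑-cube-++ (suc m) n f = begin
    ∑ (allPoints (suc m + n)) f
      ≡⟨ ∑-cube (m + n) f ⟩
    ∑ (allPoints (m + n)) (λ v → f (true ∷ v)) + ∑ (allPoints (m + n)) (λ v → f (false ∷ v))
      ≡⟨ cong₂ _+_ (∑-cube-++ m n (λ v → f (true ∷ v))) (∑-cube-++ m n (λ v → f (false ∷ v))) ⟩
    _ ≡⟨ sym (∑-cube m (λ x → ∑ (allPoints n) (λ y → f (x Vec.++ y)))) ⟩
    ∑ (allPoints (suc m)) (λ x → ∑ (allPoints n) (λ y → f (x Vec.++ y))) ∎
    where open ≡-Reasoning

  -- Uniform bits stay uniform under a fixed shift. This carries the coupling between the
  -- intersecting and the far function.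
  ∑-cube-xor : (n : ℕ) (σ : Vec Bool n) (f : Vec Bool n → ℕ) →
               ∑ (allPoints n) (λ b → f (Vec.zipWith _xor_ σ b)) ≡ ∑ (allPoints n) f
  ∑-cube-xor zero    []          f = refl
  ∑-cube-xor (suc n) (false ∷ σ) f = begin
    ∑ (allPoints (suc n)) (λ b → f (Vec.zipWith _xor_ (false ∷ σ) b))
      ≡⟨ ∑-cube n (λ b → f (Vec.zipWith _xor_ (false ∷ σ) b)) ⟩
    _ ≡⟨ cong₂ _+_ (∑-cube-xor n σ (λ b → f (true ∷ b))) (∑-cube-xor n σ (λ b → f (false ∷ b))) ⟩
    _ ≡⟨ sym (∑-cube n f) ⟩
    ∑ (allPoints (suc n)) f ∎
    where open ≡-Reasoning
  ∑-cube-xor (suc n) (true ∷ σ) f = begin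
    ∑ (allPoints (suc n)) (λ b → f (Vec.zipWith _xor_ (true ∷ σ) b))
      ≡⟨ ∑-cube n (λ b → f (Vec.zipWith _xor_ (true ∷ σ) b)) ⟩
    _ ≡⟨ cong₂ _+_ (∑-cube-xor n σ (λ b → f (false ∷ b))) (∑-cube-xor n σ (λ b → f (true ∷ b))) ⟩
    _ ≡⟨ +-comm (∑ (allPoints n) (λ b → f (false ∷ b))) _ ⟩
    _ ≡⟨ sym (∑-cube n f) ⟩
    ∑ (allPoints (suc n)) f ∎
    where open ≡-Reasoning

  ∑-cube-not : (n : ℕ) (f : Vec Bool n → ℕ) →
               ∑ (allPoints n) (λ x → f (Vec.map not x)) ≡ ∑ (allPoints n) f
  ∑-cube-not zero    f = refl
  ∑-cube-not (suc n) f = begin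
    ∑ (allPoints (suc n)) (λ x → f (Vec.map not x))
      ≡⟨ ∑-cube n (λ x → f (Vec.map not x)) ⟩
    _ ≡⟨ cong₂ _+_ (∑-cube-not n (λ x → f (false ∷ x))) (∑-cube-not n (λ x → f (true ∷ x))) ⟩
    _ ≡⟨ +-comm (∑ (allPoints n) (λ x → f (false ∷ x))) _ ⟩
    _ ≡⟨ sym (∑-cube n f) ⟩
    ∑ (allPoints (suc n)) f ∎
    where open ≡-Reasoning

  -- A truncation-free Bernoulli inequality (1 − p/M)^L ≥ 1 − L p/M ≥ 1/2.
  ^-half-Bernoulli : ∀ Q p L .{{_ : NonZero (Q + p)}} → 2 * (L * p) ≤ Q + p → (Q + p) ^ L ≤ 2 * Q ^ L
  ^-half-Bernoulli Q p L 2Lp≤M = *-cancelˡ-≤ M (+-cancelʳ-≤ (M * M ^ L) _ _ (begin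
    M * M ^ L + M * M ^ L                   ≡⟨ double (M * M ^ L) ⟩
    2 * (M * M ^ L)                         ≤⟨ *-monoʳ-≤ 2 (bern L) ⟩
    2 * (M * Q ^ L + L * p * M ^ L)         ≡⟨ expand M (Q ^ L) (L * p) (M ^ L) ⟩
    M * (2 * Q ^ L) + 2 * (L * p) * M ^ L   ≤⟨ +-monoʳ-≤ (M * (2 * Q ^ L)) (*-monoˡ-≤ (M ^ L) 2Lp≤M) ⟩
    M * (2 * Q ^ L) + M * M ^ L             ∎))
    where
    open ≤-Reasoning
    M = Q + p
    double : ∀ x → x + x ≡ 2 * x
    double = solve-∀
    expand : ∀ M q l m → 2 * (M * q + l * m) ≡ M * (2 * q) + 2 * l * m
    expand = solve-∀
    step : ∀ Q p L z q → Q * ((Q + p) * q + L * p * z) + p * ((Q + p) * z) + L * p * (p * z)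
                       ≡ (Q + p) * (Q * q) + (p + L * p) * ((Q + p) * z)
    step = solve-∀
    split : ∀ Q p z → (Q + p) * ((Q + p) * z) ≡ Q * ((Q + p) * z) + p * ((Q + p) * z)
    split = solve-∀
    bern : ∀ L → M * M ^ L ≤ M * Q ^ L + L * p * M ^ L
    bern zero    = ≤-reflexive (sym (+-identityʳ _))
    bern (suc L) = begin
      M * (M * M ^ L)                                              ≡⟨ split Q p (M ^ L) ⟩
      Q * (M * M ^ L) + p * (M * M ^ L)                            ≤⟨ +-monoˡ-≤ _ (*-monoʳ-≤ Q (bern L)) ⟩
      Q * (M * Q ^ L + L * p * M ^ L) + p * (M * M ^ L)            ≤⟨ m≤m+n _ _ ⟩
      Q * (M * Q ^ L + L * p * M ^ L) + p * (M * M ^ L) + L * p * (p * M ^ L)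
                                                                   ≡⟨ step Q p L (M ^ L) (Q ^ L) ⟩
      M * (Q * Q ^ L) + (p + L * p) * (M * M ^ L)                  ∎

  -- For h = 1 + x this is (1 - 1/h)^h ≤ 1/2: Bernoulli gives (1 + 1/x)^x ≥ 2 already for the
  -- exponent x.
  2*x^[1+x]≤[1+x]^[1+x] : ∀ x → 2 * x ^ suc x ≤ suc x ^ suc x
  2*x^[1+x]≤[1+x]^[1+x] zero    = z≤n
  2*x^[1+x]≤[1+x]^[1+x] x@(suc _) = begin
    2 * (x * x ^ x)      ≡⟨ rearr x (x ^ x) ⟩
    x * (2 * x ^ x)      ≤⟨ *-monoʳ-≤ x (*-cancelˡ-≤ x (begin
        x * (2 * x ^ x)    ≡⟨ rearr₂ x (x ^ x) ⟩
        (x + x) * x ^ x    ≤⟨ bern x ⟩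
        x * suc x ^ x      ∎)) ⟩
    x * suc x ^ x        ≤⟨ *-monoˡ-≤ _ (n≤1+n x) ⟩
    suc x * suc x ^ x    ∎
    where
    open ≤-Reasoning
    rearr : ∀ x y → 2 * (x * y) ≡ x * (2 * y)
    rearr = solve-∀
    rearr₂ : ∀ x y → x * (2 * y) ≡ (x + x) * y
    rearr₂ = solve-∀
    step : ∀ x j y → (x + suc j) * (x * y) + j * y ≡ suc x * ((x + j) * y)
    step = solve-∀
    comm : ∀ x y → suc x * (x * y) ≡ x * (suc x * y)
    comm = solve-∀
    bern : ∀ j → (x + j) * x ^ j ≤ x * suc x ^ j
    bern zero    = ≤-reflexive (cong (_* 1) (+-identityʳ x))
    bern (suc j) = begin
      (x + suc j) * (x * x ^ j)               ≤⟨ m≤m+n _ _ ⟩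
      (x + suc j) * (x * x ^ j) + j * x ^ j   ≡⟨ step x j (x ^ j) ⟩
      suc x * ((x + j) * x ^ j)               ≤⟨ *-monoʳ-≤ (suc x) (bern j) ⟩
      suc x * (x * suc x ^ j)                 ≡⟨ comm x (suc x ^ j) ⟩
      x * (suc x * suc x ^ j)                 ∎

  -- Levels of the cube

  𝟙-elim : ∀ b {m} → (T b → 1 ≤ m) → 𝟙 b ≤ m
  𝟙-elim true  f = f _
  𝟙-elim false f = z≤n

  *-𝟙-elim : ∀ b {k m} → (T b → k ≤ m) → k * 𝟙 b ≤ m
  *-𝟙-elim true  {k} f = ≤-trans (≤-reflexive (*-identityʳ k)) (f _)
  *-𝟙-elim false {k} f = ≤-trans (≤-reflexive (*-zeroʳ k)) z≤n

  𝟙-intro : ∀ {b} → T b → 𝟙 b ≡ 1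
  𝟙-intro {true} _ = refl

  wt : ∀ {n} → Vec Bool n → ℕ
  wt []      = 0
  wt (b ∷ u) = 𝟙 b + wt u

  ∁ : ∀ {n} → Vec Bool n → Vec Bool n
  ∁ = Vec.map not

  wt-∁ : ∀ {n} (u : Vec Bool n) → wt u + wt (∁ u) ≡ n
  wt-∁ []          = refl
  wt-∁ (true ∷ u)  = cong suc (wt-∁ u)
  wt-∁ (false ∷ u) = trans (+-suc (wt u) _) (cong suc (wt-∁ u))

  Disjoint : ∀ {n} → Vec Bool n → Vec Bool n → Set
  Disjoint = Pointwise (λ b c → b ∧ c ≡ false)

  ∑-level : (n j : ℕ) → (Vec Bool n → ℕ) → ℕ
  ∑-level n j f = ∑[ u ← allPoints n ] 𝟙 (wt u ≡ᵇ j) * f u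

  ∑-level-suc : ∀ n j (f : Vec Bool (suc n) → ℕ) →
    ∑-level (suc n) (suc j) f ≡ ∑-level n j (f ∘ (true ∷_)) + ∑-level n (suc j) (f ∘ (false ∷_))
  ∑-level-suc n j f = ∑-cube n _

  ∑-level-zero : ∀ n (f : Vec Bool (suc n) → ℕ) →
    ∑-level (suc n) 0 f ≡ ∑-level n 0 (f ∘ (false ∷_))
  ∑-level-zero n f = trans (∑-cube n _) (cong (_+ ∑-level n 0 (f ∘ (false ∷_))) (∑-zero (allPoints n)))

  ∑-level-C : ∀ n j → ∑-level n j (λ _ → 1) ≡ n C j
  ∑-level-C zero    zero    = refl
  ∑-level-C zero    (suc j) = sym (k>n⇒nCk≡0 {0} {suc j} z<s)
  ∑-level-C (suc n) zero    = trans (∑-level-zero n (λ _ → 1)) (∑-level-C n 0)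
  ∑-level-C (suc n) (suc j) = begin
    ∑-level (suc n) (suc j) (λ _ → 1)  ≡⟨ ∑-level-suc n j (λ _ → 1) ⟩
    ∑-level n j (λ _ → 1) + ∑-level n (suc j) (λ _ → 1)
                                       ≡⟨ cong₂ _+_ (∑-level-C n j) (∑-level-C n (suc j)) ⟩
    n C j + n C suc j                  ≡⟨ nCk+nC[k+1]≡[n+1]C[k+1] n j ⟩
    suc n C suc j                      ∎
    where open ≡-Reasoning

  ∑-level-vanish : ∀ n j (f : Vec Bool n → ℕ) → n < j → ∑-level n j f ≡ 0
  ∑-level-vanish zero    (suc j) f n<j = refl
  ∑-level-vanish (suc n) (suc j) f (s≤s n<j) = trans (∑-level-suc n j f)
    (cong₂ _+_ (∑-level-vanish n j _ n<j) (∑-level-vanish n (suc j) _ (m<n⇒m<1+n n<j)))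

  -- Λ a i c f = i! c! ∑-level a i f when i + c = a; the recursion over the choice of the
  -- first coordinate makes the LYM-type double count below a linear identity.
  Λ : (a i c : ℕ) → (Vec Bool a → ℕ) → ℕ
  Λ zero    i c f = f []
  Λ (suc a) i c f = i * Λ a (pred i) c (f ∘ (true ∷_)) + c * Λ a i (pred c) (f ∘ (false ∷_))

  -- When i or c is 0, the meaningless branch of `Λ` created by `pred` carries the coefficient 0;
  -- the two boundary cases check exactly this.
  Λ-level : ∀ a i c (f : Vec Bool a → ℕ) → i + c ≡ a → Λ a i c f ≡ i ! * c ! * ∑-level a i f
  Λ-level zero    zero    zero    f refl = sym (lemma (f []))
    where
    lemma : ∀ x → 1 * 1 * (1 * x + 0) ≡ x
    lemma = solve-∀
  Λ-level (suc a) zero    (suc a) f refl = begin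
    suc a * Λ a 0 a f₀                  ≡⟨ cong (suc a *_) (Λ-level a 0 a f₀ refl) ⟩
    suc a * (1 * a ! * ∑-level a 0 f₀)  ≡⟨ lemma (suc a) (a !) _ ⟩
    1 * (suc a * a !) * ∑-level a 0 f₀  ≡⟨ cong (1 * suc a ! *_) (sym (∑-level-zero a f)) ⟩
    1 * suc a ! * ∑-level (suc a) 0 f   ∎
    where
    open ≡-Reasoning
    f₀ = f ∘ (false ∷_)
    lemma : ∀ x y z → x * (1 * y * z) ≡ 1 * (x * y) * z
    lemma = solve-∀
  Λ-level (suc a) (suc i) zero    f eq with trans (sym (+-identityʳ i)) (suc-injective eq)
  ... | refl = begin
    suc i * Λ i i 0 f₁ + 0               ≡⟨ cong (λ x → suc i * x + 0) (Λ-level i i 0 f₁ (+-identityʳ i)) ⟩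
    suc i * (i ! * 1 * ∑-level i i f₁) + 0
       ≡⟨ lemma (suc i) (i !) _ ⟩
    suc i * i ! * 1 * (∑-level i i f₁ + 0)
       ≡⟨ cong (λ x → suc i ! * 1 * (∑-level i i f₁ + x)) (sym (∑-level-vanish i (suc i) (f ∘ (false ∷_)) ≤-refl)) ⟩
    suc i ! * 1 * (∑-level i i f₁ + ∑-level i (suc i) (f ∘ (false ∷_)))
       ≡⟨ cong (suc i ! * 1 *_) (sym (∑-level-suc i i f)) ⟩
    suc i ! * 1 * ∑-level (suc i) (suc i) f  ∎
    where
    open ≡-Reasoning
    f₁ = f ∘ (true ∷_)
    lemma : ∀ x y z → x * (y * 1 * z) + 0 ≡ x * y * 1 * (z + 0)
    lemma = solve-∀
  Λ-level (suc a) (suc i) (suc c) f eq = begin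
    suc i * Λ a i (suc c) f₁ + suc c * Λ a (suc i) c f₀
       ≡⟨ cong₂ (λ x y → suc i * x + suc c * y)
            (Λ-level a i (suc c) f₁ (suc-injective eq))
            (Λ-level a (suc i) c f₀ (trans (sym (+-suc i c)) (suc-injective eq))) ⟩
    suc i * (i ! * suc c ! * ∑-level a i f₁) + suc c * (suc i ! * c ! * ∑-level a (suc i) f₀)
       ≡⟨ lemma (suc i) (i !) (suc c) (c !) _ _ ⟩
    suc i ! * suc c ! * (∑-level a i f₁ + ∑-level a (suc i) f₀)
       ≡⟨ cong (suc i ! * suc c ! *_) (sym (∑-level-suc a i f)) ⟩
    suc i ! * suc c ! * ∑-level (suc a) (suc i) f  ∎
    where
    open ≡-Reasoning
    f₁ = f ∘ (true ∷_)
    f₀ = f ∘ (false ∷_)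
    lemma : ∀ i i! c c! x y → i * (i! * (c * c!) * x) + c * (i * i! * c! * y) ≡ i * i! * (c * c!) * (x + y)
    lemma = solve-∀

  Λ-one : ∀ a i c → i + c ≡ a → Λ a i c (λ _ → 1) ≡ a !
  Λ-one zero    i c eq = refl
  Λ-one (suc a) i c eq = begin
    i * Λ a (pred i) c (λ _ → 1) + c * Λ a i (pred c) (λ _ → 1)
                       ≡⟨ cong₂ _+_ (left i eq) (right c eq) ⟩
    i * a ! + c * a !  ≡⟨ sym (*-distribʳ-+ (a !) i c) ⟩
    (i + c) * a !      ≡⟨ cong (_* a !) eq ⟩
    suc a * a !        ∎
    where
    open ≡-Reasoning
    left : ∀ i → i + c ≡ suc a → i * Λ a (pred i) c (λ _ → 1) ≡ i * a !
    left zero    _ = refl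
    left (suc i) e = cong (suc i *_) (Λ-one a i c (suc-injective e))
    right : ∀ c → i + c ≡ suc a → c * Λ a i (pred c) (λ _ → 1) ≡ c * a !
    right zero    _ = refl
    right (suc c) e = cong (suc c *_) (Λ-one a i c (suc-injective (trans (sym (+-suc i c)) e)))

  -- In a uniformly random disjoint pair u, v of sizes i and j both marginals are uniform, so E[p u]
  -- + E[q v] ≥ 1. The induction exposes the first coordinate: it lies in u, in v or in neither with
  -- weights i, j and l. Seen from u alone, the last two cases merge into weight j + l; seen from v,
  -- the first and last merge into i + l.
  Λ-cover : ∀ a i j l → i + (j + l) ≡ a → (p q : Vec Bool a → ℕ) →
            (∀ u v → Disjoint u v → wt u ≡ i → wt v ≡ j → 1 ≤ p u + q v) →
            a ! ≤ Λ a i (j + l) p + Λ a j (i + l) q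
  Λ-cover zero    zero zero zero eq p q cover = cover [] [] [] refl refl
  Λ-cover (suc a) i j l eq p q cover = begin
    suc a * a !                                          ≡⟨ cong (_* a !) (sym eq) ⟩
    (i + (j + l)) * a !                                  ≡⟨ lemma₁ i j l (a !) ⟩
    i * a ! + (j * a ! + l * a !)                        ≤⟨ +-mono-≤ (one i eq cover) (+-mono-≤ (two j eq cover) (three l eq)) ⟩
    i * (P₁ + Q₀) + (j * (P₀ + Q₁) + l * (P₀ + Q₀))      ≡⟨ lemma₂ i j l P₁ P₀ Q₁ Q₀ ⟩
    (i * P₁ + (j + l) * P₀) + (j * Q₁ + (i + l) * Q₀)    ∎
    where
    open ≤-Reasoning
    p₁ = p ∘ (true ∷_)
    p₀ = p ∘ (false ∷_)
    q₁ = q ∘ (true ∷_)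
    q₀ = q ∘ (false ∷_)
    P₁ = Λ a (pred i) (j + l) p₁
    P₀ = Λ a i (pred (j + l)) p₀
    Q₁ = Λ a (pred j) (i + l) q₁
    Q₀ = Λ a j (pred (i + l)) q₀
    lemma₁ : ∀ i j l x → (i + (j + l)) * x ≡ i * x + (j * x + l * x)
    lemma₁ = solve-∀
    lemma₂ : ∀ i j l p₁ p₀ q₁ q₀ → i * (p₁ + q₀) + (j * (p₀ + q₁) + l * (p₀ + q₀))
                                 ≡ (i * p₁ + (j + l) * p₀) + (j * q₁ + (i + l) * q₀)
    lemma₂ = solve-∀
    one : ∀ i → i + (j + l) ≡ suc a →
          (∀ u v → Disjoint u v → wt u ≡ i → wt v ≡ j → 1 ≤ p u + q v) →
          i * a ! ≤ i * (Λ a (pred i) (j + l) p₁ + Λ a j (pred (i + l)) q₀)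
    one zero    e cov = z≤n
    one (suc i) e cov = *-monoʳ-≤ (suc i) (Λ-cover a i j l (suc-injective e) p₁ q₀
      λ u v d wu wv → cov (true ∷ u) (false ∷ v) (refl ∷ d) (cong suc wu) wv)
    two : ∀ j → i + (j + l) ≡ suc a →
          (∀ u v → Disjoint u v → wt u ≡ i → wt v ≡ j → 1 ≤ p u + q v) →
          j * a ! ≤ j * (Λ a i (pred (j + l)) p₀ + Λ a (pred j) (i + l) q₁)
    two zero    e cov = z≤n
    two (suc j) e cov = *-monoʳ-≤ (suc j) (Λ-cover a i j l
      (suc-injective (trans (sym (+-suc i (j + l))) e)) p₀ q₁
      λ u v d wu wv → cov (false ∷ u) (true ∷ v) (refl ∷ d) wu (cong suc wv))
    three : ∀ l → i + (j + l) ≡ suc a →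
            l * a ! ≤ l * (Λ a i (pred (j + l)) p₀ + Λ a j (pred (i + l)) q₀)
    three zero    e = z≤n
    three (suc l) e rewrite +-suc j l | +-suc i l = *-monoʳ-≤ (suc l) (Λ-cover a i j l
      (suc-injective (trans (sym (+-suc i (j + l))) e)) p₀ q₀
      λ u v d wu wv → cover (false ∷ u) (false ∷ v) (refl ∷ d) wu wv)

  -- Disjointness between two copies of a layer is a regular bipartite graph, so a vertex cover
  -- weighs at least as much as one side. With equal sizes both normalising factors are `j ! * c !`
  -- and cancel; 2j ≤ a leaves room for a disjoint pair.
  ∑-level-cover : ∀ a j → 2 * j ≤ a → (p q : Vec Bool a → ℕ) →
    (∀ u v → Disjoint u v → wt u ≡ j → wt v ≡ j → 1 ≤ p u + q v) →
    ∑-level a j (λ _ → 1) ≤ ∑-level a j p + ∑-level a j q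
  ∑-level-cover a j 2j≤a p q cover = *-cancelˡ-≤ (j ! * c !) {{m*n≢0 _ _ {{j !≢0}} {{c !≢0}}}} (begin
    j ! * c ! * ∑-level a j (λ _ → 1)                      ≡⟨ sym (Λ-level a j c _ eq) ⟩
    Λ a j c (λ _ → 1)                                      ≡⟨ Λ-one a j c eq ⟩
    a !                                                    ≤⟨ Λ-cover a j j l eq p q cover ⟩
    Λ a j c p + Λ a j c q                                  ≡⟨ cong₂ _+_ (Λ-level a j c p eq) (Λ-level a j c q eq) ⟩
    j ! * c ! * ∑-level a j p + j ! * c ! * ∑-level a j q  ≡⟨ sym (*-distribˡ-+ (j ! * c !) _ _) ⟩
    j ! * c ! * (∑-level a j p + ∑-level a j q)            ∎)
    where
    open ≤-Reasoning
    l = a ∸ 2 * j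
    c = j + l
    shift : ∀ j l → j + (j + l) ≡ 2 * j + l
    shift = solve-∀
    eq : j + c ≡ a
    eq = trans (shift j l) (m+[n∸m]≡n 2j≤a)

  ∑-level-mono : ∀ n j {f g : Vec Bool n → ℕ} → (∀ u → wt u ≡ j → f u ≤ g u) → ∑-level n j f ≤ ∑-level n j g
  ∑-level-mono n j {f} {g} f≤g = ∑-mono (allPoints n) pointwise
    where
    pointwise : ∀ u → 𝟙 (wt u ≡ᵇ j) * f u ≤ 𝟙 (wt u ≡ᵇ j) * g u
    pointwise u with wt u ≡ᵇ j in eq
    ... | true  = *-monoʳ-≤ 1 (f≤g u (≡ᵇ⇒≡ (wt u) j (subst T (sym eq) _)))
    ... | false = z≤n

  ∑-δ : ∀ N w → w < N → ∑[ j ← downFrom N ] 𝟙 (w ≡ᵇ j) ≡ 1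
  ∑-δ (suc N) w (s≤s w≤N) with m≤n⇒m<n∨m≡n w≤N
  ... | inj₂ refl = cong₂ _+_ (𝟙-intro (≡⇒≡ᵇ w w refl)) (none N ≤-refl)
    where
    none : ∀ N → N ≤ w → ∑[ j ← downFrom N ] 𝟙 (w ≡ᵇ j) ≡ 0
    none zero    _ = refl
    none (suc N) N<w with w ≡ᵇ N in eq
    ... | true  = contradiction (sym (≡ᵇ⇒≡ w N (subst T (sym eq) _))) (<⇒≢ N<w)
    ... | false = none N (<⇒≤ N<w)
  ... | inj₁ w<N with w ≡ᵇ N in eq
  ...   | true  = contradiction (≡ᵇ⇒≡ w N (subst T (sym eq) _)) (<⇒≢ w<N)
  ...   | false = ∑-δ N w w<N

  ∑-levels : ∀ n (f : Vec Bool n → ℕ) → ∑[ j ← downFrom (suc n) ] ∑-level n j f ≡ ∑ (allPoints n) f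
  ∑-levels n f = begin
    ∑[ j ← downFrom (suc n) ] ∑-level n j f
      ≡⟨ ∑-swap (downFrom (suc n)) (allPoints n) (λ j u → 𝟙 (wt u ≡ᵇ j) * f u) ⟩
    ∑[ u ← allPoints n ] ∑[ j ← downFrom (suc n) ] 𝟙 (wt u ≡ᵇ j) * f u
      ≡⟨ ∑-cong (allPoints n) (λ u → trans (∑-*ʳ (downFrom (suc n)) (λ j → 𝟙 (wt u ≡ᵇ j)) (f u))
           (trans (cong (_* f u) (∑-δ (suc n) (wt u) (s≤s (m+n≤o⇒m≤o (wt u) (≤-reflexive (wt-∁ u)))))) (*-identityˡ _))) ⟩
    ∑ (allPoints n) f ∎
    where open ≡-Reasoning

  -- The margin s forces any two such points to have at least 2s common zeros. That is the deviation
  -- which a random secret is unlikely to produce on queries with nearly complementary control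
  -- parts.
  low : ∀ {n} → ℕ → Vec Bool n → Bool
  low {n} s u = 2 * (wt u + s) ≤ᵇ n

  -- Pairs of equal weight suffice, one layer at a time. In `hard-far`, p and q mark the α-points
  -- and the γ-points at which a given intersecting function differs from f.
  ∑-low-cover : ∀ a s (p q : Vec Bool a → ℕ) →
    (∀ u v → Disjoint u v → T (low s u) → T (low s v) → 1 ≤ p u + q v) →
    ∑[ u ← allPoints a ] 𝟙 (low s u) ≤ ∑ (allPoints a) p + ∑ (allPoints a) q
  ∑-low-cover a s p q cover = begin
    ∑ (allPoints a) (𝟙 ∘ low s)                               ≡⟨ sym (∑-levels a _) ⟩
    ∑[ j ← downFrom (suc a) ] ∑-level a j (𝟙 ∘ low s)         ≤⟨ ∑-mono (downFrom (suc a)) level ⟩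
    ∑[ j ← downFrom (suc a) ] (∑-level a j p + ∑-level a j q) ≡⟨ ∑-+ (downFrom (suc a)) (λ j → ∑-level a j p) (λ j → ∑-level a j q) ⟩
    _ ≡⟨ cong₂ _+_ (∑-levels a p) (∑-levels a q) ⟩
    ∑ (allPoints a) p + ∑ (allPoints a) q                     ∎
    where
    open ≤-Reasoning
    level : ∀ j → ∑-level a j (𝟙 ∘ low s) ≤ ∑-level a j p + ∑-level a j q
    level j with 2 * (j + s) ≤? a
    ... | yes 2[j+s]≤a = ≤-trans (∑-level-mono a j (λ u _ → 𝟙≤1 (low s u)))
      (∑-level-cover a j (≤-trans (*-monoʳ-≤ 2 (m≤m+n j s)) 2[j+s]≤a) p q
        λ u v d wu wv → cover u v d (islow u wu) (islow v wv))
      where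
      islow : ∀ u → wt u ≡ j → T (low s u)
      islow u wu = ≤⇒≤ᵇ (subst (λ w → 2 * (w + s) ≤ a) (sym wu) 2[j+s]≤a)
    ... | no 2[j+s]≰a = ≤-trans (∑-level-mono a j {g = λ _ → 0} λ u wu → 𝟙-elim (low s u)
            λ t → contradiction (subst (λ w → 2 * (w + s) ≤ a) wu (≤ᵇ⇒≤ _ _ t)) 2[j+s]≰a)
        (≤-trans (≤-reflexive (trans (∑-cong (allPoints a) (λ u → *-zeroʳ (𝟙 (wt u ≡ᵇ j)))) (∑-zero (allPoints a)))) z≤n)

  -- By Pascal's rule it is enough to compare the outer terms n C j and n C (j + 2). This is two
  -- steps of the induction hypothesis, except at n = 2j + 2, where the two are equal by symmetry.
  C-unimodal : ∀ n j → suc (2 * j) ≤ n → n C j ≤ n C suc j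
  C-unimodal (suc n) zero    _ = subst (1 ≤_) (sym (nC1≡n (suc n))) (s≤s z≤n)
  C-unimodal (suc n) (suc j) (s≤s le) = begin
    suc n C suc j                 ≡⟨ sym (nCk+nC[k+1]≡[n+1]C[k+1] n j) ⟩
    n C j + n C suc j             ≡⟨ +-comm (n C j) _ ⟩
    n C suc j + n C j             ≤⟨ +-monoʳ-≤ (n C suc j) outer ⟩
    n C suc j + n C suc (suc j)   ≡⟨ nCk+nC[k+1]≡[n+1]C[k+1] n (suc j) ⟩
    suc n C suc (suc j)           ∎
    where
    open ≤-Reasoning
    2+2j≤n : suc (suc (2 * j)) ≤ n
    2+2j≤n = subst (_≤ n) (*-suc 2 j) le
    twice : ∀ j → 2 * suc j ≡ j + suc (suc j)
    twice = solve-∀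
    outer : n C j ≤ n C suc (suc j)
    outer with m≤n⇒m<n∨m≡n le
    ... | inj₁ lt   = ≤-trans (C-unimodal n j (<⇒≤ 2+2j≤n)) (C-unimodal n (suc j) lt)
    ... | inj₂ refl = ≤-reflexive (trans (nCk≡nC[n∸k] {j} {n} (≤-trans (m≤m+n j _) (≤-reflexive (sym (twice j)))))
                        (cong (n C_) (trans (cong (_∸ j) (twice j)) (m+n∸m≡n j _))))

  -- Second and fourth moments of the imbalance of a random point

  dist² : ℕ → ℕ → ℕ
  dist² p q = ∣ p - q ∣ * ∣ p - q ∣

  dist²-step : ∀ p q → dist² (suc p) q + dist² p (suc q) ≡ 2 * dist² p q + 2
  dist²-step zero    zero    = refl
  dist²-step zero    (suc q) = lemma q
    where
    lemma : ∀ q → q * q + suc (suc q) * suc (suc q) ≡ 2 * (suc q * suc q) + 2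
    lemma = solve-∀
  dist²-step (suc p) zero    = trans (cong (suc (suc p) * suc (suc p) +_) (cong (λ x → x * x) (∣-∣-identityʳ p))) (lemma p)
    where
    lemma : ∀ q → suc (suc q) * suc (suc q) + q * q ≡ 2 * (suc q * suc q) + 2
    lemma = solve-∀
  dist²-step (suc p) (suc q) = dist²-step p q

  dist⁴-step : ∀ p q → dist² (suc p) q * dist² (suc p) q + dist² p (suc q) * dist² p (suc q)
                       ≡ 2 * (dist² p q * dist² p q) + 12 * dist² p q + 2
  dist⁴-step zero    zero    = refl
  dist⁴-step zero    (suc q) = lemma q
    where
    lemma : ∀ q → q * q * (q * q) + suc (suc q) * suc (suc q) * (suc (suc q) * suc (suc q))
                  ≡ 2 * (suc q * suc q * (suc q * suc q)) + 12 * (suc q * suc q) + 2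
    lemma = solve-∀
  dist⁴-step (suc p) zero    = trans (cong (suc (suc p) * suc (suc p) * (suc (suc p) * suc (suc p)) +_)
                                        (cong (λ x → x * x * (x * x)) (∣-∣-identityʳ p))) (lemma p)
    where
    lemma : ∀ q → suc (suc q) * suc (suc q) * (suc (suc q) * suc (suc q)) + q * q * (q * q)
                  ≡ 2 * (suc q * suc q * (suc q * suc q)) + 12 * (suc q * suc q) + 2
    lemma = solve-∀
  dist⁴-step (suc p) (suc q) = dist⁴-step p q

  ∑-dist-cube : ∀ n p q (G : ℕ → ℕ → ℕ) →
    ∑[ u ← allPoints (suc n) ] G (p + wt u) (q + wt (∁ u)) ≡
    (∑[ u ← allPoints n ] G (suc p + wt u) (q + wt (∁ u))) + (∑[ u ← allPoints n ] G (p + wt u) (suc q + wt (∁ u)))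
  ∑-dist-cube n p q G = trans (∑-cube n _)
    (cong₂ _+_ (∑-cong (allPoints n) (λ u → cong (λ x → G x (q + wt (∁ u))) (+-suc p (wt u))))
               (∑-cong (allPoints n) (λ u → cong (G (p + wt u)) (+-suc q (wt (∁ u))))))

  -- `wt u` minus `wt (∁ u)` is a simple random walk of n steps, here started at p - q. The general
  -- starting point makes the induction over the steps close.
  moment₂ : ∀ n p q → ∑[ u ← allPoints n ] dist² (p + wt u) (q + wt (∁ u)) ≡ 2 ^ n * (dist² p q + n)
  moment₂ zero p q = trans (+-identityʳ _) (trans (cong₂ dist² (+-identityʳ p) (+-identityʳ q)) (lemma (dist² p q)))
    where
    lemma : ∀ x → x ≡ 1 * (x + 0)
    lemma = solve-∀
  moment₂ (suc n) p q = begin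
    _ ≡⟨ ∑-dist-cube n p q dist² ⟩
    _ ≡⟨ cong₂ _+_ (moment₂ n (suc p) q) (moment₂ n p (suc q)) ⟩
    2 ^ n * (dist² (suc p) q + n) + 2 ^ n * (dist² p (suc q) + n) ≡⟨ lemma₁ (2 ^ n) _ _ n ⟩
    2 ^ n * ((dist² (suc p) q + dist² p (suc q)) + 2 * n)         ≡⟨ cong (λ x → 2 ^ n * (x + 2 * n)) (dist²-step p q) ⟩
    2 ^ n * (2 * dist² p q + 2 + 2 * n)                           ≡⟨ lemma₂ (2 ^ n) (dist² p q) n ⟩
    2 * 2 ^ n * (dist² p q + suc n)                               ∎
    where
    open ≡-Reasoning
    lemma₁ : ∀ z x y n → z * (x + n) + z * (y + n) ≡ z * ((x + y) + 2 * n)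
    lemma₁ = solve-∀
    lemma₂ : ∀ z x n → z * (2 * x + 2 + 2 * n) ≡ 2 * z * (x + suc n)
    lemma₂ = solve-∀

  -- The fourth moment D⁴ + 6nD² + 3n² - 2n of the walk started at distance D, with the negative
  -- term moved to the left.
  moment₄ : ∀ n p q →
    (∑[ u ← allPoints n ] dist² (p + wt u) (q + wt (∁ u)) * dist² (p + wt u) (q + wt (∁ u))) + 2 ^ n * (2 * n)
    ≡ 2 ^ n * (dist² p q * dist² p q + 6 * n * dist² p q + 3 * (n * n))
  moment₄ zero p q = trans (cong (_+ 0) (+-identityʳ _))
    (trans (cong (λ x → x * x + 0) (cong₂ dist² (+-identityʳ p) (+-identityʳ q))) (lemma (dist² p q)))
    where
    lemma : ∀ x → x * x + 0 ≡ 1 * (x * x + 6 * 0 * x + 3 * (0 * 0))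
    lemma = solve-∀
  moment₄ (suc n) p q = begin
    (∑[ u ← allPoints (suc n) ] G (p + wt u) (q + wt (∁ u))) + 2 ^ suc n * (2 * suc n)
      ≡⟨ cong (_+ 2 ^ suc n * (2 * suc n)) (∑-dist-cube n p q G) ⟩
    X + Y + 2 * 2 ^ n * (2 * suc n)
      ≡⟨ lemma₀ X Y (2 ^ n) n ⟩
    (X + 2 ^ n * (2 * n)) + (Y + 2 ^ n * (2 * n)) + 4 * 2 ^ n
      ≡⟨ cong₂ (λ x y → x + y + 4 * 2 ^ n) (moment₄ n (suc p) q) (moment₄ n p (suc q)) ⟩
    2 ^ n * (A * A + 6 * n * A + 3 * (n * n)) + 2 ^ n * (B * B + 6 * n * B + 3 * (n * n)) + 4 * 2 ^ n
      ≡⟨ lemma₁ (2 ^ n) A B n ⟩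
    2 ^ n * ((A * A + B * B) + 6 * n * (A + B) + 6 * (n * n) + 4)
      ≡⟨ cong₂ (λ x y → 2 ^ n * (x + 6 * n * y + 6 * (n * n) + 4)) (dist⁴-step p q) (dist²-step p q) ⟩
    2 ^ n * (2 * (D * D) + 12 * D + 2 + 6 * n * (2 * D + 2) + 6 * (n * n) + 4)
      ≡⟨ lemma₂ (2 ^ n) D n ⟩
    2 * 2 ^ n * (D * D + 6 * suc n * D + 3 * (suc n * suc n)) ∎
    where
    open ≡-Reasoning
    G : ℕ → ℕ → ℕ
    G x y = dist² x y * dist² x y
    X = ∑[ u ← allPoints n ] G (suc p + wt u) (q + wt (∁ u))
    Y = ∑[ u ← allPoints n ] G (p + wt u) (suc q + wt (∁ u))
    A = dist² (suc p) q
    B = dist² p (suc q)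
    D = dist² p q
    lemma₀ : ∀ x y z n → x + y + 2 * z * (2 * suc n) ≡ (x + z * (2 * n)) + (y + z * (2 * n)) + 4 * z
    lemma₀ = solve-∀
    lemma₁ : ∀ z a b n → z * (a * a + 6 * n * a + 3 * (n * n)) + z * (b * b + 6 * n * b + 3 * (n * n)) + 4 * z
                         ≡ z * ((a * a + b * b) + 6 * n * (a + b) + 6 * (n * n) + 4)
    lemma₁ = solve-∀
    lemma₂ : ∀ z d n → z * (2 * (d * d) + 12 * d + 2 + 6 * n * (2 * d + 2) + 6 * (n * n) + 4)
                       ≡ 2 * z * (d * d + 6 * suc n * d + 3 * (suc n * suc n))
    lemma₂ = solve-∀

  -- Mass of layers

  2xy≤x²+y² : ∀ x y → 2 * (x * y) ≤ x * x + y * y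
  2xy≤x²+y² x y with ≤-total x y
  ... | inj₁ x≤y = ordered x y x≤y
    where
    ordered : ∀ x y → x ≤ y → 2 * (x * y) ≤ x * x + y * y
    ordered x y x≤y = subst (λ y → 2 * (x * y) ≤ x * x + y * y) (m+[n∸m]≡n x≤y)
      (≤-trans (m≤m+n _ (d * d)) (≤-reflexive (lemma x d)))
      where
      d = y ∸ x
      lemma : ∀ x d → 2 * (x * (x + d)) + d * d ≡ x * x + (x + d) * (x + d)
      lemma = solve-∀
  ... | inj₂ y≤x = subst (λ x → 2 * (x * y) ≤ x * x + y * y) (m+[n∸m]≡n y≤x)
      (≤-trans (m≤m+n _ (d * d)) (≤-reflexive (lemma y d)))
    where
    d = x ∸ y
    lemma : ∀ y d → 2 * ((y + d) * y) + d * d ≡ (y + d) * (y + d) + y * y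
    lemma = solve-∀

  gap : ∀ {n} → Vec Bool n → ℕ
  gap u = ∣ wt u - wt (∁ u) ∣

  ∁-involutive : ∀ {n} (u : Vec Bool n) → ∁ (∁ u) ≡ u
  ∁-involutive []          = refl
  ∁-involutive (true ∷ u)  = cong (true ∷_) (∁-involutive u)
  ∁-involutive (false ∷ u) = cong (false ∷_) (∁-involutive u)

  -- One of u and `∁ u` lies in the lower half, so replacing a symmetric two-sided event by its
  -- lower side costs a factor 2.
  wlog-∁ : ∀ {n} (P Q : Vec Bool n → Bool) →
    (∀ u → wt u ≤ wt (∁ u) → T (P u) → T (Q u)) → (∀ u → T (P u) → T (P (∁ u))) →
    ∑ (allPoints n) (𝟙 ∘ P) ≤ 2 * ∑ (allPoints n) (𝟙 ∘ Q)
  wlog-∁ {n} P Q P⇒Q P-∁ = begin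
    ∑ (allPoints n) (𝟙 ∘ P)                                  ≤⟨ ∑-mono (allPoints n) pointwise ⟩
    ∑[ u ← allPoints n ] (𝟙 (Q u) + 𝟙 (Q (∁ u)))             ≡⟨ ∑-+ (allPoints n) (𝟙 ∘ Q) (𝟙 ∘ Q ∘ ∁) ⟩
    ∑ (allPoints n) (𝟙 ∘ Q) + ∑ (allPoints n) (𝟙 ∘ Q ∘ ∁)    ≡⟨ cong (∑ (allPoints n) (𝟙 ∘ Q) +_)
                                                                  (trans (∑-cube-not n (𝟙 ∘ Q)) (sym (+-identityʳ _))) ⟩
    2 * ∑ (allPoints n) (𝟙 ∘ Q)                              ∎
    where
    open ≤-Reasoning
    pointwise : ∀ u → 𝟙 (P u) ≤ 𝟙 (Q u) + 𝟙 (Q (∁ u))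
    pointwise u = 𝟙-elim (P u) λ Pu → case Pu (≤-total (wt u) (wt (∁ u)))
      where
      case : T (P u) → wt u ≤ wt (∁ u) ⊎ wt (∁ u) ≤ wt u → 1 ≤ 𝟙 (Q u) + 𝟙 (Q (∁ u))
      case Pu (inj₁ le) = ≤-trans (≤-reflexive (sym (𝟙-intro (P⇒Q u le Pu)))) (m≤m+n _ _)
      case Pu (inj₂ ge) = ≤-trans (≤-reflexive (sym (𝟙-intro
        (P⇒Q (∁ u) (subst (λ v → wt (∁ u) ≤ wt v) (sym (∁-involutive u)) ge) (P-∁ u Pu))))) (m≤n+m _ _)

  gap-∁ : ∀ {n} (u : Vec Bool n) → gap (∁ u) ≡ gap u
  gap-∁ u = trans (cong (∣ wt (∁ u) -_∣ ∘ wt) (∁-involutive u)) (∣-∣-comm (wt (∁ u)) (wt u))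

  ∑-gap² : ∀ n → ∑[ u ← allPoints n ] gap u * gap u ≡ 2 ^ n * n
  ∑-gap² n = moment₂ n 0 0

  -- Paley–Zygmund with z² = gap²: 96 s² z² ≤ z⁴ + 384 s⁴ + 2304 s⁴ [z ≥ 2s].
  low-mass : ∀ s .{{_ : NonZero s}} → let a = 16 * (s * s) in
    2 ^ a ≤ 12 * (∑[ u ← allPoints a ] 𝟙 (low s u))
  low-mass s = *-cancelˡ-≤ S² {{m*n≢0 _ _ {{m*n≢0 s s}} {{m*n≢0 s s}}}} (*-cancelˡ-≤ 384 (+-cancelʳ-≤ (1152 * (S² * Z)) _ _ main))
    where
    open ≤-Reasoning
    a = 16 * (s * s)
    S² = (s * s) * (s * s)
    Z = 2 ^ a
    cube = allPoints a
    far? : Vec Bool a → Bool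
    far? u = 2 * s ≤ᵇ gap u
    F = ∑ cube (𝟙 ∘ far?)
    M₄ = ∑[ u ← cube ] gap u * gap u * (gap u * gap u)
    Lw = ∑ cube (𝟙 ∘ low s)
    far≤low : F ≤ 2 * Lw
    far≤low = wlog-∁ far? (low s)
      (λ u le t → ≤⇒≤ᵇ (islow u le (≤ᵇ⇒≤ _ _ t)))
      (λ u t → subst (λ g → T (2 * s ≤ᵇ g)) (sym (gap-∁ u)) t)
      where
      islow : ∀ u → wt u ≤ wt (∁ u) → 2 * s ≤ gap u → 2 * (wt u + s) ≤ a
      islow u le 2s≤g = begin
        2 * (wt u + s)               ≡⟨ lemma (wt u) s ⟩
        wt u + (wt u + 2 * s)        ≤⟨ +-monoʳ-≤ (wt u) (+-monoʳ-≤ (wt u) 2s≤g) ⟩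
        wt u + (wt u + gap u)        ≡⟨ cong (λ g → wt u + (wt u + g)) (m≤n⇒∣m-n∣≡n∸m le) ⟩
        wt u + (wt u + (wt (∁ u) ∸ wt u)) ≡⟨ cong (wt u +_) (m+[n∸m]≡n le) ⟩
        wt u + wt (∁ u)              ≡⟨ wt-∁ u ⟩
        a                            ∎
        where
        lemma : ∀ w s → 2 * (w + s) ≡ w + (w + 2 * s)
        lemma = solve-∀
    pointwise : ∀ u → 96 * (s * s) * (gap u * gap u) ≤ gap u * gap u * (gap u * gap u) + (384 * S² + 2304 * S² * 𝟙 (far? u))
    pointwise u with far? u in eq
    ... | true = begin
      96 * (s * s) * z         ≡⟨ lemma₁ (s * s) z ⟩
      2 * (z * (48 * (s * s))) ≤⟨ 2xy≤x²+y² z (48 * (s * s)) ⟩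
      z * z + 48 * (s * s) * (48 * (s * s)) ≤⟨ m≤m+n _ (384 * S²) ⟩
      z * z + 48 * (s * s) * (48 * (s * s)) + 384 * S² ≡⟨ lemma₂ z (s * s) ⟩
      z * z + (384 * S² + 2304 * S² * 1) ∎
      where
      z = gap u * gap u
      lemma₁ : ∀ s z → 96 * s * z ≡ 2 * (z * (48 * s))
      lemma₁ = solve-∀
      lemma₂ : ∀ z s → z * z + 48 * s * (48 * s) + 384 * (s * s) ≡ z * z + (384 * (s * s) + 2304 * (s * s) * 1)
      lemma₂ = solve-∀
    ... | false = begin
      96 * (s * s) * z                       ≤⟨ *-monoʳ-≤ (96 * (s * s)) (*-mono-≤ g≤2s g≤2s) ⟩
      96 * (s * s) * (2 * s * (2 * s))       ≡⟨ lemma₃ s ⟩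
      384 * S² + 2304 * S² * 0               ≤⟨ m≤n+m _ (z * z) ⟩
      z * z + (384 * S² + 2304 * S² * 0)     ∎
      where
      z = gap u * gap u
      g≤2s : gap u ≤ 2 * s
      g≤2s = ≮⇒≥ λ lt → subst T eq (≤⇒≤ᵇ (<⇒≤ lt))
      lemma₃ : ∀ s → 96 * (s * s) * (2 * s * (2 * s)) ≡ 384 * ((s * s) * (s * s)) + 2304 * ((s * s) * (s * s)) * 0
      lemma₃ = solve-∀
    summed : 96 * (s * s) * (Z * a) ≤ M₄ + (Z * (384 * S²) + 2304 * S² * F)
    summed = begin
      96 * (s * s) * (Z * a)
        ≡⟨ cong (96 * (s * s) *_) (sym (∑-gap² a)) ⟩
      96 * (s * s) * ∑ cube (λ u → gap u * gap u)
        ≡⟨ sym (∑-*ˡ cube (96 * (s * s)) _) ⟩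
      ∑ cube (λ u → 96 * (s * s) * (gap u * gap u))
        ≤⟨ ∑-mono cube pointwise ⟩
      ∑ cube (λ u → gap u * gap u * (gap u * gap u) + (384 * S² + 2304 * S² * 𝟙 (far? u)))
        ≡⟨ ∑-+ cube (λ u → gap u * gap u * (gap u * gap u)) _ ⟩
      M₄ + ∑ cube (λ u → 384 * S² + 2304 * S² * 𝟙 (far? u))
        ≡⟨ cong (M₄ +_) (∑-+ cube (λ _ → 384 * S²) _) ⟩
      M₄ + (∑ cube (λ _ → 384 * S²) + ∑ cube (λ u → 2304 * S² * 𝟙 (far? u)))
        ≡⟨ cong (M₄ +_) (cong₂ _+_ (∑-cube-const a (384 * S²)) (∑-*ˡ cube (2304 * S²) _)) ⟩
      M₄ + (Z * (384 * S²) + 2304 * S² * F) ∎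
    M₄≤ : M₄ ≤ Z * (3 * (a * a))
    M₄≤ = begin
      M₄                                     ≤⟨ m≤m+n M₄ _ ⟩
      M₄ + Z * (2 * a)                       ≡⟨ moment₄ a 0 0 ⟩
      Z * (0 + 6 * a * 0 + 3 * (a * a))      ≡⟨ lemma Z a ⟩
      Z * (3 * (a * a))                      ∎
      where
      lemma : ∀ z a → z * (0 + 6 * a * 0 + 3 * (a * a)) ≡ z * (3 * (a * a))
      lemma = solve-∀
    -- With E[gap²] = 16 s² and E[gap⁴] ≤ 3 (16 s²)² = 768 s⁴, the summed inequality divided by s⁴
    -- reads 1536 ≤ 768 + 384 + 2304 Pr[gap ≥ 2s]. Hence the probability is at least 1/6, and its
    -- lower side at least 1/12.
    main : 384 * (S² * Z) + 1152 * (S² * Z) ≤ 384 * (S² * (12 * Lw)) + 1152 * (S² * Z)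
    main = begin
      384 * (S² * Z) + 1152 * (S² * Z)                         ≡⟨ lemma₁ (s * s) Z ⟩
      96 * (s * s) * (Z * a)                                   ≤⟨ summed ⟩
      M₄ + (Z * (384 * S²) + 2304 * S² * F)                    ≤⟨ +-mono-≤ M₄≤ (+-monoʳ-≤ (Z * (384 * S²)) (*-monoʳ-≤ (2304 * S²) far≤low)) ⟩
      Z * (3 * (a * a)) + (Z * (384 * S²) + 2304 * S² * (2 * Lw)) ≡⟨ lemma₂ (s * s) Z Lw ⟩
      384 * (S² * (12 * Lw)) + 1152 * (S² * Z) ∎
      where
      lemma₁ : ∀ s z → 384 * ((s * s) * z) + 1152 * ((s * s) * z) ≡ 96 * s * (z * (16 * s))
      lemma₁ = solve-∀
      lemma₂ : ∀ s z l → z * (3 * ((16 * s) * (16 * s))) + (z * (384 * (s * s)) + 2304 * (s * s) * (2 * l))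
                         ≡ 384 * ((s * s) * (12 * l)) + 1152 * ((s * s) * z)
      lemma₂ = solve-∀

  band : ∀ {n} → ℕ → ℕ → Vec Bool n → Bool
  band H J v = (wt v ≤ᵇ H) ∧ (H <ᵇ wt v + J)

  -- If J exceeds H + 1, truncated subtraction repeats the bottom layer, so this sum can only
  -- overcount the band. Hence `∑-band-≥` holds for every J while `∑-band-≤` asks for J ≤ H + 1; the
  -- wide band of width J₀ may well reach below the cube.
  ∑-band : ∀ n → ℕ → ℕ → (Vec Bool n → ℕ) → ℕ
  ∑-band n H J f = ∑[ i ← downFrom J ] ∑-level n (H ∸ i) f

  band⇒ : ∀ {n} H J (v : Vec Bool n) → T (band H J v) → wt v ≤ H × H < wt v + J
  band⇒ H J v t with Equivalence.to T-∧ t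
  ... | t₁ , t₂ = ≤ᵇ⇒≤ _ _ t₁ , <ᵇ⇒< _ _ t₂

  ⇒band : ∀ {n} H J (v : Vec Bool n) → wt v ≤ H → H < wt v + J → T (band H J v)
  ⇒band H J v le lt = Equivalence.from T-∧ (≤⇒≤ᵇ le , <⇒<ᵇ lt)

  band≤level : ∀ {n} H J (v : Vec Bool n) → 𝟙 (band H J v) ≤ ∑[ i ← downFrom J ] 𝟙 (wt v ≡ᵇ H ∸ i)
  band≤level H zero    v = 𝟙-elim (band H 0 v) λ t → case (band⇒ H 0 v t)
    where
    case : wt v ≤ H × H < wt v + 0 → 1 ≤ 0
    case (le , lt) = contradiction le (<⇒≱ (subst (H <_) (+-identityʳ _) lt))
  band≤level H (suc J) v = 𝟙-elim (band H (suc J) v) λ t → case (band⇒ H (suc J) v t)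
    where
    case : wt v ≤ H × H < wt v + suc J → 1 ≤ 𝟙 (wt v ≡ᵇ H ∸ J) + (∑[ i ← downFrom J ] 𝟙 (wt v ≡ᵇ H ∸ i))
    case (le , lt) with m≤n⇒m<n∨m≡n (≤-pred (subst (H <_) (+-suc (wt v) J) lt))
    ... | inj₁ lt′  = ≤-trans (≤-reflexive (sym (𝟙-intro (⇒band H J v le lt′)))) (≤-trans (band≤level H J v) (m≤n+m _ _))
    ... | inj₂ refl = ≤-trans (≤-reflexive (sym (𝟙-intro (≡⇒≡ᵇ (wt v) (wt v + J ∸ J) (sym (m+n∸n≡m (wt v) J)))))) (m≤m+n _ _)

  level≤band : ∀ {n} H J (v : Vec Bool n) → J ≤ suc H → ∑[ i ← downFrom J ] 𝟙 (wt v ≡ᵇ H ∸ i) ≤ 𝟙 (band H J v)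
  level≤band H zero    v _ = z≤n
  level≤band H (suc J) v (s≤s J≤H) with wt v ≡ᵇ H ∸ J in eq
  ... | false = ≤-trans (level≤band H J v (m≤n⇒m≤1+n J≤H)) (𝟙-elim (band H J v) λ t → case (band⇒ H J v t))
    where
    case : wt v ≤ H × H < wt v + J → 1 ≤ 𝟙 (band H (suc J) v)
    case (le , lt) = ≤-reflexive (sym (𝟙-intro (⇒band H (suc J) v le (≤-trans lt (+-monoʳ-≤ (wt v) (n≤1+n J))))))
  ... | true = begin
    1 + (∑[ i ← downFrom J ] 𝟙 (wt v ≡ᵇ H ∸ i)) ≤⟨ +-monoʳ-≤ 1 (level≤band H J v (m≤n⇒m≤1+n J≤H)) ⟩
    1 + 𝟙 (band H J v)                          ≤⟨ +-monoʳ-≤ 1 (𝟙-elim (band H J v) λ t → contradiction (proj₂ (band⇒ H J v t)) (n≮n′)) ⟩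
    1                                           ≡⟨ sym (𝟙-intro (⇒band H (suc J) v (subst (_≤ H) (sym w≡) (m∸n≤m H J)) H<)) ⟩
    𝟙 (band H (suc J) v)                        ∎
    where
    open ≤-Reasoning
    w≡ : wt v ≡ H ∸ J
    w≡ = ≡ᵇ⇒≡ (wt v) (H ∸ J) (subst T (sym eq) _)
    w+J : wt v + J ≡ H
    w+J = trans (cong (_+ J) w≡) (m∸n+n≡m J≤H)
    n≮n′ : H ≮ wt v + J
    n≮n′ lt = <-irrefl (sym w+J) lt
    H< : H < wt v + suc J
    H< = subst (H <_) (sym (+-suc (wt v) J)) (s≤s (≤-reflexive (sym w+J)))

  ∑-band-levels : ∀ n H J (f : Vec Bool n → ℕ) →
    ∑-band n H J f ≡ ∑[ v ← allPoints n ] (∑[ i ← downFrom J ] 𝟙 (wt v ≡ᵇ H ∸ i)) * f v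
  ∑-band-levels n H J f = trans (∑-swap (downFrom J) (allPoints n) (λ i v → 𝟙 (wt v ≡ᵇ H ∸ i) * f v))
    (∑-cong (allPoints n) (λ v → ∑-*ʳ (downFrom J) (λ i → 𝟙 (wt v ≡ᵇ H ∸ i)) (f v)))

  ∑-band-≤ : ∀ n H J (f : Vec Bool n → ℕ) → J ≤ suc H →
    ∑-band n H J f ≤ ∑[ v ← allPoints n ] 𝟙 (band H J v) * f v
  ∑-band-≤ n H J f J≤1+H = ≤-trans (≤-reflexive (∑-band-levels n H J f))
    (∑-mono (allPoints n) (λ v → *-monoˡ-≤ (f v) (level≤band H J v J≤1+H)))

  ∑-band-≥ : ∀ n H J → ∑[ v ← allPoints n ] 𝟙 (band H J v) ≤ ∑-band n H J (λ _ → 1)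
  ∑-band-≥ n H J = ≤-trans (∑-mono (allPoints n) (λ v → ≤-trans (band≤level H J v) (≤-reflexive (sym (*-identityʳ _)))))
    (≤-reflexive (sym (∑-band-levels n H J (λ _ → 1))))

  -- Lengthening a prefix of a decreasing sequence appends terms below its average, so the average
  -- over the first m terms is at least that over the first k.
  decreasing-average : (c : ℕ → ℕ) → (∀ i → c (suc i) ≤ c i) → ∀ m k → m ≤ k →
    m * ∑ (downFrom k) c ≤ k * ∑ (downFrom m) c
  decreasing-average c dec m k m≤k = subst (λ k → m * ∑ (downFrom k) c ≤ k * ∑ (downFrom m) c) (m∸n+n≡m m≤k) (go (k ∸ m))
    where
    open ≤-Reasoning
    dec′ : ∀ d i → c (d + i) ≤ c i
    dec′ zero    i = ≤-refl
    dec′ (suc d) i = ≤-trans (dec (d + i)) (dec′ d i)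
    tail : ∀ m j → m ≤ j → m * c j ≤ ∑ (downFrom m) c
    tail zero    j _   = z≤n
    tail (suc m) j m<j = +-mono-≤ (subst (λ j → c j ≤ c m) (m∸n+n≡m (<⇒≤ m<j)) (dec′ (j ∸ m) m)) (tail m j (<⇒≤ m<j))
    go : ∀ d → m * ∑ (downFrom (d + m)) c ≤ (d + m) * ∑ (downFrom m) c
    go zero    = ≤-refl
    go (suc d) = begin
      m * (c (d + m) + ∑ (downFrom (d + m)) c)         ≡⟨ *-distribˡ-+ m (c (d + m)) _ ⟩
      m * c (d + m) + m * ∑ (downFrom (d + m)) c       ≤⟨ +-mono-≤ (tail m (d + m) (m≤n+m m d)) (go d) ⟩
      ∑ (downFrom m) c + (d + m) * ∑ (downFrom m) c    ∎

  -- Chebyshev gives the half-band of width J₀ ≥ √n constant mass, and unimodality transfers a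
  -- proportional share of it to the narrower half-band of width J.
  band-mass : ∀ H J J₀ → 0 < J₀ → 2 * H ≤ J₀ * J₀ → J ≤ J₀ → let n = 2 * H in
    3 * (J * 2 ^ n) ≤ 8 * (J₀ * ∑-band n H J (λ _ → 1))
  band-mass H J J₀ 0<J₀ 2H≤J₀² J≤J₀ = begin
    3 * (J * Z)                                      ≡⟨ lemma₀ J Z ⟩
    J * (3 * Z)                                      ≤⟨ *-monoʳ-≤ J (chebyshev) ⟩
    J * (8 * ∑ cube (𝟙 ∘ band H J₀))                 ≤⟨ *-monoʳ-≤ J (*-monoʳ-≤ 8 (∑-band-≥ n H J₀)) ⟩
    J * (8 * ∑-band n H J₀ (λ _ → 1))                ≡⟨ lemma₁ J _ ⟩
    8 * (J * ∑-band n H J₀ (λ _ → 1))                ≤⟨ *-monoʳ-≤ 8 (decreasing-average (λ i → ∑-level n (H ∸ i) (λ _ → 1)) dec J J₀ J≤J₀) ⟩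
    8 * (J₀ * ∑-band n H J (λ _ → 1))                ∎
    where
    open ≤-Reasoning
    n = 2 * H
    Z = 2 ^ n
    cube = allPoints n
    X² = 4 * (J₀ * J₀)
    lemma₀ : ∀ j z → 3 * (j * z) ≡ j * (3 * z)
    lemma₀ = solve-∀
    lemma₁ : ∀ j z → j * (8 * z) ≡ 8 * (j * z)
    lemma₁ = solve-∀
    dec : ∀ i → ∑-level n (H ∸ suc i) (λ _ → 1) ≤ ∑-level n (H ∸ i) (λ _ → 1)
    dec i with suc i ≤? H
    ... | no i≮H = ≤-reflexive (cong (λ j → ∑-level n j (λ _ → 1))
            (trans (m≤n⇒m∸n≡0 {H} {suc i} (m≤n⇒m≤1+n (≮⇒≥ i≮H))) (sym (m≤n⇒m∸n≡0 {H} {i} (≮⇒≥ i≮H)))))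
    ... | yes i<H = begin
      ∑-level n (H ∸ suc i) (λ _ → 1)   ≡⟨ ∑-level-C n _ ⟩
      n C (H ∸ suc i)                   ≤⟨ C-unimodal n (H ∸ suc i) bound ⟩
      n C suc (H ∸ suc i)               ≡⟨ cong (n C_) (sym (+-∸-assoc 1 i<H)) ⟩
      n C (H ∸ i)                       ≡⟨ sym (∑-level-C n _) ⟩
      ∑-level n (H ∸ i) (λ _ → 1)       ∎
      where
      bound : suc (2 * (H ∸ suc i)) ≤ 2 * H
      bound = *-monoʳ-< 2 (∸-monoʳ-< {H} {suc i} {0} z<s i<H)
    near? : Vec Bool n → Bool
    near? u = gap u <ᵇ 2 * J₀
    N = ∑ cube (𝟙 ∘ near?)
    pointwise : ∀ u → X² ≤ gap u * gap u + X² * 𝟙 (near? u)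
    pointwise u with near? u in eq
    ... | true  = ≤-trans (≤-reflexive (sym (*-identityʳ X²))) (m≤n+m _ _)
    ... | false = begin
      4 * (J₀ * J₀)          ≡⟨ lemma J₀ ⟩
      2 * J₀ * (2 * J₀)      ≤⟨ *-mono-≤ ge ge ⟩
      gap u * gap u          ≤⟨ m≤m+n _ _ ⟩
      gap u * gap u + X² * 0 ∎
      where
      lemma : ∀ j → 4 * (j * j) ≡ 2 * j * (2 * j)
      lemma = solve-∀
      ge : 2 * J₀ ≤ gap u
      ge = ≮⇒≥ λ lt → subst T eq (<⇒<ᵇ lt)
    near≤band : N ≤ 2 * ∑ cube (𝟙 ∘ band H J₀)
    near≤band = wlog-∁ near? (band H J₀)
      (λ u le t → ⇒band H J₀ u
        (*-cancelˡ-≤ 2 (begin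
          2 * wt u             ≡⟨ double (wt u) ⟩
          wt u + wt u          ≤⟨ +-monoʳ-≤ (wt u) le ⟩
          wt u + wt (∁ u)      ≡⟨ wt-∁ u ⟩
          2 * H                ∎))
        (*-cancelˡ-< 2 H (wt u + J₀) (begin-strict
          2 * H                               ≡⟨ sym (wt-∁ u) ⟩
          wt u + wt (∁ u)                     ≡⟨ cong (wt u +_) (sym (m+[n∸m]≡n le)) ⟩
          wt u + (wt u + (wt (∁ u) ∸ wt u))   ≡⟨ cong (λ g → wt u + (wt u + g)) (sym (m≤n⇒∣m-n∣≡n∸m le)) ⟩
          wt u + (wt u + gap u)               <⟨ +-monoʳ-< (wt u) (+-monoʳ-< (wt u) (<ᵇ⇒< _ _ t)) ⟩
          wt u + (wt u + 2 * J₀)              ≡⟨ double′ (wt u) J₀ ⟩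
          2 * (wt u + J₀)                     ∎)))
      (λ u t → subst (λ g → T (g <ᵇ 2 * J₀)) (sym (gap-∁ u)) t)
      where
      double : ∀ w → 2 * w ≡ w + w
      double = solve-∀
      double′ : ∀ w j → w + (w + 2 * j) ≡ 2 * (w + j)
      double′ = solve-∀
    -- Pr[gap ≥ 2 J₀] ≤ n / (4 J₀²) ≤ 1/4, and the lower side of the remaining 3/4 lies in the band
    -- of width J₀.
    chebyshev : 3 * Z ≤ 8 * ∑ cube (𝟙 ∘ band H J₀)
    chebyshev = *-cancelˡ-≤ (J₀ * J₀) {{>-nonZero (*-mono-≤ 0<J₀ 0<J₀)}} (*-cancelˡ-≤ 4 (+-cancelʳ-≤ (4 * (J₀ * J₀ * Z)) _ _ (begin
      4 * (J₀ * J₀ * (3 * Z)) + 4 * (J₀ * J₀ * Z)   ≡⟨ lemma₂ (J₀ * J₀) Z ⟩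
      4 * (Z * X²)                                  ≡⟨ cong (4 *_) (sym (∑-cube-const n X²)) ⟩
      4 * ∑ cube (λ _ → X²)                         ≤⟨ *-monoʳ-≤ 4 (∑-mono cube pointwise) ⟩
      4 * ∑ cube (λ u → gap u * gap u + X² * 𝟙 (near? u))
                                                    ≡⟨ cong (4 *_) (trans (∑-+ cube (λ u → gap u * gap u) (λ u → X² * 𝟙 (near? u)))
                                                         (cong₂ _+_ (∑-gap² n) (∑-*ˡ cube X² (𝟙 ∘ near?)))) ⟩
      4 * (Z * n + X² * N)                          ≤⟨ *-monoʳ-≤ 4 (+-mono-≤ (*-monoʳ-≤ Z 2H≤J₀²) (*-monoʳ-≤ X² near≤band)) ⟩
      4 * (Z * (J₀ * J₀) + X² * (2 * ∑ cube (𝟙 ∘ band H J₀)))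
                                                    ≡⟨ lemma₃ (J₀ * J₀) Z (∑ cube (𝟙 ∘ band H J₀)) ⟩
      4 * (J₀ * J₀ * (8 * ∑ cube (𝟙 ∘ band H J₀))) + 4 * (J₀ * J₀ * Z) ∎)))
      where
      lemma₂ : ∀ j z → 4 * (j * (3 * z)) + 4 * (j * z) ≡ 4 * (z * (4 * j))
      lemma₂ = solve-∀
      lemma₃ : ∀ j z b → 4 * (z * j + 4 * j * (2 * b)) ≡ 4 * (j * (8 * b)) + 4 * (j * z)
      lemma₃ = solve-∀

  -- Random terms

  ^-distribˡ-* : ∀ m n k → (m * n) ^ k ≡ m ^ k * n ^ k
  ^-distribˡ-* m n zero    = refl
  ^-distribˡ-* m n (suc k) = trans (cong (m * n *_) (^-distribˡ-* m n k)) (lemma m n (m ^ k) (n ^ k))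
    where
    lemma : ∀ m n x y → m * n * (x * y) ≡ m * x * (n * y)
    lemma = solve-∀

  ∑-allFin : ∀ m (f : Fin (suc m) → ℕ) → ∑ (List.allFin (suc m)) f ≡ f zero + ∑ (List.allFin m) (f ∘ suc)
  ∑-allFin m f = cong (f zero +_) (trans (cong (λ is → ∑ is f) (sym (map-tabulate id suc))) (∑-map suc (List.allFin m) f))

  ∑-lookup : ∀ {m} (v : Vec Bool m) → ∑[ l ← List.allFin m ] 𝟙 (lookup v l) ≡ wt v
  ∑-lookup []              = refl
  ∑-lookup {suc m} (b ∷ v) = trans (∑-allFin m (λ l → 𝟙 (lookup (b ∷ v) l))) (cong (𝟙 b +_) (∑-lookup v))

  -- Variables are drawn with replacement, so the number of terms satisfied by a point is exactly a
  -- power of its weight.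
  terms : (m r : ℕ) → List (Vec (Fin m) r)
  terms m r = vecs (List.allFin m) r

  length-terms : ∀ m r → length (terms m r) ≡ m ^ r
  length-terms m r = trans (length-vecs (List.allFin m) r) (cong (_^ r) (length-tabulate id))

  sat : ∀ {m r} → Vec Bool m → Vec (Fin m) r → Bool
  sat v []      = true
  sat v (l ∷ τ) = lookup v l ∧ sat v τ

  𝟙-∧ : ∀ b c → 𝟙 (b ∧ c) ≡ 𝟙 b * 𝟙 c
  𝟙-∧ true  c = sym (+-identityʳ _)
  𝟙-∧ false c = refl

  ∑-sat : ∀ {m} r (v : Vec Bool m) → ∑ (terms m r) (𝟙 ∘ sat v) ≡ wt v ^ r
  ∑-sat     zero    v = refl
  ∑-sat {m} (suc r) v = begin
    ∑ (terms m (suc r)) (𝟙 ∘ sat v)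
      ≡⟨ ∑-vecs (List.allFin m) r (𝟙 ∘ sat v) ⟩
    ∑[ l ← List.allFin m ] ∑[ τ ← terms m r ] 𝟙 (lookup v l ∧ sat v τ)
      ≡⟨ ∑-cong (List.allFin m) (λ l → trans (∑-cong (terms m r) (λ τ → 𝟙-∧ (lookup v l) (sat v τ)))
           (trans (∑-*ˡ (terms m r) (𝟙 (lookup v l)) (𝟙 ∘ sat v)) (cong (𝟙 (lookup v l) *_) (∑-sat r v)))) ⟩
    ∑[ l ← List.allFin m ] 𝟙 (lookup v l) * wt v ^ r
      ≡⟨ ∑-*ʳ (List.allFin m) (λ l → 𝟙 (lookup v l)) (wt v ^ r) ⟩
    (∑[ l ← List.allFin m ] 𝟙 (lookup v l)) * wt v ^ r
      ≡⟨ cong (_* wt v ^ r) (∑-lookup v) ⟩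
    wt v * wt v ^ r ∎
    where open ≡-Reasoning

  none : ∀ {L} → Vec Bool L → Bool
  none []       = true
  none (b ∷ bs) = not b ∧ none bs

  unique : ∀ {L} → Vec Bool L → Maybe (Fin L)
  unique []           = nothing
  unique (true ∷ bs)  = if none bs then just zero else nothing
  unique (false ∷ bs) = Maybe.map suc (unique bs)

  none-lookup : ∀ {L} (bs : Vec Bool L) → none bs ≡ true → ∀ j → lookup bs j ≡ false
  none-lookup (false ∷ bs) eq zero    = refl
  none-lookup (false ∷ bs) eq (suc j) = none-lookup bs eq j

  unique-sound : ∀ {L} (bs : Vec Bool L) {i} → unique bs ≡ just i → lookup bs i ≡ true
  unique-sound (true ∷ bs) eq with none bs | eq
  ... | true | refl = refl
  unique-sound (false ∷ bs) eq with unique bs in eq′ | eq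
  ... | just i | refl = unique-sound bs eq′

  unique-complete : ∀ {L} (bs : Vec Bool L) {i} → unique bs ≡ just i → ∀ j → lookup bs j ≡ true → j ≡ i
  unique-complete (true ∷ bs) eq j bj with none bs in eq′ | eq
  unique-complete (true ∷ bs) eq zero    bj | true | refl = refl
  unique-complete (true ∷ bs) eq (suc j) bj | true | refl with trans (sym bj) (none-lookup bs eq′ j)
  ... | ()
  unique-complete (false ∷ bs) eq (suc j) bj with unique bs in eq′ | eq
  ... | just i | refl = cong suc (unique-complete bs eq′ j bj)

  ∑-not : {X : Set} (xs : List X) (g : X → Bool) → ∑ xs (𝟙 ∘ not ∘ g) + ∑ xs (𝟙 ∘ g) ≡ length xs
  ∑-not xs g = trans (sym (∑-+ xs (𝟙 ∘ not ∘ g) (𝟙 ∘ g))) (trans (∑-cong xs (λ x → lemma (g x))) (sym (length≡∑1 xs)))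
    where
    lemma : ∀ b → 𝟙 (not b) + 𝟙 b ≡ 1
    lemma true  = refl
    lemma false = refl

  ∑-none : {X : Set} (xs : List X) (g : X → Bool) (L : ℕ) →
    ∑[ x ← vecs xs L ] 𝟙 (none (Vec.map g x)) ≡ ∑ xs (𝟙 ∘ not ∘ g) ^ L
  ∑-none xs g zero    = refl
  ∑-none xs g (suc L) = begin
    _ ≡⟨ ∑-vecs xs L _ ⟩
    ∑[ x ← xs ] ∑[ w ← vecs xs L ] 𝟙 (not (g x) ∧ none (Vec.map g w))
      ≡⟨ ∑-cong xs (λ x → trans (∑-cong (vecs xs L) (λ w → 𝟙-∧ (not (g x)) (none (Vec.map g w))))
           (trans (∑-*ˡ (vecs xs L) (𝟙 (not (g x))) (𝟙 ∘ none ∘ Vec.map g)) (cong (𝟙 (not (g x)) *_) (∑-none xs g L)))) ⟩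
    ∑[ x ← xs ] 𝟙 (not (g x)) * q ^ L
      ≡⟨ ∑-*ʳ xs (𝟙 ∘ not ∘ g) (q ^ L) ⟩
    q * q ^ L ∎
    where
    open ≡-Reasoning
    q = ∑ xs (𝟙 ∘ not ∘ g)

  -- Exactly one of L independent trials succeeds in L p q^(L-1) ways. The extra factor q on both
  -- sides avoids the exponent L - 1.
  ∑-unique : {X : Set} (xs : List X) (g : X → Bool) (L : ℕ) →
    let p = ∑ xs (𝟙 ∘ g) ; q = ∑ xs (𝟙 ∘ not ∘ g) in
    q * (∑[ x ← vecs xs L ] 𝟙 (is-just (unique (Vec.map g x)))) ≡ L * p * q ^ L
  ∑-unique xs g zero    = *-zeroʳ (∑ xs (𝟙 ∘ not ∘ g))
  ∑-unique xs g (suc L) = begin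
    q * (∑[ x ← vecs xs (suc L) ] U (Vec.map g x))
      ≡⟨ cong (q *_) (∑-vecs xs L (U ∘ Vec.map g)) ⟩
    q * (∑[ x ← xs ] ∑[ w ← vecs xs L ] U (g x ∷ Vec.map g w))
      ≡⟨ cong (q *_) (∑-cong xs (λ x → trans (∑-cong (vecs xs L) (λ w → split (g x) (Vec.map g w)))
           (trans (∑-+ (vecs xs L) (λ w → 𝟙 (g x) * 𝟙 (none (Vec.map g w))) (λ w → 𝟙 (not (g x)) * U (Vec.map g w)))
           (cong₂ _+_ (trans (∑-*ˡ (vecs xs L) (𝟙 (g x)) (𝟙 ∘ none ∘ Vec.map g)) (cong (𝟙 (g x) *_) (∑-none xs g L)))
                      (∑-*ˡ (vecs xs L) (𝟙 (not (g x))) (U ∘ Vec.map g)))))) ⟩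
    q * (∑[ x ← xs ] (𝟙 (g x) * q ^ L + 𝟙 (not (g x)) * u))
      ≡⟨ cong (q *_) (trans (∑-+ xs (λ x → 𝟙 (g x) * q ^ L) (λ x → 𝟙 (not (g x)) * u))
           (cong₂ _+_ (∑-*ʳ xs (𝟙 ∘ g) (q ^ L)) (∑-*ʳ xs (𝟙 ∘ not ∘ g) u))) ⟩
    q * (p * q ^ L + q * u)
      ≡⟨ cong (λ z → q * (p * q ^ L + z)) (∑-unique xs g L) ⟩
    q * (p * q ^ L + L * p * q ^ L)
      ≡⟨ lemma q p L (q ^ L) ⟩
    suc L * p * (q * q ^ L) ∎
    where
    open ≡-Reasoning
    p = ∑ xs (𝟙 ∘ g)
    q = ∑ xs (𝟙 ∘ not ∘ g)
    U : ∀ {n} → Vec Bool n → ℕ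
    U bs = 𝟙 (is-just (unique bs))
    u = ∑[ w ← vecs xs L ] U (Vec.map g w)
    lemma : ∀ q p l z → q * (p * z + l * p * z) ≡ (1 + l) * p * (q * z)
    lemma = solve-∀
    split : ∀ {n} b (bs : Vec Bool n) → U (b ∷ bs) ≡ 𝟙 b * 𝟙 (none bs) + 𝟙 (not b) * U bs
    split true bs with none bs
    ... | true  = refl
    ... | false = refl
    split false bs with unique bs
    ... | just _  = refl
    ... | nothing = refl

  -- The union bound over the L entries, multiplied by the size of `xs` for the same reason.
  ∑-some : {X : Set} (xs : List X) (g : X → Bool) (L : ℕ) →
    length xs * (∑[ x ← vecs xs L ] 𝟙 (not (none (Vec.map g x)))) ≤ L * ∑ xs (𝟙 ∘ g) * length xs ^ L
  ∑-some xs g zero    = ≤-reflexive (*-zeroʳ (length xs))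
  ∑-some xs g (suc L) = begin
    M * (∑[ x ← vecs xs (suc L) ] S (Vec.map g x))
      ≡⟨ cong (M *_) (∑-vecs xs L (S ∘ Vec.map g)) ⟩
    M * (∑[ x ← xs ] ∑[ w ← vecs xs L ] S (g x ∷ Vec.map g w))
      ≤⟨ *-monoʳ-≤ M (∑-mono xs (λ x → ∑-mono (vecs xs L) (λ w → split (g x) (none (Vec.map g w))))) ⟩
    M * (∑[ x ← xs ] ∑[ w ← vecs xs L ] (𝟙 (g x) + S (Vec.map g w)))
      ≡⟨ cong (M *_) (∑-cong xs (λ x → trans (∑-+ (vecs xs L) (λ _ → 𝟙 (g x)) (S ∘ Vec.map g))
           (cong (_+ u) (trans (∑-const (vecs xs L) (𝟙 (g x))) (trans (*-comm _ (𝟙 (g x))) (cong (𝟙 (g x) *_) (length-vecs xs L))))))) ⟩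
    M * (∑[ x ← xs ] (𝟙 (g x) * M ^ L + u))
      ≡⟨ cong (M *_) (trans (∑-+ xs (λ x → 𝟙 (g x) * M ^ L) (λ _ → u)) (cong₂ _+_ (∑-*ʳ xs (𝟙 ∘ g) (M ^ L)) (∑-const xs u))) ⟩
    M * (p * M ^ L + M * u)
      ≤⟨ *-monoʳ-≤ M (+-monoʳ-≤ (p * M ^ L) (∑-some xs g L)) ⟩
    M * (p * M ^ L + L * p * M ^ L)
      ≡⟨ lemma M p L (M ^ L) ⟩
    suc L * p * (M * M ^ L) ∎
    where
    open ≤-Reasoning
    M = length xs
    p = ∑ xs (𝟙 ∘ g)
    S : ∀ {n} → Vec Bool n → ℕ
    S bs = 𝟙 (not (none bs))
    u = ∑[ w ← vecs xs L ] S (Vec.map g w)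
    lemma : ∀ q p l z → q * (p * z + l * p * z) ≡ (1 + l) * p * (q * z)
    lemma = solve-∀
    split : ∀ b c → 𝟙 (not (not b ∧ c)) ≤ 𝟙 b + 𝟙 (not c)
    split true  c = s≤s z≤n
    split false c = ≤-refl

  key : ∀ {m r L} → Vec (Vec (Fin m) r) L → Vec Bool m → Maybe (Fin L)
  key τs v = unique (Vec.map (sat v) τs)

  -- 2^t random terms of length t + 1: a point of weight slightly below m/2 satisfies on average
  -- about half a term, hence exactly one term with constant probability.
  unique-mass : ∀ m t (v : Vec Bool m) .{{_ : NonZero m}} → 2 * wt v ≤ m → 2 * (suc t * (m ∸ 2 * wt v)) ≤ m →
    (m ^ suc t) ^ (2 ^ t) ≤ 8 * (∑[ τs ← vecs (terms m (suc t)) (2 ^ t) ] 𝟙 (is-just (key τs v)))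
  unique-mass m t v 2w≤m near = *-cancelˡ-≤ M {{>-nonZero (m^n>0 m (suc t))}} (begin
    M * M ^ L                ≤⟨ *-monoˡ-≤ (M ^ L) M≤4Lp ⟩
    4 * (L * p) * M ^ L      ≤⟨ *-monoʳ-≤ (4 * (L * p)) M^L≤2q^L ⟩
    4 * (L * p) * (2 * q ^ L) ≡⟨ lemma₁ L p (q ^ L) ⟩
    8 * (L * p * q ^ L)      ≡⟨ cong (8 *_) (sym (∑-unique (terms m (suc t)) (sat v) L)) ⟩
    8 * (q * U)              ≤⟨ *-monoʳ-≤ 8 (*-monoˡ-≤ U (≤-trans (m≤m+n q p) (≤-reflexive q+p))) ⟩
    8 * (M * U)              ≡⟨ lemma₂ M U ⟩
    M * (8 * U)              ∎)
    where
    open ≤-Reasoning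
    L = 2 ^ t
    M = m ^ suc t
    p = ∑ (terms m (suc t)) (𝟙 ∘ sat v)
    q = ∑ (terms m (suc t)) (𝟙 ∘ not ∘ sat v)
    U = ∑[ τs ← vecs (terms m (suc t)) L ] 𝟙 (is-just (key τs v))
    lemma₁ : ∀ l p q → 4 * (l * p) * (2 * q) ≡ 8 * (l * p * q)
    lemma₁ = solve-∀
    lemma₂ : ∀ l p → 8 * (l * p) ≡ l * (8 * p)
    lemma₂ = solve-∀
    q+p : q + p ≡ M
    q+p = trans (∑-not (terms m (suc t)) (sat v)) (length-terms m (suc t))
    -- The term length exceeds log₂ L by one, so twice the expected number of satisfied terms is (2
    -- wt v / m)^(t+1). This is at most 1, and at least 1/2 for points close enough to the middle.
    2Lp : 2 * (L * p) ≡ (2 * wt v) ^ suc t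
    2Lp = trans (sym (*-assoc 2 L p)) (trans (cong (2 ^ suc t *_) (∑-sat (suc t) v)) (sym (^-distribˡ-* 2 (wt v) (suc t))))
    2Lp≤M : 2 * (L * p) ≤ M
    2Lp≤M = subst (_≤ M) (sym 2Lp) (^-monoˡ-≤ (suc t) 2w≤m)
    M≤4Lp : M ≤ 4 * (L * p)
    M≤4Lp = begin
      m ^ suc t                   ≡⟨ cong (_^ suc t) (sym m≡) ⟩
      (2 * wt v + d) ^ suc t      ≤⟨ ^-half-Bernoulli (2 * wt v) d (suc t) {{subst NonZero (sym m≡) (it m)}} (subst (2 * (suc t * d) ≤_) (sym m≡) near) ⟩
      2 * (2 * wt v) ^ suc t      ≡⟨ cong (2 *_) (sym 2Lp) ⟩
      2 * (2 * (L * p))           ≡⟨ sym (*-assoc 2 2 (L * p)) ⟩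
      4 * (L * p)                 ∎
      where
      d = m ∸ 2 * wt v
      m≡ : 2 * wt v + d ≡ m
      m≡ = m+[n∸m]≡n 2w≤m
      it : ∀ m .{{_ : NonZero m}} → NonZero m
      it (suc m) = _
    M^L≤2q^L : M ^ L ≤ 2 * q ^ L
    M^L≤2q^L = subst (λ x → x ^ L ≤ 2 * q ^ L) q+p
      (^-half-Bernoulli q p L {{subst NonZero (sym q+p) (>-nonZero (m^n>0 m (suc t)))}} (subst (2 * (L * p) ≤_) (sym q+p) 2Lp≤M))

  -- Two points without a key do not count as sharing one: the hard functions are 0 at both,
  -- whatever the bits are.
  sameKey : ∀ {L} → Maybe (Fin L) → Maybe (Fin L) → Bool
  sameKey (just i) (just j) = ⌊ i Fin.≟ j ⌋
  sameKey _        _        = false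

  sameKey⇒ : ∀ {L} (k l : Maybe (Fin L)) → T (sameKey k l) → ∃ λ i → k ≡ just i × l ≡ just i
  sameKey⇒ (just i) (just j) t with i Fin.≟ j
  ... | yes refl = i , refl , refl

  ⇒sameKey : ∀ {L} (i : Fin L) → T (sameKey (just i) (just i))
  ⇒sameKey i with i Fin.≟ i
  ... | yes _  = _
  ... | no i≢i = contradiction refl i≢i

  sat-∧ : ∀ {m r} (v w : Vec Bool m) (τ : Vec (Fin m) r) → sat v τ ≡ true → sat w τ ≡ true →
    sat (Vec.zipWith _∧_ v w) τ ≡ true
  sat-∧ v w []      _ _ = refl
  sat-∧ v w (l ∷ τ) sv sw = cong₂ _∧_
    (trans (lookup-zipWith _∧_ l v w) (cong₂ _∧_ (∧-conicalˡ (lookup v l) (sat v τ) sv) (∧-conicalˡ (lookup w l) (sat w τ) sw)))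
    (sat-∧ v w τ (∧-conicalʳ (lookup v l) (sat v τ) sv) (∧-conicalʳ (lookup w l) (sat w τ) sw))

  lookup⇒¬none : ∀ {L} (bs : Vec Bool L) j → lookup bs j ≡ true → T (not (none bs))
  lookup⇒¬none bs j bj with none bs in eq
  ... | false = _
  ... | true with trans (sym bj) (none-lookup bs eq j)
  ...   | ()

  -- The shared term is satisfied by both points, hence, being a conjunction of variables, by their
  -- meet. Two keys are thereby reduced to a union bound for a single point.
  sameKey⇒some : ∀ {m r L} (τs : Vec (Vec (Fin m) r) L) (v w : Vec Bool m) →
    T (sameKey (key τs v) (key τs w)) → T (not (none (Vec.map (sat (Vec.zipWith _∧_ v w)) τs)))
  sameKey⇒some τs v w t with sameKey⇒ (key τs v) (key τs w) t
  ... | i , kv , kw = lookup⇒¬none (Vec.map (sat v∧w) τs) i (trans (lookup-map i _ τs) (sat-∧ v w (lookup τs i)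
          (satisfied v kv) (satisfied w kw)))
    where
    v∧w = Vec.zipWith _∧_ v w
    satisfied : ∀ v → key τs v ≡ just i → sat v (lookup τs i) ≡ true
    satisfied v kv = trans (sym (lookup-map i (sat v) τs)) (unique-sound (Vec.map (sat v) τs) kv)

  -- By hypothesis the meet has at most m/2 coordinates times 1 - 1/h. A term of length s h + 1 is
  -- then satisfied with probability at most 2^-(t+1) (1 - 1/h)^(s h) ≤ 2^-(t+1) 2^-s, and the union
  -- over 2^t terms leaves less than 2^-s.
  sameKey-mass : ∀ m s x (v w : Vec Bool m) .{{_ : NonZero m}} → let h = suc x ; t = s * h in
    h * (2 * wt (Vec.zipWith _∧_ v w)) ≤ x * m →
    2 ^ s * (∑[ τs ← vecs (terms m (suc t)) (2 ^ t) ] 𝟙 (sameKey (key τs v) (key τs w))) ≤ (m ^ suc t) ^ (2 ^ t)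
  sameKey-mass m s x v w far = *-cancelˡ-≤ M {{>-nonZero (m^n>0 m (suc t))}} (begin
    M * (2 ^ s * ∑ Ω (λ τs → 𝟙 (sameKey (key τs v) (key τs w))))
      ≤⟨ *-monoʳ-≤ M (*-monoʳ-≤ (2 ^ s) (∑-mono Ω (λ τs → 𝟙-elim (sameKey (key τs v) (key τs w)) λ t → ≤-reflexive (sym (𝟙-intro (sameKey⇒some τs v w t)))))) ⟩
    M * (2 ^ s * ∑ Ω (λ τs → 𝟙 (not (none (Vec.map (sat z) τs)))))
      ≡⟨ lemma₁ M (2 ^ s) _ ⟩
    2 ^ s * (M * ∑ Ω (λ τs → 𝟙 (not (none (Vec.map (sat z) τs)))))
      ≡⟨ cong (λ M → 2 ^ s * (M * ∑ Ω (λ τs → 𝟙 (not (none (Vec.map (sat z) τs)))))) (sym len) ⟩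
    2 ^ s * (length (terms m (suc t)) * ∑ Ω (λ τs → 𝟙 (not (none (Vec.map (sat z) τs)))))
      ≤⟨ *-monoʳ-≤ (2 ^ s) (∑-some (terms m (suc t)) (sat z) L) ⟩
    2 ^ s * (L * ∑ (terms m (suc t)) (𝟙 ∘ sat z) * length (terms m (suc t)) ^ L)
      ≡⟨ cong₂ (λ p M → 2 ^ s * (L * p * M ^ L)) (∑-sat (suc t) z) len ⟩
    2 ^ s * (L * p * M ^ L)
      ≡⟨ lemma₂ (2 ^ s) (L * p) (M ^ L) ⟩
    2 ^ s * (L * p) * M ^ L
      ≤⟨ *-monoˡ-≤ (M ^ L) bound ⟩
    M * M ^ L ∎)
    where
    open ≤-Reasoning
    h = suc x
    t = s * h
    L = 2 ^ t
    M = m ^ suc t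
    Ω = vecs (terms m (suc t)) L
    z = Vec.zipWith _∧_ v w
    c = 2 * wt z
    p = wt z ^ suc t
    len = length-terms m (suc t)
    lemma₁ : ∀ x y z → x * (y * z) ≡ y * (x * z)
    lemma₁ = solve-∀
    lemma₂ : ∀ x y z → x * (y * z) ≡ x * y * z
    lemma₂ = solve-∀
    lemma₃ : ∀ x y z → x * (2 * y * z) ≡ 2 * (x * (y * z))
    lemma₃ = solve-∀
    2c^h≤m^h : 2 * c ^ h ≤ m ^ h
    2c^h≤m^h = *-cancelˡ-≤ (h ^ h) {{>-nonZero (m^n>0 h h)}} (begin
      h ^ h * (2 * c ^ h)   ≡⟨ lemma₁ (h ^ h) 2 (c ^ h) ⟩
      2 * (h ^ h * c ^ h)   ≡⟨ cong (2 *_) (sym (^-distribˡ-* h c h)) ⟩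
      2 * (h * c) ^ h       ≤⟨ *-monoʳ-≤ 2 (^-monoˡ-≤ h far) ⟩
      2 * (x * m) ^ h       ≡⟨ cong (2 *_) (^-distribˡ-* x m h) ⟩
      2 * (x ^ h * m ^ h)   ≡⟨ sym (*-assoc 2 (x ^ h) (m ^ h)) ⟩
      2 * x ^ h * m ^ h     ≤⟨ *-monoˡ-≤ (m ^ h) (2*x^[1+x]≤[1+x]^[1+x] x) ⟩
      h ^ h * m ^ h         ∎)
    power : 2 ^ s * c ^ t ≤ m ^ t
    power = begin
      2 ^ s * c ^ (s * h)       ≡⟨ cong (λ e → 2 ^ s * c ^ e) (*-comm s h) ⟩
      2 ^ s * c ^ (h * s)       ≡⟨ cong (2 ^ s *_) (sym (^-*-assoc c h s)) ⟩
      2 ^ s * (c ^ h) ^ s       ≡⟨ sym (^-distribˡ-* 2 (c ^ h) s) ⟩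
      (2 * c ^ h) ^ s           ≤⟨ ^-monoˡ-≤ s 2c^h≤m^h ⟩
      (m ^ h) ^ s               ≡⟨ ^-*-assoc m h s ⟩
      m ^ (h * s)               ≡⟨ cong (m ^_) (*-comm h s) ⟩
      m ^ (s * h)               ∎
    c≤m : c ≤ m
    c≤m = *-cancelˡ-≤ h (≤-trans far (*-monoˡ-≤ m (n≤1+n x)))
    bound : 2 ^ s * (L * p) ≤ M
    bound = begin
      2 ^ s * (L * p)               ≤⟨ m≤m+n _ _ ⟩
      2 * (2 ^ s * (L * p))         ≡⟨ sym (lemma₃ (2 ^ s) L p) ⟩
      2 ^ s * (2 ^ suc t * p)       ≡⟨ cong (2 ^ s *_) (sym (^-distribˡ-* 2 (wt z) (suc t))) ⟩
      2 ^ s * (c * c ^ t)           ≡⟨ lemma₁ (2 ^ s) c (c ^ t) ⟩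
      c * (2 ^ s * c ^ t)           ≤⟨ *-mono-≤ c≤m power ⟩
      m * m ^ t                     ∎

  -- Secrets

  take-++ : ∀ {X : Set} {m n} (x : Vec X m) (y : Vec X n) → take m (x ++ y) ≡ x
  take-++ []      y = refl
  take-++ (b ∷ x) y = cong (b ∷_) (take-++ x y)

  drop-++ : ∀ {X : Set} {m n} (x : Vec X m) (y : Vec X n) → drop m (x ++ y) ≡ y
  drop-++ []      y = refl
  drop-++ (b ∷ x) y = drop-++ x y

  -- A secret A picks one coordinate in each of a rows of suc b bits: the action coordinates of x
  -- are the picked ones, its control coordinates all the others.
  action : ∀ {a b} → Vec (Fin (suc b)) a → Vec Bool (a * suc b) → Vec Bool a
  action         []      x = []
  action {b = b} (i ∷ A) x = lookup (take (suc b) x) i ∷ action A (drop (suc b) x)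

  control : ∀ {a b} → Vec (Fin (suc b)) a → Vec Bool (a * suc b) → Vec Bool (a * b)
  control         []      x = []
  control {b = b} (i ∷ A) x = removeAt (take (suc b) x) i ++ control A (drop (suc b) x)

  merge : ∀ {a b} → Vec (Fin (suc b)) a → Vec Bool a → Vec Bool (a * b) → Vec Bool (a * suc b)
  merge         []      u       v = []
  merge {b = b} (i ∷ A) (c ∷ u) v = insertAt (take b v) i c ++ merge A u (drop b v)

  action-merge : ∀ {a b} (A : Vec (Fin (suc b)) a) u v → action A (merge A u v) ≡ u
  action-merge         []      []      v = refl
  action-merge {b = b} (i ∷ A) (c ∷ u) v
    rewrite take-++ (insertAt (take b v) i c) (merge A u (drop b v))
          | drop-++ (insertAt (take b v) i c) (merge A u (drop b v))
    = cong₂ _∷_ (insertAt-lookup (take b v) i c) (action-merge A u (drop b v))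

  control-merge : ∀ {a b} (A : Vec (Fin (suc b)) a) u v → control A (merge A u v) ≡ v
  control-merge         []      []      []  = refl
  control-merge {b = b} (i ∷ A) (c ∷ u) v
    rewrite take-++ (insertAt (take b v) i c) (merge A u (drop b v))
          | drop-++ (insertAt (take b v) i c) (merge A u (drop b v))
    = trans (cong₂ _++_ (removeAt-insertAt (take b v) i c) (control-merge A u (drop b v))) (take++drop≡id b v)

  ∑-insertAt : ∀ b (i : Fin (suc b)) (f : Vec Bool (suc b) → ℕ) →
    ∑ (allPoints (suc b)) f ≡ (∑[ r ← allPoints b ] f (insertAt r i true)) + (∑[ r ← allPoints b ] f (insertAt r i false))
  ∑-insertAt b       zero    f = ∑-cube b f
  ∑-insertAt (suc b) (suc i) f = begin
    ∑ (allPoints (suc (suc b))) f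
      ≡⟨ ∑-cube (suc b) f ⟩
    _ ≡⟨ cong₂ _+_ (∑-insertAt b i (λ r → f (true ∷ r))) (∑-insertAt b i (λ r → f (false ∷ r))) ⟩
    _ ≡⟨ +-interchange (∑ (allPoints b) (λ r → f (true ∷ insertAt r i true))) _ _ _ ⟩
    _ ≡⟨ sym (cong₂ _+_ (∑-cube b (λ r → f (insertAt r (suc i) true))) (∑-cube b (λ r → f (insertAt r (suc i) false)))) ⟩
    _ ∎
    where open ≡-Reasoning

  -- For each fixed secret the cube is the product of the cube of action parts and the cube of
  -- control parts, so masses can be computed separately in the two factors.
  ∑-merge : ∀ {a b} (A : Vec (Fin (suc b)) a) (f : Vec Bool (a * suc b) → ℕ) →
    ∑ (allPoints (a * suc b)) f ≡ ∑[ u ← allPoints a ] ∑[ v ← allPoints (a * b) ] f (merge A u v)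
  ∑-merge                 []      f = sym (+-identityʳ _)
  ∑-merge {suc a} {b} (i ∷ A) f = begin
    ∑ (allPoints (suc b + a * suc b)) f
      ≡⟨ ∑-cube-++ (suc b) (a * suc b) f ⟩
    ∑[ r ← allPoints (suc b) ] ∑[ x ← allPoints (a * suc b) ] f (r ++ x)
      ≡⟨ ∑-cong (allPoints (suc b)) (λ r → ∑-merge A (λ x → f (r ++ x))) ⟩
    ∑[ r ← allPoints (suc b) ] ∑[ u ← allPoints a ] ∑[ v ← allPoints (a * b) ] f (r ++ merge A u v)
      ≡⟨ ∑-insertAt b i _ ⟩
    _ ≡⟨ cong₂ _+_ (regroup true) (regroup false) ⟩
    _ ≡⟨ sym (∑-cube a (λ u → ∑[ v ← allPoints (b + a * b) ] f (merge (i ∷ A) u v))) ⟩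
    ∑[ u ← allPoints (suc a) ] ∑[ v ← allPoints (b + a * b) ] f (merge (i ∷ A) u v) ∎
    where
    open ≡-Reasoning
    regroup : ∀ c → ∑[ r ← allPoints b ] ∑[ u ← allPoints a ] ∑[ v ← allPoints (a * b) ] f (insertAt r i c ++ merge A u v)
                    ≡ ∑[ u ← allPoints a ] ∑[ v ← allPoints (b + a * b) ] f (merge (i ∷ A) (c ∷ u) v)
    regroup c = begin
      ∑[ r ← allPoints b ] ∑[ u ← allPoints a ] ∑[ v ← allPoints (a * b) ] f (insertAt r i c ++ merge A u v)
        ≡⟨ ∑-swap (allPoints b) (allPoints a) _ ⟩
      ∑[ u ← allPoints a ] ∑[ r ← allPoints b ] ∑[ v ← allPoints (a * b) ] f (insertAt r i c ++ merge A u v)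
        ≡⟨ ∑-cong (allPoints a) (λ u → ∑-cong (allPoints b) (λ r → ∑-cong (allPoints (a * b)) (λ v →
             sym (cong₂ (λ r v → f (insertAt r i c ++ merge A u v)) (take-++ r v) (drop-++ r v))))) ⟩
      ∑[ u ← allPoints a ] ∑[ r ← allPoints b ] ∑[ v ← allPoints (a * b) ] f (merge (i ∷ A) (c ∷ u) (r ++ v))
        ≡⟨ sym (∑-cong (allPoints a) (λ u → ∑-cube-++ b (a * b) (λ v → f (merge (i ∷ A) (c ∷ u) v)))) ⟩
      ∑[ u ← allPoints a ] ∑[ v ← allPoints (b + a * b) ] f (merge (i ∷ A) (c ∷ u) v) ∎

  removeAt-zipWith : ∀ {X : Set} {n} (_∙_ : X → X → X) (x y : Vec X (suc n)) i →
    removeAt (zipWith _∙_ x y) i ≡ zipWith _∙_ (removeAt x i) (removeAt y i)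
  removeAt-zipWith _∙_ (b ∷ x)     (c ∷ y)     zero    = refl
  removeAt-zipWith _∙_ (b ∷ x@(_ ∷ _)) (c ∷ y@(_ ∷ _)) (suc i) = cong (b ∙ c ∷_) (removeAt-zipWith _∙_ x y i)

  zipWith-++ : ∀ {X : Set} {m n} (_∙_ : X → X → X) (x y : Vec X m) (x′ y′ : Vec X n) →
    zipWith _∙_ (x ++ x′) (y ++ y′) ≡ zipWith _∙_ x y ++ zipWith _∙_ x′ y′
  zipWith-++ _∙_ []      []      x′ y′ = refl
  zipWith-++ _∙_ (b ∷ x) (c ∷ y) x′ y′ = cong (b ∙ c ∷_) (zipWith-++ _∙_ x y x′ y′)

  action-zipWith : ∀ {a b} (_∙_ : Bool → Bool → Bool) (A : Vec (Fin (suc b)) a) x y →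
    action A (zipWith _∙_ x y) ≡ zipWith _∙_ (action A x) (action A y)
  action-zipWith         _∙_ []      x y = refl
  action-zipWith {b = b} _∙_ (i ∷ A) x y = cong₂ _∷_
    (trans (cong (λ r → lookup r i) (take-zipWith _∙_ x y)) (lookup-zipWith _∙_ i (take (suc b) x) (take (suc b) y)))
    (trans (cong (action A) (drop-zipWith {m = suc b} _∙_ x y)) (action-zipWith _∙_ A (drop (suc b) x) (drop (suc b) y)))

  control-zipWith : ∀ {a b} (_∙_ : Bool → Bool → Bool) (A : Vec (Fin (suc b)) a) x y →
    control A (zipWith _∙_ x y) ≡ zipWith _∙_ (control A x) (control A y)
  control-zipWith         _∙_ []      x y = refl
  control-zipWith {b = b} _∙_ (i ∷ A) x y = trans (cong₂ _++_
    (trans (cong (λ r → removeAt r i) (take-zipWith _∙_ x y)) (removeAt-zipWith _∙_ (take (suc b) x) (take (suc b) y) i))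
    (trans (cong (control A) (drop-zipWith {m = suc b} _∙_ x y)) (control-zipWith _∙_ A (drop (suc b) x) (drop (suc b) y))))
    (sym (zipWith-++ _∙_ (removeAt (take (suc b) x) i) (removeAt (take (suc b) y) i) _ _))

  Disjoint-take : ∀ m {n} {x y : Vec Bool (m + n)} → Disjoint x y → Disjoint (take m x) (take m y)
  Disjoint-take zero    d       = []
  Disjoint-take (suc m) {x = _ ∷ _} {_ ∷ _} (b ∷ d) = b ∷ Disjoint-take m d

  Disjoint-drop : ∀ m {n} {x y : Vec Bool (m + n)} → Disjoint x y → Disjoint (drop m x) (drop m y)
  Disjoint-drop zero    d       = d
  Disjoint-drop (suc m) {x = _ ∷ _} {_ ∷ _} (b ∷ d) = Disjoint-drop m d

  Disjoint-removeAt : ∀ {n} {x y : Vec Bool (suc n)} i → Disjoint x y → Disjoint (removeAt x i) (removeAt y i)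
  Disjoint-removeAt zero    (b ∷ d)     = d
  Disjoint-removeAt (suc i) (b ∷ c ∷ d) = b ∷ Disjoint-removeAt i (c ∷ d)

  Disjoint-insertAt : ∀ {n} {x y : Vec Bool n} i {b c} → b ∧ c ≡ false → Disjoint x y → Disjoint (insertAt x i b) (insertAt y i c)
  Disjoint-insertAt zero    e d       = e ∷ d
  Disjoint-insertAt (suc i) e (b ∷ d) = b ∷ Disjoint-insertAt i e d

  Disjoint-control : ∀ {a b} (A : Vec (Fin (suc b)) a) {x y} → Disjoint x y → Disjoint (control A x) (control A y)
  Disjoint-control         []      d = []
  Disjoint-control {b = b} (i ∷ A) d = Pointwise.++⁺ (Disjoint-removeAt i (Disjoint-take (suc b) d)) (Disjoint-control A (Disjoint-drop (suc b) d))

  Disjoint-merge : ∀ {a b} (A : Vec (Fin (suc b)) a) {u u′ v v′} → Disjoint u u′ → Disjoint v v′ → Disjoint (merge A u v) (merge A u′ v′)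
  Disjoint-merge         []      d       e = []
  Disjoint-merge {b = b} (i ∷ A) (c ∷ d) e = Pointwise.++⁺ (Disjoint-insertAt i c (Disjoint-take b e)) (Disjoint-merge A d (Disjoint-drop b e))

  Disjoint-∁ : ∀ {n} (v : Vec Bool n) → Disjoint v (∁ v)
  Disjoint-∁ []      = []
  Disjoint-∁ (b ∷ v) = ∧-inverseʳ b ∷ Disjoint-∁ v

  -- This is (y / (y + 1)) ^ wt v, multiplied by (y + 1)^n to stay in ℕ.
  weigh : ∀ {n} → ℕ → Vec Bool n → ℕ
  weigh y []          = 1
  weigh y (true ∷ v)  = y * weigh y v
  weigh y (false ∷ v) = suc y * weigh y v

  weigh-++ : ∀ {m n} y (v : Vec Bool m) (w : Vec Bool n) → weigh y (v ++ w) ≡ weigh y v * weigh y w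
  weigh-++ y []          w = sym (+-identityʳ _)
  weigh-++ y (true ∷ v)  w = trans (cong (y *_) (weigh-++ y v w)) (sym (*-assoc y (weigh y v) _))
  weigh-++ y (false ∷ v) w = trans (cong (suc y *_) (weigh-++ y v w)) (sym (*-assoc (suc y) (weigh y v) _))

  weigh-^ : ∀ {n} y (v : Vec Bool n) → weigh y v ≡ y ^ wt v * suc y ^ wt (∁ v)
  weigh-^ y []          = refl
  weigh-^ y (true ∷ v)  = trans (cong (y *_) (weigh-^ y v)) (sym (*-assoc y (y ^ wt v) _))
  weigh-^ y (false ∷ v) = trans (cong (suc y *_) (weigh-^ y v)) (lemma (suc y) (y ^ wt v) (suc y ^ wt (∁ v)))
    where
    lemma : ∀ x y z → x * (y * z) ≡ y * (x * z)
    lemma = solve-∀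

  -- The exponential moment contributed by one row of δ, summed over the place i that the secret
  -- picks in it.
  row-potential : ℕ → ∀ {n} → Vec Bool (suc n) → ℕ
  row-potential y {n} r = ∑[ i ← List.allFin (suc n) ] 2 ^ 𝟙 (lookup r i) * weigh y (removeAt r i)

  -- Removing a one divides `weigh` by y and removing a zero divides it by y + 1, so the sum is W (2
  -- wt r / y + wt (∁ r) / (y + 1)) for W = `weigh y r`. The factor y (y + 1) clears both
  -- denominators.
  row-potential-≡ : ∀ y {n} (r : Vec Bool (suc n)) →
    row-potential y r * (y * suc y) ≡ weigh y r * (2 * wt r * suc y + wt (∁ r) * y)
  row-potential-≡ y {zero}  (true ∷ [])  = lemma y
    where
    lemma : ∀ y → (2 * 1 * 1 + 0) * (y * suc y) ≡ y * 1 * (2 * 1 * suc y + 0 * y)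
    lemma = solve-∀
  row-potential-≡ y {zero}  (false ∷ []) = lemma y
    where
    lemma : ∀ y → (1 * 1 + 0) * (y * suc y) ≡ suc y * 1 * (2 * 0 * suc y + 1 * y)
    lemma = solve-∀
  row-potential-≡ y {suc n} (true ∷ r@(_ ∷ _)) = begin
    row-potential y (true ∷ r) * (y * suc y)
      ≡⟨ cong (_* (y * suc y)) (trans (∑-allFin (suc n) (λ i → 2 ^ 𝟙 (lookup (true ∷ r) i) * weigh y (removeAt (true ∷ r) i))) (cong (2 * W +_)
           (trans (∑-cong (List.allFin (suc n)) (λ i → swap (2 ^ 𝟙 (lookup r i)) y (weigh y (removeAt r i)))) (∑-*ˡ (List.allFin (suc n)) y _)))) ⟩
    (2 * W + y * E) * (y * suc y)
      ≡⟨ lemma₁ y W E ⟩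
    2 * W * (y * suc y) + y * (E * (y * suc y))
      ≡⟨ cong (λ z → 2 * W * (y * suc y) + y * z) (row-potential-≡ y r) ⟩
    2 * W * (y * suc y) + y * (W * (2 * wt r * suc y + wt (∁ r) * y))
      ≡⟨ lemma₂ y W (wt r) (wt (∁ r)) ⟩
    y * W * (2 * suc (wt r) * suc y + wt (∁ r) * y) ∎
    where
    open ≡-Reasoning
    W = weigh y r
    E = row-potential y r
    swap : ∀ x y z → x * (y * z) ≡ y * (x * z)
    swap = solve-∀
    lemma₁ : ∀ y w e → (2 * w + y * e) * (y * suc y) ≡ 2 * w * (y * suc y) + y * (e * (y * suc y))
    lemma₁ = solve-∀
    lemma₂ : ∀ y w d e → 2 * w * (y * suc y) + y * (w * (2 * d * suc y + e * y)) ≡ y * w * (2 * suc d * suc y + e * y)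
    lemma₂ = solve-∀
  row-potential-≡ y {suc n} (false ∷ r@(_ ∷ _)) = begin
    row-potential y (false ∷ r) * (y * suc y)
      ≡⟨ cong (_* (y * suc y)) (trans (∑-allFin (suc n) (λ i → 2 ^ 𝟙 (lookup (false ∷ r) i) * weigh y (removeAt (false ∷ r) i))) (cong (1 * W +_)
           (trans (∑-cong (List.allFin (suc n)) (λ i → swap (2 ^ 𝟙 (lookup r i)) (suc y) (weigh y (removeAt r i)))) (∑-*ˡ (List.allFin (suc n)) (suc y) _)))) ⟩
    (1 * W + suc y * E) * (y * suc y)
      ≡⟨ lemma₁ y W E ⟩
    W * (y * suc y) + suc y * (E * (y * suc y))
      ≡⟨ cong (λ z → W * (y * suc y) + suc y * z) (row-potential-≡ y r) ⟩
    W * (y * suc y) + suc y * (W * (2 * wt r * suc y + wt (∁ r) * y))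
      ≡⟨ lemma₂ y W (wt r) (wt (∁ r)) ⟩
    suc y * W * (2 * wt r * suc y + suc (wt (∁ r)) * y) ∎
    where
    open ≡-Reasoning
    W = weigh y r
    E = row-potential y r
    swap : ∀ x y z → x * (y * z) ≡ y * (x * z)
    swap = solve-∀
    lemma₁ : ∀ y w e → (1 * w + suc y * e) * (y * suc y) ≡ w * (y * suc y) + suc y * (e * (y * suc y))
    lemma₁ = solve-∀
    lemma₂ : ∀ y w d e → w * (y * suc y) + suc y * (w * (2 * d * suc y + e * y)) ≡ suc y * w * (2 * d * suc y + suc e * y)
    lemma₂ = solve-∀

  -- What `row-potential-≤` requires of a row with d + 1 ones once the common factors are cancelled:
  -- a Bernoulli inequality for 2 (y + 1)² (1 + 1/y)^d.
  ^-Bernoulli-quadratic : ∀ y d → y ^ d * (2 * (y * y) + 3 * y + 2 + d * (y + 2)) ≤ 2 * suc y ^ suc (suc d)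
  ^-Bernoulli-quadratic y zero    = ≤-trans (m≤m+n _ y) (≤-reflexive (lemma y))
    where
    lemma : ∀ y → 1 * (2 * (y * y) + 3 * y + 2 + 0 * (y + 2)) + y ≡ 2 * (suc y * (suc y * 1))
    lemma = solve-∀
  ^-Bernoulli-quadratic y (suc d) = begin
    y * y ^ d * (2 * (y * y) + 3 * y + 2 + suc d * (y + 2))  ≤⟨ m≤m+n _ (y ^ d * (y * y + y + 2 + d * (y + 2))) ⟩
    y * y ^ d * (2 * (y * y) + 3 * y + 2 + suc d * (y + 2)) + y ^ d * (y * y + y + 2 + d * (y + 2))
                                                             ≡⟨ lemma y d (y ^ d) ⟩
    suc y * (y ^ d * (2 * (y * y) + 3 * y + 2 + d * (y + 2))) ≤⟨ *-monoʳ-≤ (suc y) (^-Bernoulli-quadratic y d) ⟩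
    suc y * (2 * suc y ^ suc (suc d))                        ≡⟨ swap (suc y) (suc y ^ suc (suc d)) ⟩
    2 * (suc y * suc y ^ suc (suc d))                        ∎
    where
    open ≤-Reasoning
    lemma : ∀ y d z → y * z * (2 * (y * y) + 3 * y + 2 + suc d * (y + 2)) + z * (y * y + y + 2 + d * (y + 2))
                      ≡ suc y * (z * (2 * (y * y) + 3 * y + 2 + d * (y + 2)))
    lemma = solve-∀
    swap : ∀ x y → x * (2 * y) ≡ 2 * (x * y)
    swap = solve-∀

  -- No row can make the potential grow on average. If d of its 2 (y + 1) entries are ones, the
  -- picked entry gains a factor 1 + d / (2 (y + 1)), while the discount on the remaining ones is
  -- about 1 - d / (y + 1), which outweighs the gain. A row of zeros gives equality.
  row-potential-≤ : ∀ y .{{_ : NonZero y}} (r : Vec Bool (suc (suc (2 * y)))) →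
    row-potential y r ≤ suc (suc (2 * y)) * suc y ^ suc (2 * y)
  row-potential-≤ y r = *-cancelʳ-≤ _ _ (y * suc y) {{m*n≢0 y (suc y)}} (begin
    row-potential y r * (y * suc y)                                  ≡⟨ row-potential-≡ y r ⟩
    weigh y r * (2 * wt r * suc y + wt (∁ r) * y)                    ≡⟨ cong (_* (2 * wt r * suc y + wt (∁ r) * y)) (weigh-^ y r) ⟩
    y ^ wt r * suc y ^ wt (∁ r) * (2 * wt r * suc y + wt (∁ r) * y)  ≤⟨ bound (wt r) (wt (∁ r)) (wt-∁ r) ⟩
    suc (suc (2 * y)) * suc y ^ suc (2 * y) * (y * suc y)            ∎)
    where
    open ≤-Reasoning
    bound : ∀ d e → d + e ≡ suc (suc (2 * y)) →
            y ^ d * suc y ^ e * (2 * d * suc y + e * y) ≤ suc (suc (2 * y)) * suc y ^ suc (2 * y) * (y * suc y)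
    bound zero    e refl = ≤-reflexive (lemma y (suc y ^ suc (2 * y)))
      where
      lemma : ∀ y z → 1 * (suc y * z) * (2 * 0 * suc y + suc (suc (2 * y)) * y) ≡ suc (suc (2 * y)) * z * (y * suc y)
      lemma = solve-∀
    bound (suc d) e eq = begin
      y * y ^ d * suc y ^ e * (2 * suc d * suc y + e * y)
        ≡⟨ lemma₀ y (y ^ d) (suc y ^ e) (2 * suc d * suc y + e * y) ⟩
      y * suc y ^ e * (y ^ d * (2 * suc d * suc y + e * y))
        ≡⟨ cong (λ z → y * suc y ^ e * (y ^ d * z)) (+-cancelʳ-≡ (d * y) _ _ (trans (lemma₁ y d e) (trans (cong (λ z → 2 * suc d * suc y + z * y) (suc-injective eq)) (lemma₂ y d)))) ⟩
      y * suc y ^ e * (y ^ d * (2 * (y * y) + 3 * y + 2 + d * (y + 2)))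
        ≤⟨ *-monoʳ-≤ (y * suc y ^ e) (^-Bernoulli-quadratic y d) ⟩
      y * suc y ^ e * (2 * (suc y * (suc y * suc y ^ d)))
        ≡⟨ lemma₃ y (suc y ^ e) (suc y ^ d) ⟩
      suc (suc (2 * y)) * (suc y ^ d * suc y ^ e) * (y * suc y)
        ≡⟨ cong (λ z → suc (suc (2 * y)) * z * (y * suc y)) (trans (sym (^-distribˡ-+-* (suc y) d e)) (cong (suc y ^_) (suc-injective eq))) ⟩
      suc (suc (2 * y)) * suc y ^ suc (2 * y) * (y * suc y) ∎
      where
      lemma₀ : ∀ y p q z → y * p * q * z ≡ y * q * (p * z)
      lemma₀ = solve-∀
      lemma₁ : ∀ y d e → 2 * suc d * suc y + e * y + d * y ≡ 2 * suc d * suc y + (d + e) * y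
      lemma₁ = solve-∀
      lemma₂ : ∀ y d → 2 * suc d * suc y + suc (2 * y) * y ≡ 2 * (y * y) + 3 * y + 2 + d * (y + 2) + d * y
      lemma₂ = solve-∀
      lemma₃ : ∀ y q p → y * q * (2 * (suc y * (suc y * p))) ≡ suc (suc (2 * y)) * (p * q) * (y * suc y)
      lemma₃ = solve-∀

  -- One pick per row, rather than a random set of a coordinates, keeps the picks independent; the
  -- exponential moment then factorises over the rows.
  secrets : ∀ a b → List (Vec (Fin (suc b)) a)
  secrets a b = vecs (List.allFin (suc b)) a

  length-secrets : ∀ a b → length (secrets a b) ≡ suc b ^ a
  length-secrets a b = trans (length-vecs (List.allFin (suc b)) a) (cong (_^ a) (length-tabulate {n = suc b} id))

  -- The exponential moment E_A[2^{d_A} (y/(y+1))^{d_C}] ≤ 1, where d_A and d_C count the picked and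
  -- the remaining positions of δ, and rows have length 2(y+1).
  potential-≤ : ∀ y .{{_ : NonZero y}} a (δ : Vec Bool (a * suc (suc (2 * y)))) →
    ∑[ A ← secrets a (suc (2 * y)) ] 2 ^ wt (action A δ) * weigh y (control A δ)
    ≤ suc (suc (2 * y)) ^ a * suc y ^ (a * suc (2 * y))
  potential-≤ y zero    δ = ≤-refl
  potential-≤ y (suc a) δ = begin
    ∑[ A ← secrets (suc a) b ] 2 ^ wt (action A δ) * weigh y (control A δ)
      ≡⟨ ∑-vecs (List.allFin (suc b)) a _ ⟩
    ∑[ i ← List.allFin (suc b) ] ∑[ A ← secrets a b ]
      2 ^ (𝟙 (lookup r i) + wt (action A δ′)) * weigh y (removeAt r i ++ control A δ′)
      ≡⟨ ∑-cong (List.allFin (suc b)) (λ i → trans (∑-cong (secrets a b) (λ A →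
           trans (cong₂ _*_ (^-distribˡ-+-* 2 (𝟙 (lookup r i)) (wt (action A δ′))) (weigh-++ y (removeAt r i) (control A δ′)))
                 (interchange (2 ^ 𝟙 (lookup r i)) (2 ^ wt (action A δ′)) _ _)))
           (∑-*ˡ (secrets a b) (2 ^ 𝟙 (lookup r i) * weigh y (removeAt r i)) (λ A → 2 ^ wt (action A δ′) * weigh y (control A δ′)))) ⟩
    ∑[ i ← List.allFin (suc b) ] 2 ^ 𝟙 (lookup r i) * weigh y (removeAt r i) * P
      ≡⟨ ∑-*ʳ (List.allFin (suc b)) (λ i → 2 ^ 𝟙 (lookup r i) * weigh y (removeAt r i)) P ⟩
    row-potential y r * P
      ≤⟨ *-mono-≤ (row-potential-≤ y r) (potential-≤ y a δ′) ⟩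
    suc b * suc y ^ b * (suc b ^ a * suc y ^ (a * b))
      ≡⟨ interchange (suc b) (suc y ^ b) (suc b ^ a) _ ⟩
    suc b * suc b ^ a * (suc y ^ b * suc y ^ (a * b))
      ≡⟨ cong (suc b * suc b ^ a *_) (sym (^-distribˡ-+-* (suc y) b (a * b))) ⟩
    suc b ^ suc a * suc y ^ (b + a * b) ∎
    where
    open ≤-Reasoning
    b = suc (2 * y)
    r = take (suc b) δ
    δ′ = drop (suc b) δ
    P = ∑[ A ← secrets a b ] 2 ^ wt (action A δ′) * weigh y (control A δ′)
    interchange : ∀ x y z w → x * y * (z * w) ≡ x * z * (y * w)
    interchange = solve-∀

  near : ∀ {a b} → ℕ → ℕ → Vec Bool (a * suc b) → Vec (Fin (suc b)) a → Bool
  near s D δ A = (2 * s ≤ᵇ wt (action A δ)) ∧ (wt (control A δ) ≤ᵇ D)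

  -- Markov's inequality for `potential-≤`. On the event, the picked positions contribute at least
  -- 2^(2s). At most s β positions remain, and each group of β costs a factor (1 - 1/(2β))^β ≥ 1/2,
  -- so the discount is at least 2^-s and the potential at least 2^s.
  near-mass : ∀ s β y .{{_ : NonZero y}} → suc y ≡ 2 * β → ∀ a (δ : Vec Bool (a * suc (suc (2 * y)))) →
    2 ^ s * (∑[ A ← secrets a (suc (2 * y)) ] 𝟙 (near s (s * β) δ A)) ≤ suc (suc (2 * y)) ^ a
  near-mass s β y Y≡2β a δ = *-cancelʳ-≤ _ _ (Y ^ m) {{>-nonZero (m^n>0 Y m)}} (begin
    2 ^ s * (∑ (secrets a b) (𝟙 ∘ near s D δ)) * Y ^ m           ≡⟨ lemma₁ (2 ^ s) _ (Y ^ m) ⟩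
    2 ^ s * Y ^ m * (∑ (secrets a b) (𝟙 ∘ near s D δ))           ≡⟨ sym (∑-*ˡ (secrets a b) (2 ^ s * Y ^ m) (𝟙 ∘ near s D δ)) ⟩
    ∑[ A ← secrets a b ] 2 ^ s * Y ^ m * 𝟙 (near s D δ A)        ≤⟨ ∑-mono (secrets a b) pointwise ⟩
    ∑[ A ← secrets a b ] 2 ^ wt (action A δ) * weigh y (control A δ) ≤⟨ potential-≤ y a δ ⟩
    suc b ^ a * Y ^ m                                            ∎)
    where
    open ≤-Reasoning
    Y = suc y
    b = suc (2 * y)
    m = a * b
    D = s * β
    lemma₁ : ∀ x y z → x * y * z ≡ x * z * y
    lemma₁ = solve-∀
    y+1 : y + 1 ≡ Y
    y+1 = +-comm y 1
    Y^D≤ : Y ^ D ≤ 2 ^ s * y ^ D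
    Y^D≤ = begin
      Y ^ (s * β)              ≡⟨ cong (Y ^_) (*-comm s β) ⟩
      Y ^ (β * s)              ≡⟨ sym (^-*-assoc Y β s) ⟩
      (Y ^ β) ^ s              ≤⟨ ^-monoˡ-≤ s (subst (λ z → z ^ β ≤ 2 * y ^ β) y+1
                                   (^-half-Bernoulli y 1 β {{>-nonZero (m≤n+m 1 y)}}
                                     (≤-reflexive (trans (cong (2 *_) (*-identityʳ β)) (trans (sym Y≡2β) (sym y+1)))))) ⟩
      (2 * y ^ β) ^ s          ≡⟨ ^-distribˡ-* 2 (y ^ β) s ⟩
      2 ^ s * (y ^ β) ^ s      ≡⟨ cong (2 ^ s *_) (^-*-assoc y β s) ⟩
      2 ^ s * y ^ (β * s)      ≡⟨ cong (λ e → 2 ^ s * y ^ e) (*-comm β s) ⟩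
      2 ^ s * y ^ (s * β)      ∎
    light : ∀ (c : Vec Bool m) → wt c ≤ D → Y ^ m ≤ 2 ^ s * weigh y c
    light c wc≤D = *-cancelʳ-≤ _ _ (Y ^ D) {{>-nonZero (m^n>0 Y D)}} (begin
      Y ^ m * Y ^ D                          ≤⟨ *-monoʳ-≤ (Y ^ m) Y^D≤ ⟩
      Y ^ m * (2 ^ s * y ^ D)                ≡⟨ cong₂ (λ i j → Y ^ i * (2 ^ s * y ^ j)) (sym (wt-∁ c)) (sym (m+[n∸m]≡n wc≤D)) ⟩
      Y ^ (d + e) * (2 ^ s * y ^ (d + k))    ≡⟨ cong₂ (λ i j → i * (2 ^ s * j)) (^-distribˡ-+-* Y d e) (^-distribˡ-+-* y d k) ⟩
      Y ^ d * Y ^ e * (2 ^ s * (y ^ d * y ^ k)) ≤⟨ *-monoʳ-≤ (Y ^ d * Y ^ e) (*-monoʳ-≤ (2 ^ s) (*-monoʳ-≤ (y ^ d) (^-monoˡ-≤ k (n≤1+n y)))) ⟩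
      Y ^ d * Y ^ e * (2 ^ s * (y ^ d * Y ^ k)) ≡⟨ lemma₂ (Y ^ d) (Y ^ e) (2 ^ s) (y ^ d) (Y ^ k) ⟩
      2 ^ s * (y ^ d * Y ^ e) * (Y ^ d * Y ^ k) ≡⟨ cong₂ (λ i j → 2 ^ s * i * j) (sym (weigh-^ y c))
                                                     (trans (sym (^-distribˡ-+-* Y d k)) (cong (Y ^_) (m+[n∸m]≡n wc≤D))) ⟩
      2 ^ s * weigh y c * Y ^ D              ∎)
      where
      d = wt c
      e = wt (∁ c)
      k = D ∸ d
      lemma₂ : ∀ p q z r t → p * q * (z * (r * t)) ≡ z * (r * q) * (p * t)
      lemma₂ = solve-∀
    pointwise : ∀ A → 2 ^ s * Y ^ m * 𝟙 (near s D δ A) ≤ 2 ^ wt (action A δ) * weigh y (control A δ)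
    pointwise A = *-𝟙-elim (near s D δ A) λ t → bound (Equivalence.to (T-∧ {2 * s ≤ᵇ wt (action A δ)}) t)
      where
      bound : T (2 * s ≤ᵇ wt (action A δ)) × T (wt (control A δ) ≤ᵇ D) →
              2 ^ s * Y ^ m ≤ 2 ^ wt (action A δ) * weigh y (control A δ)
      bound (t₁ , t₂) = begin
        2 ^ s * Y ^ m                                ≤⟨ *-monoʳ-≤ (2 ^ s) (light (control A δ) (≤ᵇ⇒≤ _ _ t₂)) ⟩
        2 ^ s * (2 ^ s * weigh y (control A δ))      ≡⟨ sym (*-assoc (2 ^ s) (2 ^ s) _) ⟩
        2 ^ s * 2 ^ s * weigh y (control A δ)        ≡⟨ cong (_* weigh y (control A δ)) (trans (sym (^-distribˡ-+-* 2 s s)) (cong (2 ^_) (cong (s +_) (sym (+-identityʳ s))))) ⟩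
        2 ^ (2 * s) * weigh y (control A δ)          ≤⟨ *-monoˡ-≤ (weigh y (control A δ)) (^-monoʳ-≤ 2 (≤ᵇ⇒≤ (2 * s) (wt (action A δ)) t₁)) ⟩
        2 ^ wt (action A δ) * weigh y (control A δ)  ∎

  -- Conflicts between queries

  agree : Bool → Bool → Bool
  agree b c = not (b xor c)

  wt-agree : ∀ {n} (u v : Vec Bool n) → n ≤ wt (zipWith agree u v) + (wt u + wt v)
  wt-agree []          []          = z≤n
  wt-agree (true ∷ u)  (true ∷ v)  = s≤s (≤-trans (wt-agree u v) (+-monoʳ-≤ _ (+-mono-≤ (n≤1+n (wt u)) (n≤1+n (wt v)))))
  wt-agree (true ∷ u)  (false ∷ v) = ≤-trans (s≤s (wt-agree u v)) (≤-reflexive (sym (+-suc _ _)))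
  wt-agree (false ∷ u) (true ∷ v)  = ≤-trans (s≤s (wt-agree u v)) (≤-reflexive (trans (sym (+-suc _ _)) (cong (wt (zipWith agree u v) +_) (sym (+-suc (wt u) _)))))
  wt-agree (false ∷ u) (false ∷ v) = s≤s (wt-agree u v)

  -- On the right, a coordinate with u = 1 and v = 0 counts twice, an agreement once and the
  -- remaining kind not at all. Agreements therefore measure how far the meet of u and `∁ v` falls
  -- below the average of their weights.
  wt-meet : ∀ {n} (u v : Vec Bool n) → 2 * wt (zipWith _∧_ u (∁ v)) + wt (zipWith agree u v) ≡ wt u + wt (∁ v)
  wt-meet []          []          = refl
  wt-meet (true ∷ u)  (true ∷ v)  = trans (+-suc _ _) (cong suc (wt-meet u v))
  wt-meet (true ∷ u)  (false ∷ v) = trans (lemma (wt (zipWith _∧_ u (∁ v))) _) (cong suc (trans (cong suc (wt-meet u v)) (sym (+-suc (wt u) _))))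
    where
    lemma : ∀ x y → 2 * suc x + y ≡ suc (suc (2 * x + y))
    lemma = solve-∀
  wt-meet (false ∷ u) (true ∷ v)  = wt-meet u v
  wt-meet (false ∷ u) (false ∷ v) = trans (+-suc _ _) (trans (cong suc (wt-meet u v)) (sym (+-suc (wt u) _)))

  -- The hard functions cut control parts only from above, at the middle. The band enters through
  -- the count of points that certify the distance.
  half : ∀ {m} → Vec Bool m → Bool
  half {m} v = 2 * wt v ≤ᵇ m

  low⇒ : ∀ {n} s (u : Vec Bool n) → T (low s u) → 2 * (wt u + s) ≤ n
  low⇒ s u = ≤ᵇ⇒≤ _ _

  half⇒ : ∀ {m} (v : Vec Bool m) → T (half v) → 2 * wt v ≤ m
  half⇒ v = ≤ᵇ⇒≤ _ _

  -- An α-point has action part u and control part v, a γ-point action part u′ and control part w,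
  -- where w is already complemented: disjointness of the two points means v ≤ w.
  conflict : ∀ {a m r L} → ℕ → (u u′ : Vec Bool a) (v w : Vec Bool m) → Vec (Vec (Fin m) r) L → Bool
  conflict s u u′ v w τs = ((low s u ∧ low s u′) ∧ (half v ∧ half w)) ∧ sameKey (key τs v) (key τs w)

  -- Split the secrets by the number of control agreements of p and q. If there are at most D = s β,
  -- the light action parts force 2s picked agreements, and such secrets are rare by `near-mass`. If
  -- there are more, the meet of the control parts is too light for a common key, and such terms are
  -- rare by `sameKey-mass`. Each case contributes a 2^-s fraction.
  conflict-mass : ∀ s β x y .{{_ : NonZero s}} .{{_ : NonZero y}} → suc x ≡ 64 * s → suc y ≡ 2 * β →
    let a = 16 * (s * s) ; b = suc (2 * y) ; m = a * b ; t = s * suc x ; Ω = vecs (terms m (suc t)) (2 ^ t) in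
    ∀ (p q : Vec Bool (a * suc b)) →
    2 ^ s * (∑[ A ← secrets a b ] ∑[ τs ← Ω ] 𝟙 (conflict s (action A p) (action A q) (control A p) (∁ (control A q)) τs))
    ≤ 2 * (length (secrets a b) * length Ω)
  conflict-mass s β x y x≡ y≡ p q = begin
    2 ^ s * (∑[ A ← secrets a b ] ∑[ τs ← Ω ] 𝟙 (cf A τs))
      ≡⟨ sym (∑-*ˡ (secrets a b) (2 ^ s) (λ A → ∑[ τs ← Ω ] 𝟙 (cf A τs))) ⟩
    ∑[ A ← secrets a b ] 2 ^ s * (∑[ τs ← Ω ] 𝟙 (cf A τs))
      ≤⟨ ∑-mono (secrets a b) secret ⟩
    ∑[ A ← secrets a b ] (2 ^ s * 𝟙 (near s D δ A) * length Ω + length Ω)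
      ≡⟨ trans (∑-+ (secrets a b) (λ A → 2 ^ s * 𝟙 (near s D δ A) * length Ω) (λ _ → length Ω))
           (cong₂ _+_ (trans (∑-*ʳ (secrets a b) (λ A → 2 ^ s * 𝟙 (near s D δ A)) (length Ω))
                        (cong (_* length Ω) (∑-*ˡ (secrets a b) (2 ^ s) (𝟙 ∘ near s D δ))))
                      (∑-const (secrets a b) (length Ω))) ⟩
    2 ^ s * ∑ (secrets a b) (𝟙 ∘ near s D δ) * length Ω + length (secrets a b) * length Ω
      ≤⟨ +-monoˡ-≤ _ (*-monoˡ-≤ (length Ω) (≤-trans (near-mass s β y y≡ a δ) (≤-reflexive (sym (length-secrets a b))))) ⟩
    length (secrets a b) * length Ω + length (secrets a b) * length Ω
      ≡⟨ cong (length (secrets a b) * length Ω +_) (sym (+-identityʳ _)) ⟩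
    2 * (length (secrets a b) * length Ω) ∎
    where
    open ≤-Reasoning
    a = 16 * (s * s)
    b = suc (2 * y)
    m = a * b
    t = s * suc x
    Ω = vecs (terms m (suc t)) (2 ^ t)
    D = s * β
    δ = zipWith agree p q
    m≢0 : NonZero m
    m≢0 = m*n≢0 a b {{m*n≢0 16 (s * s) {{_}} {{m*n≢0 s s}}}}
    cf : Vec (Fin (suc b)) a → Vec (Vec (Fin m) (suc t)) (2 ^ t) → Bool
    cf A τs = conflict s (action A p) (action A q) (control A p) (∁ (control A q)) τs
    len : length Ω ≡ (m ^ suc t) ^ (2 ^ t)
    len = trans (length-vecs (terms m (suc t)) (2 ^ t)) (cong (_^ (2 ^ t)) (length-terms m (suc t)))
    -- A row has 4β coordinates, so all rows together have 16 s² · 4β = 64 s · s β, that is h D.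
    -- This fixes h = 64 s: more than D agreements are more than a 1/h share of m.
    m≤hD : m ≤ suc x * D
    m≤hD = begin
      16 * (s * s) * b          ≤⟨ *-monoʳ-≤ (16 * (s * s)) (n≤1+n b) ⟩
      16 * (s * s) * suc b      ≡⟨ cong (16 * (s * s) *_) (trans (lemma₀ y) (cong (2 *_) y≡)) ⟩
      16 * (s * s) * (2 * (2 * β)) ≡⟨ lemma₁ s β ⟩
      64 * s * (s * β)          ≡⟨ cong (_* (s * β)) (sym x≡) ⟩
      suc x * (s * β)           ∎
      where
      lemma₀ : ∀ y → suc (suc (2 * y)) ≡ 2 * suc y
      lemma₀ = solve-∀
      lemma₁ : ∀ s β → 16 * (s * s) * (2 * (2 * β)) ≡ 64 * s * (s * β)
      lemma₁ = solve-∀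
    secret : ∀ A → 2 ^ s * (∑[ τs ← Ω ] 𝟙 (cf A τs)) ≤ 2 ^ s * 𝟙 (near s D δ A) * length Ω + length Ω
    secret A = cases guard refl
      where
      u = action A p
      u′ = action A q
      v = control A p
      w = ∁ (control A q)
      guard = (low s u ∧ low s u′) ∧ (half v ∧ half w)
      actionδ : action A δ ≡ zipWith agree u u′
      actionδ = action-zipWith agree A p q
      controlδ : control A δ ≡ zipWith agree v (control A q)
      controlδ = control-zipWith agree A p q
      apart : T (low s u) → T (low s u′) → 2 * s ≤ wt (action A δ)
      apart lu lu′ = subst (λ z → 2 * s ≤ wt z) (sym actionδ)
        (*-cancelˡ-≤ 2 (+-cancelʳ-≤ (2 * (wt u + wt u′)) _ _ (begin
          2 * (2 * s) + 2 * (wt u + wt u′)        ≡⟨ lemma₁ s (wt u) (wt u′) ⟩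
          2 * (wt u + s) + 2 * (wt u′ + s)        ≤⟨ +-mono-≤ (low⇒ s u lu) (low⇒ s u′ lu′) ⟩
          a + a                                   ≡⟨ lemma₂ a ⟩
          2 * a                                   ≤⟨ *-monoʳ-≤ 2 (wt-agree u u′) ⟩
          2 * (wt (zipWith agree u u′) + (wt u + wt u′)) ≡⟨ *-distribˡ-+ 2 (wt (zipWith agree u u′)) _ ⟩
          2 * wt (zipWith agree u u′) + 2 * (wt u + wt u′) ∎)))
        where
        lemma₁ : ∀ s u v → 2 * (2 * s) + 2 * (u + v) ≡ 2 * (u + s) + 2 * (v + s)
        lemma₁ = solve-∀
        lemma₂ : ∀ a → a + a ≡ 2 * a
        lemma₂ = solve-∀
      separated : T (half v) → T (half w) → D < wt (control A δ) → suc x * (2 * wt (zipWith _∧_ v w)) ≤ x * m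
      separated hv hw D<d = +-cancelʳ-≤ (suc x * D) _ _ (begin
        suc x * z + suc x * D      ≡⟨ sym (*-distribˡ-+ (suc x) z D) ⟩
        suc x * (z + D)            ≤⟨ *-monoʳ-≤ (suc x) z+D≤m ⟩
        suc x * m                  ≡⟨ +-comm m (x * m) ⟩
        x * m + m                  ≤⟨ +-monoʳ-≤ (x * m) m≤hD ⟩
        x * m + suc x * D          ∎)
        where
        z = 2 * wt (zipWith _∧_ v w)
        lemma : ∀ z → 2 * z ≡ z + z
        lemma = solve-∀
        z+D≤m : z + D ≤ m
        z+D≤m = *-cancelˡ-≤ 2 (begin
          2 * (z + D)                              ≤⟨ *-monoʳ-≤ 2 (+-monoʳ-≤ z (<⇒≤ D<d)) ⟩
          2 * (z + wt (control A δ))               ≡⟨ cong (λ c → 2 * (z + wt c)) controlδ ⟩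
          2 * (z + wt (zipWith agree v (control A q))) ≡⟨ cong (2 *_) (wt-meet v (control A q)) ⟩
          2 * (wt v + wt w)                        ≡⟨ *-distribˡ-+ 2 (wt v) (wt w) ⟩
          2 * wt v + 2 * wt w                      ≤⟨ +-mono-≤ (half⇒ v hv) (half⇒ w hw) ⟩
          m + m                                    ≡⟨ sym (lemma m) ⟩
          2 * m                                    ∎)
      split : T guard → (T (low s u) × T (low s u′)) × (T (half v) × T (half w))
      split t with Equivalence.to (T-∧ {low s u ∧ low s u′}) t
      ... | t₁ , t₂ = Equivalence.to (T-∧ {low s u}) t₁ , Equivalence.to (T-∧ {half v}) t₂
      cases : (g : Bool) → guard ≡ g →
        2 ^ s * (∑[ τs ← Ω ] 𝟙 (guard ∧ sameKey (key τs v) (key τs w))) ≤ 2 ^ s * 𝟙 (near s D δ A) * length Ω + length Ω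
      cases false eq = ≤-trans (≤-reflexive (trans (cong (2 ^ s *_)
        (trans (∑-cong Ω (λ τs → cong (λ g → 𝟙 (g ∧ sameKey (key τs v) (key τs w))) eq)) (∑-zero Ω))) (*-zeroʳ (2 ^ s)))) z≤n
      cases true eq with split (subst T (sym eq) _) | wt (control A δ) ≤? D
      ... | (lu , lu′) , (hv , hw) | yes d≤D = begin
        2 ^ s * (∑[ τs ← Ω ] 𝟙 (guard ∧ sameKey (key τs v) (key τs w)))
          ≤⟨ *-monoʳ-≤ (2 ^ s) (∑-mono Ω (λ τs → 𝟙≤1 (guard ∧ sameKey (key τs v) (key τs w)))) ⟩
        2 ^ s * (∑[ τs ← Ω ] 1)
          ≡⟨ cong (2 ^ s *_) (sym (length≡∑1 Ω)) ⟩
        2 ^ s * length Ω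
          ≡⟨ cong (_* length Ω) (sym (trans (cong (2 ^ s *_) (𝟙-intro isNear)) (*-identityʳ (2 ^ s)))) ⟩
        2 ^ s * 𝟙 (near s D δ A) * length Ω
          ≤⟨ m≤m+n _ _ ⟩
        2 ^ s * 𝟙 (near s D δ A) * length Ω + length Ω ∎
        where
        isNear : T (near s D δ A)
        isNear = Equivalence.from (T-∧ {2 * s ≤ᵇ wt (action A δ)}) (≤⇒≤ᵇ (apart lu lu′) , ≤⇒≤ᵇ d≤D)
      ... | _ , (hv , hw) | no d≰D = begin
        2 ^ s * (∑[ τs ← Ω ] 𝟙 (guard ∧ sameKey (key τs v) (key τs w)))
          ≡⟨ cong (2 ^ s *_) (∑-cong Ω (λ τs → cong (λ g → 𝟙 (g ∧ sameKey (key τs v) (key τs w))) eq)) ⟩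
        2 ^ s * (∑[ τs ← Ω ] 𝟙 (sameKey (key τs v) (key τs w)))
          ≤⟨ sameKey-mass m s x v w {{m≢0}} (separated hv hw (≰⇒> d≰D)) ⟩
        (m ^ suc t) ^ (2 ^ t)
          ≡⟨ sym len ⟩
        length Ω
          ≤⟨ m≤n+m _ _ ⟩
        2 ^ s * 𝟙 (near s D δ A) * length Ω + length Ω ∎

  -- The hard functions

  orient : ∀ {m} → Bool → Vec Bool m → Vec Bool m
  orient γ v = if γ then ∁ v else v

  verdict : ∀ {L} → Maybe (Fin L) → Vec Bool L → Bool → Bool
  verdict nothing  bits c = false
  verdict (just i) bits c = lookup bits i xor c

  -- Whatever the bit of a term is, exactly one parity e turns it into 1 at α-points. In the far
  -- case the same parity does so at γ-points, in the intersecting case the other one.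
  core : ∀ {a b r L} → Bool → ℕ → Vec (Fin (suc b)) a → Vec (Vec (Fin (a * b)) r) L → Vec Bool L →
         Bool → Bool → Vec Bool (a * suc b) → Bool
  core yes? s A τs bits γ e x =
    (low s (action A x) ∧ half (orient γ (control A x))) ∧
    verdict (key τs (orient γ (control A x))) bits (e xor (γ ∧ yes?))

  -- The first four coordinates 1 0 ē e mark α-points with parity e, and 0 1 e ē γ-points with parity
  -- e; only an α-point and a γ-point of equal parity can be disjoint.
  hard : ∀ {a b r L} ℓ → Bool → ℕ → Vec (Fin (suc b)) a → Vec (Vec (Fin (a * b)) r) L → Vec Bool L →
         BoolFun (4 + (ℓ + a * suc b))
  hard ℓ yes? s A τs bits (w₁ ∷ w₂ ∷ w₃ ∷ w₄ ∷ z) =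
    ((w₁ xor w₂) ∧ (w₃ xor w₄)) ∧ core yes? s A τs bits w₂ (w₄ xor w₂) (drop ℓ z)

  meet? : ∀ {n} (x y : Vec Bool n) → (∃ λ i → lookup x i ≡ true × lookup y i ≡ true) ⊎ Disjoint x y
  meet? []          []          = inj₂ []
  meet? (true ∷ x)  (true ∷ y)  = inj₁ (zero , refl , refl)
  meet? (true ∷ x)  (false ∷ y) with meet? x y
  ... | inj₁ (i , p) = inj₁ (suc i , p)
  ... | inj₂ d       = inj₂ (refl ∷ d)
  meet? (false ∷ x) (c ∷ y)     with meet? x y
  ... | inj₁ (i , p) = inj₁ (suc i , p)
  ... | inj₂ d       = inj₂ (refl ∷ d)

  Disjoint⇒¬meet : ∀ {n} {x y : Vec Bool n} → Disjoint x y → ∀ i → lookup x i ≡ true → lookup y i ≡ true → ⊥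
  Disjoint⇒¬meet d i xi yi with trans (sym (cong₂ _∧_ xi yi)) (Pointwise.lookup d i)
  ... | ()

  Disjoint-sym : ∀ {n} {x y : Vec Bool n} → Disjoint x y → Disjoint y x
  Disjoint-sym = Pointwise.sym λ {b} {c} e → trans (∧-comm c b) e

  core⇒ : ∀ {a b r L} yes? s (A : Vec (Fin (suc b)) a) (τs : Vec (Vec (Fin (a * b)) r) L) bits γ e x →
    core yes? s A τs bits γ e x ≡ true →
    ∃ λ i → key τs (orient γ (control A x)) ≡ just i × lookup bits i xor (e xor (γ ∧ yes?)) ≡ true
  core⇒ yes? s A τs bits γ e x c with key τs (orient γ (control A x))
  ... | just i  = i , refl , ∧-conicalʳ (low s (action A x) ∧ half (orient γ (control A x))) _ c
  ... | nothing with ∧-conicalʳ (low s (action A x) ∧ half (orient γ (control A x))) _ c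
  ...   | ()

  sat-mono : ∀ {m r} {v w : Vec Bool m} → Disjoint v w → (τ : Vec (Fin m) r) → sat v τ ≡ true → sat (∁ w) τ ≡ true
  sat-mono d []      _ = refl
  sat-mono {v = v} {w} d (l ∷ τ) sv = cong₂ _∧_
    (trans (lookup-map l not w) (flip (Pointwise.lookup d l) (∧-conicalˡ (lookup v l) (sat v τ) sv)))
    (sat-mono d τ (∧-conicalʳ (lookup v l) (sat v τ) sv))
    where
    flip : ∀ {b c} → b ∧ c ≡ false → b ≡ true → not c ≡ true
    flip {true} {false} _ _ = refl

  core-disjoint : ∀ {a b r L} s (A : Vec (Fin (suc b)) a) (τs : Vec (Vec (Fin (a * b)) r) L) bits e {x y} →
    Disjoint x y → core true s A τs bits false e x ≡ true → core true s A τs bits true e y ≡ true → ⊥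
  core-disjoint s A τs bits e {x} {y} d cx cy
    with core⇒ true s A τs bits false e x cx | core⇒ true s A τs bits true e y cy
  ... | i , kx , bx | j , ky , by with unique-complete (Vec.map (sat (∁ (control A y))) τs) ky i satᵢ
    where
    satᵢ : lookup (Vec.map (sat (∁ (control A y))) τs) i ≡ true
    satᵢ = trans (lookup-map i _ τs) (sat-mono (Disjoint-control A d) (lookup τs i)
      (trans (sym (lookup-map i (sat (control A x)) τs)) (unique-sound (Vec.map (sat (control A x)) τs) kx)))
  ...   | refl = clash (lookup bits i) e bx by
    where
    clash : ∀ b e → b xor (e xor false) ≡ true → b xor (e xor true) ≡ true → ⊥
    clash true  true  () _
    clash true  false _ ()
    clash false true  _ ()
    clash false false () _

  mark-disjoint : ∀ w₁ w₂ w₁′ w₂′ → w₁ xor w₂ ≡ true → w₁′ xor w₂′ ≡ true →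
    w₁ ∧ w₁′ ≡ false → w₂ ∧ w₂′ ≡ false → w₂′ ≡ not w₂
  mark-disjoint w₁    true  w₁′   true  _ _ _ ()
  mark-disjoint w₁    true  w₁′   false _ _ _ _ = refl
  mark-disjoint w₁    false w₁′   true  _ _ _ _ = refl
  mark-disjoint true  false true  false _ _ () _

  hard-intersecting : ∀ {a b r L} ℓ s (A : Vec (Fin (suc b)) a) (τs : Vec (Vec (Fin (a * b)) r) L) bits →
    Intersecting (hard ℓ true s A τs bits)
  hard-intersecting ℓ s A τs bits x@(w₁ ∷ w₂ ∷ w₃ ∷ w₄ ∷ z) y@(w₁′ ∷ w₂′ ∷ w₃′ ∷ w₄′ ∷ z′) fx fy with meet? x y
  ... | inj₁ i = i
  ... | inj₂ (d₁ ∷ d₂ ∷ d₃ ∷ d₄ ∷ d) = ⊥-elim (cases w₂ w₄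
      (mark-disjoint w₁ w₂ w₁′ w₂′ (first w₁ w₂ w₃ w₄ z fx) (first w₁′ w₂′ w₃′ w₄′ z′ fy) d₁ d₂)
      (mark-disjoint w₃ w₄ w₃′ w₄′ (second w₁ w₂ w₃ w₄ z fx) (second w₁′ w₂′ w₃′ w₄′ z′ fy) d₃ d₄)
      (third w₁ w₂ w₃ w₄ z fx) (third w₁′ w₂′ w₃′ w₄′ z′ fy))
    where
    f = hard ℓ true s A τs bits
    C = core true s A τs bits
    first : ∀ w₁ w₂ w₃ w₄ z → f (w₁ ∷ w₂ ∷ w₃ ∷ w₄ ∷ z) ≡ true → w₁ xor w₂ ≡ true
    first w₁ w₂ w₃ w₄ z e = ∧-conicalˡ (w₁ xor w₂) (w₃ xor w₄) (∧-conicalˡ _ (C w₂ (w₄ xor w₂) (drop ℓ z)) e)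
    second : ∀ w₁ w₂ w₃ w₄ z → f (w₁ ∷ w₂ ∷ w₃ ∷ w₄ ∷ z) ≡ true → w₃ xor w₄ ≡ true
    second w₁ w₂ w₃ w₄ z e = ∧-conicalʳ (w₁ xor w₂) (w₃ xor w₄) (∧-conicalˡ _ (C w₂ (w₄ xor w₂) (drop ℓ z)) e)
    third : ∀ w₁ w₂ w₃ w₄ z → f (w₁ ∷ w₂ ∷ w₃ ∷ w₄ ∷ z) ≡ true → C w₂ (w₄ xor w₂) (drop ℓ z) ≡ true
    third w₁ w₂ w₃ w₄ z e = ∧-conicalʳ ((w₁ xor w₂) ∧ (w₃ xor w₄)) _ e
    -- Both marks flip between two disjoint points. Hence one of them is an α-point and the other a
    -- γ-point, and the parity `w₄ xor w₂` is the same for both.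
    cases : ∀ w₂ w₄ {w₂′ w₄′} → w₂′ ≡ not w₂ → w₄′ ≡ not w₄ →
            C w₂ (w₄ xor w₂) (drop ℓ z) ≡ true → C w₂′ (w₄′ xor w₂′) (drop ℓ z′) ≡ true → ⊥
    cases false true  refl refl cx cy = core-disjoint s A τs bits true (Disjoint-drop ℓ d) cx cy
    cases false false refl refl cx cy = core-disjoint s A τs bits false (Disjoint-drop ℓ d) cx cy
    cases true  true  refl refl cx cy = core-disjoint s A τs bits false (Disjoint-drop ℓ (Disjoint-sym d)) cy cx
    cases true  false refl refl cx cy = core-disjoint s A τs bits true (Disjoint-drop ℓ (Disjoint-sym d)) cy cx

  length-filterᵇ : {X : Set} (P : X → Bool) (xs : List X) → length (List.filterᵇ P xs) ≡ ∑ xs (𝟙 ∘ P)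
  length-filterᵇ P []       = refl
  length-filterᵇ P (x ∷ xs) with P x
  ... | true  = cong suc (length-filterᵇ P xs)
  ... | false = length-filterᵇ P xs

  ∑-cube-marks : ∀ n (f : Vec Bool (2 + n) → ℕ) →
    ∑[ z ← allPoints n ] (f (true ∷ false ∷ z) + f (false ∷ true ∷ z)) ≤ ∑ (allPoints (2 + n)) f
  ∑-cube-marks n f = begin
    ∑[ z ← allPoints n ] (f (true ∷ false ∷ z) + f (false ∷ true ∷ z))
      ≡⟨ ∑-+ (allPoints n) (λ z → f (true ∷ false ∷ z)) (λ z → f (false ∷ true ∷ z)) ⟩
    _ ≤⟨ +-mono-≤ (m≤n+m _ (∑[ z ← allPoints n ] f (true ∷ true ∷ z))) (m≤m+n _ (∑[ z ← allPoints n ] f (false ∷ false ∷ z))) ⟩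
    _ ≡⟨ sym (cong₂ _+_ (∑-cube n (λ z → f (true ∷ z))) (∑-cube n (λ z → f (false ∷ z)))) ⟩
    _ ≡⟨ sym (∑-cube (suc n) f) ⟩
    ∑ (allPoints (2 + n)) f ∎
    where open ≤-Reasoning

  good : ∀ {m r L} → Vec (Vec (Fin m) r) L → Vec Bool m → Bool
  good τs v = half v ∧ is-just (key τs v)

  ∑-z : ∀ {a b} ℓ (A : Vec (Fin (suc b)) a) (f : Vec Bool (ℓ + a * suc b) → ℕ) →
    ∑ (allPoints (ℓ + a * suc b)) f ≡
    ∑[ ρ ← allPoints ℓ ] ∑[ v ← allPoints (a * b) ] ∑[ u ← allPoints a ] f (ρ ++ merge A u v)
  ∑-z {a} {b} ℓ A f = trans (∑-cube-++ ℓ (a * suc b) f) (∑-cong (allPoints ℓ) (λ ρ →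
    trans (∑-merge A (λ x → f (ρ ++ x))) (∑-swap (allPoints a) (allPoints (a * b)) (λ u v → f (ρ ++ merge A u v)))))

  -- The parametrisation for γ-points: with ρ and v complemented, the α-point of (ρ, u, v) and the
  -- γ-point of (ρ, u′, v) of equal parity are disjoint as soon as u and u′ are.
  ∑-z-∁ : ∀ {a b} ℓ (A : Vec (Fin (suc b)) a) (f : Vec Bool (ℓ + a * suc b) → ℕ) →
    ∑ (allPoints (ℓ + a * suc b)) f ≡
    ∑[ ρ ← allPoints ℓ ] ∑[ v ← allPoints (a * b) ] ∑[ u ← allPoints a ] f (∁ ρ ++ merge A u (∁ v))
  ∑-z-∁ {a} {b} ℓ A f = trans (∑-z ℓ A f)
    (trans (sym (∑-cube-not ℓ (λ ρ → ∑[ v ← allPoints (a * b) ] ∑[ u ← allPoints a ] f (ρ ++ merge A u v))))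
      (∑-cong (allPoints ℓ) (λ ρ → sym (∑-cube-not (a * b) (λ v → ∑[ u ← allPoints a ] f (∁ ρ ++ merge A u v))))))

  -- Fix ρ and a good v, and take the parity for which the bit of its term gives 1. Then f is 1 at
  -- the α-points (ρ, u, v) and the γ-points (∁ρ, u′, ∁v) for all light u and u′. An intersecting g
  -- must differ from f at one point of each disjoint pair, so by `∑-low-cover` it differs at least
  -- as often as there are light u.
  hard-far : ∀ {a b r L} ℓ s (A : Vec (Fin (suc b)) a) (τs : Vec (Vec (Fin (a * b)) r) L) bits
    (g : BoolFun (4 + (ℓ + a * suc b))) → Intersecting g →
    2 ^ ℓ * ((∑[ v ← allPoints (a * b) ] 𝟙 (good τs v)) * (∑[ u ← allPoints a ] 𝟙 (low s u)))
    ≤ diffCount (hard ℓ false s A τs bits) g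
  hard-far {a} {b} {r} {L} ℓ s A τs bits g inter = begin
    2 ^ ℓ * (W * Low)
      ≡⟨ cong (2 ^ ℓ *_) (sym (∑-*ʳ (allPoints (a * b)) (𝟙 ∘ good τs) Low)) ⟩
    2 ^ ℓ * (∑[ v ← allPoints (a * b) ] 𝟙 (good τs v) * Low)
      ≡⟨ sym (∑-cube-const ℓ _) ⟩
    ∑[ ρ ← allPoints ℓ ] ∑[ v ← allPoints (a * b) ] 𝟙 (good τs v) * Low
      ≤⟨ ∑-mono (allPoints ℓ) (λ ρ → ∑-mono (allPoints (a * b)) (λ v → subst (_≤ P true ρ v + Q true ρ v + (P false ρ v + Q false ρ v)) (*-comm Low _)
           (*-𝟙-elim (good τs v) (λ t → cover ρ v t)))) ⟩
    ∑[ ρ ← allPoints ℓ ] ∑[ v ← allPoints (a * b) ] (P true ρ v + Q true ρ v + (P false ρ v + Q false ρ v))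
      ≡⟨ trans (∑∑-+ (λ ρ v → P true ρ v + Q true ρ v) (λ ρ v → P false ρ v + Q false ρ v))
               (cong₂ _+_ (∑∑-+ (P true) (Q true)) (∑∑-+ (P false) (Q false))) ⟩
    (∑∑ (P true) + ∑∑ (Q true)) + (∑∑ (P false) + ∑∑ (Q false))
      ≡⟨ sym (cong₂ _+_ (cong₂ _+_ (∑-z ℓ A (α true)) (∑-z-∁ ℓ A (γ true))) (cong₂ _+_ (∑-z ℓ A (α false)) (∑-z-∁ ℓ A (γ false)))) ⟩
    (∑ Z (α true) + ∑ Z (γ true)) + (∑ Z (α false) + ∑ Z (γ false))
      ≡⟨ regroup (∑ Z (α true)) (∑ Z (γ true)) (∑ Z (α false)) (∑ Z (γ false)) ⟩
    (∑ Z (α false) + ∑ Z (α true)) + (∑ Z (γ true) + ∑ Z (γ false))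
      ≡⟨ sym (cong₂ _+_ (∑-+ Z (α false) (α true)) (∑-+ Z (γ true) (γ false))) ⟩
    (∑[ z ← Z ] (α false z + α true z)) + (∑[ z ← Z ] (γ true z + γ false z))
      ≤⟨ +-mono-≤ (∑-cube-marks N (λ z → D (true ∷ false ∷ z))) (∑-cube-marks N (λ z → D (false ∷ true ∷ z))) ⟩
    (∑[ z ← allPoints (2 + N) ] D (true ∷ false ∷ z)) + (∑[ z ← allPoints (2 + N) ] D (false ∷ true ∷ z))
      ≡⟨ sym (∑-+ (allPoints (2 + N)) (λ z → D (true ∷ false ∷ z)) (λ z → D (false ∷ true ∷ z))) ⟩
    ∑[ z ← allPoints (2 + N) ] (D (true ∷ false ∷ z) + D (false ∷ true ∷ z))
      ≤⟨ ∑-cube-marks (2 + N) D ⟩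
    ∑ (allPoints (4 + N)) D
      ≡⟨ sym (length-filterᵇ (λ x → differ (f x) (g x)) (allPoints (4 + N))) ⟩
    diffCount f g ∎
    where
    open ≤-Reasoning
    N = ℓ + a * suc b
    Z = allPoints N
    f = hard ℓ false s A τs bits
    W = ∑[ v ← allPoints (a * b) ] 𝟙 (good τs v)
    Low = ∑[ u ← allPoints a ] 𝟙 (low s u)
    D : Vec Bool (4 + N) → ℕ
    D x = 𝟙 (differ (f x) (g x))
    αpt γpt : Bool → Vec Bool N → Vec Bool (4 + N)
    αpt e z = true ∷ false ∷ not e ∷ e ∷ z
    γpt e z = false ∷ true ∷ e ∷ not e ∷ z
    α γ : Bool → Vec Bool N → ℕ
    α e z = D (αpt e z)
    γ e z = D (γpt e z)
    P Q : Bool → Vec Bool ℓ → Vec Bool (a * b) → ℕ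
    P e ρ v = ∑[ u ← allPoints a ] α e (ρ ++ merge A u v)
    Q e ρ v = ∑[ u ← allPoints a ] γ e (∁ ρ ++ merge A u (∁ v))
    ∑∑ : (Vec Bool ℓ → Vec Bool (a * b) → ℕ) → ℕ
    ∑∑ F = ∑[ ρ ← allPoints ℓ ] ∑[ v ← allPoints (a * b) ] F ρ v
    ∑∑-+ : ∀ F G → ∑∑ (λ ρ v → F ρ v + G ρ v) ≡ ∑∑ F + ∑∑ G
    ∑∑-+ F G = trans (∑-cong (allPoints ℓ) (λ ρ → ∑-+ (allPoints (a * b)) (F ρ) (G ρ)))
      (∑-+ (allPoints ℓ) (λ ρ → ∑ (allPoints (a * b)) (F ρ)) (λ ρ → ∑ (allPoints (a * b)) (G ρ)))
    regroup : ∀ x y z w → (x + y) + (z + w) ≡ (z + x) + (y + w)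
    regroup = solve-∀
    core-true : ∀ γ e x i v → action A x ≡ action A x → orient γ (control A x) ≡ v → key τs v ≡ just i →
      T (low s (action A x)) → T (half v) → lookup bits i xor (e xor (γ ∧ false)) ≡ true →
      core false s A τs bits γ e x ≡ true
    core-true γ e x i v _ refl k lu hv be = cong₂ _∧_
      (cong₂ _∧_ (Equivalence.to T-≡ lu) (Equivalence.to T-≡ hv))
      (trans (cong (λ k → verdict k bits (e xor (γ ∧ false))) k) be)
    drop-merge : ∀ (ρ : Vec Bool ℓ) u v → drop ℓ (ρ ++ merge A u v) ≡ merge A u v
    drop-merge ρ u v = drop-++ ρ (merge A u v)
    f-α : ∀ e ρ u v i → T (low s u) → T (half v) → key τs v ≡ just i → lookup bits i xor e ≡ true →
          f (αpt e (ρ ++ merge A u v)) ≡ true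
    f-α e ρ u v i lu hv k be = cong₂ _∧_ (xor-mark e)
      (core-true false (e xor false) (drop ℓ (ρ ++ merge A u v)) i v refl
        (trans (cong (control A) (drop-merge ρ u v)) (control-merge A u v)) k
        (subst (T ∘ low s) (sym (trans (cong (action A) (drop-merge ρ u v)) (action-merge A u v))) lu) hv
        (trans (cong (lookup bits i xor_) (xor-false e)) be))
      where
      xor-mark : ∀ e → not e xor e ≡ true
      xor-mark true  = refl
      xor-mark false = refl
      xor-false : ∀ e → (e xor false) xor false ≡ e
      xor-false true  = refl
      xor-false false = refl
    f-γ : ∀ e ρ u v i → T (low s u) → T (half v) → key τs v ≡ just i → lookup bits i xor e ≡ true →
          f (γpt e (ρ ++ merge A u (∁ v))) ≡ true
    f-γ e ρ u v i lu hv k be = cong₂ _∧_ (xor-mark e)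
      (core-true true (not e xor true) (drop ℓ (ρ ++ merge A u (∁ v))) i v refl
        (trans (cong ∁ (trans (cong (control A) (drop-merge ρ u (∁ v))) (control-merge A u (∁ v)))) (∁-involutive v)) k
        (subst (T ∘ low s) (sym (trans (cong (action A) (drop-merge ρ u (∁ v))) (action-merge A u (∁ v)))) lu) hv
        (trans (cong (lookup bits i xor_) (xor-true e)) be))
      where
      xor-mark : ∀ e → e xor not e ≡ true
      xor-mark true  = refl
      xor-mark false = refl
      xor-true : ∀ e → (not e xor true) xor false ≡ e
      xor-true true  = refl
      xor-true false = refl
    differ-either : ∀ x y → f x ≡ true → f y ≡ true → Disjoint x y → 1 ≤ D x + D y
    differ-either x y fx fy d with g x in gx
    ... | false rewrite fx = s≤s z≤n
    ... | true  with g y in gy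
    ...   | false rewrite fy = m≤n+m 1 _
    ...   | true  with inter x y gx gy
    ...     | i , xi , yi = ⊥-elim (Disjoint⇒¬meet d i xi yi)
    cover-e : ∀ e ρ v i → T (half v) → key τs v ≡ just i → lookup bits i xor e ≡ true → Low ≤ P e ρ v + Q e ρ v
    cover-e e ρ v i hv k be = ∑-low-cover a s _ _ λ u u′ d lu lu′ →
      differ-either (αpt e (ρ ++ merge A u v)) (γpt e (∁ ρ ++ merge A u′ (∁ v)))
        (f-α e ρ u v i lu hv k be) (f-γ e (∁ ρ) u′ v i lu′ hv k be)
        (refl ∷ refl ∷ nots e ∷ ∧-inverseʳ e ∷ Pointwise.++⁺ (Disjoint-∁ ρ) (Disjoint-merge A d (Disjoint-∁ v)))
      where
      nots : ∀ e → not e ∧ e ≡ false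
      nots true  = refl
      nots false = refl
    cover : ∀ ρ v → T (good τs v) → Low ≤ P true ρ v + Q true ρ v + (P false ρ v + Q false ρ v)
    cover ρ v t with Equivalence.to (T-∧ {half v}) t
    ... | hv , kv with key τs v in k
    ...   | just i with lookup bits i in bi
    ...     | false = ≤-trans (cover-e true ρ v i hv k (cong (_xor true) bi)) (m≤m+n _ _)
    ...     | true  = ≤-trans (cover-e false ρ v i hv k (cong (_xor false) bi))
          (m≤n+m (P false ρ v + Q false ρ v) (P true ρ v + Q true ρ v))

  -- Indistinguishability

  some : {X : Set} {q : ℕ} → (X → Bool) → Vec X q → Bool
  some P []       = false
  some P (x ∷ xs) = P x ∨ some P xs

  some-∑ : {X : Set} {q : ℕ} (P : X → Bool) (xs : Vec X q) → T (some P xs) → 1 ≤ ∑ (toList xs) (𝟙 ∘ P)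
  some-∑ P (x ∷ xs) t with P x
  ... | true  = s≤s z≤n
  ... | false = some-∑ P xs t

  tailOf : ∀ {n} → Vec Bool (4 + n) → Vec Bool n
  tailOf (_ ∷ _ ∷ _ ∷ _ ∷ z) = z

  clash : ∀ {a b r L} ℓ → ℕ → Vec (Fin (suc b)) a → Vec (Vec (Fin (a * b)) r) L →
          (p p′ : Vec Bool (4 + (ℓ + a * suc b))) → Bool
  clash ℓ s A τs p p′ = conflict s (action A x) (action A x′) (control A x) (∁ (control A x′)) τs
    where
    x = drop ℓ (tailOf p)
    x′ = drop ℓ (tailOf p′)

  clashes : ∀ {a b r L q} ℓ → ℕ → Vec (Fin (suc b)) a → Vec (Vec (Fin (a * b)) r) L →
            Vec (Vec Bool (4 + (ℓ + a * suc b))) q → ℕ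
  clashes ℓ s A τs qs = ∑[ p ← toList qs ] ∑[ p′ ← toList qs ] 𝟙 (clash ℓ s A τs p p′)

  -- Flipping the bits of all terms queried through a γ-point turns the answers of the intersecting
  -- function into those of the far one, unless some term is also queried through an α-point.
  indistinguishable : ∀ {a b r L q} ℓ s (A : Vec (Fin (suc b)) a) (τs : Vec (Vec (Fin (a * b)) r) L)
    (alg : DetAlg (4 + (ℓ + a * suc b)) q) →
    ∑[ bits ← allPoints L ] 𝟙 (runDet alg (hard ℓ true s A τs bits)) ≤
    (∑[ bits ← allPoints L ] 𝟙 (runDet alg (hard ℓ false s A τs bits))) + 2 ^ L * clashes ℓ s A τs (DetAlg.queries alg)
  indistinguishable {a} {b} {r} {L} {q} ℓ s A τs (detAlg qs decide) with clashes ℓ s A τs qs in eq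
  -- A single clash already makes the error term at least 2^L, the number of all choices of bits.
  ... | suc k = begin
    ∑[ bits ← allPoints L ] 𝟙 (run true bits)  ≤⟨ ∑-mono (allPoints L) (λ bits → 𝟙≤1 (run true bits)) ⟩
    ∑[ bits ← allPoints L ] 1                  ≡⟨ ∑-cube-const L 1 ⟩
    2 ^ L * 1                                  ≤⟨ *-monoʳ-≤ (2 ^ L) (s≤s z≤n) ⟩
    2 ^ L * suc k                              ≤⟨ m≤n+m _ _ ⟩
    _                                          ∎
    where
    open ≤-Reasoning
    run : Bool → Vec Bool L → Bool
    run yes? bits = decide (Vec.map (hard ℓ yes? s A τs bits) qs)
  ... | zero = ≤-trans (≤-reflexive (trans
      (∑-cong (allPoints L) (λ bits → cong (𝟙 ∘ decide) (maps bits)))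
      (∑-cube-xor L σ (λ bits → 𝟙 (decide (Vec.map (hard ℓ false s A τs bits) qs))))))
      (m≤m+n _ _)
    where
    X : Set
    X = Vec Bool (4 + (ℓ + a * suc b))
    x-of : X → Vec Bool (a * suc b)
    x-of p = drop ℓ (tailOf p)
    isγ : X → Bool
    isγ (w₁ ∷ w₂ ∷ _) = w₂
    γ-key : Fin L → X → Bool
    γ-key i p = isγ p ∧ ((low s (action A (x-of p)) ∧ half (∁ (control A (x-of p)))) ∧ sameKey (just i) (key τs (∁ (control A (x-of p)))))
    -- The shift depends on the queries, the secret and the terms, never on `bits`: this is where
    -- non-adaptivity enters. It is therefore a bijection of the bits. It flips each term seen
    -- through a γ-query, and in the absence of clashes it leaves the terms seen through α-queries
    -- alone.
    σ : Vec Bool L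
    σ = tabulate (λ i → some (γ-key i) qs)
    ∈-some : ∀ {q} (P : X → Bool) {p} {ps : Vec X q} → p ∈ ps → P p ≡ true → some P ps ≡ true
    ∈-some P (here refl) e rewrite e = refl
    ∈-some P (there {x = p′} m) e = trans (cong (P p′ ∨_) (∈-some P m e)) (∨-zeroʳ (P p′))
    ∈-∑ : ∀ {q} (F : X → ℕ) {p} {ps : Vec X q} → p ∈ ps → F p ≤ ∑ (toList ps) F
    ∈-∑ F (here refl) = m≤m+n _ _
    ∈-∑ F (there m) = ≤-trans (∈-∑ F m) (m≤n+m _ _)
    no-clash : ∀ {p} → p ∈ qs → T (some (clash ℓ s A τs p) qs) → 1 ≤ 0
    no-clash {p} m t = ≤-trans (some-∑ (clash ℓ s A τs p) qs t)
      (≤-trans (∈-∑ (λ p → ∑[ p′ ← toList qs ] 𝟙 (clash ℓ s A τs p p′)) m) (≤-reflexive eq))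
    some-mono : ∀ {q} (P Q : X → Bool) (ps : Vec X q) → (∀ p → T (P p) → T (Q p)) → T (some P ps) → T (some Q ps)
    some-mono P Q (p ∷ ps) PQ t with P p | Q p | PQ p
    ... | true  | true  | _  = _
    ... | true  | false | pq = ⊥-elim (pq _)
    ... | false | true  | _  = _
    ... | false | false | _  = some-mono P Q ps PQ t
    core-α : ∀ bits e x → (∀ i → key τs (control A x) ≡ just i → T (low s (action A x) ∧ half (control A x)) → lookup σ i ≡ false) →
      core true s A τs bits false e x ≡ core false s A τs (zipWith _xor_ σ bits) false e x
    core-α bits e x σi with low s (action A x) ∧ half (control A x)
    ... | false = refl
    ... | true with key τs (control A x)
    ...   | nothing = refl
    ...   | just i  = cong (_xor (e xor false)) (sym (trans (lookup-zipWith _xor_ i σ bits) (cong (_xor lookup bits i) (σi i refl _))))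
    core-γ : ∀ bits e x → (∀ i → key τs (∁ (control A x)) ≡ just i → T (low s (action A x) ∧ half (∁ (control A x))) → lookup σ i ≡ true) →
      core true s A τs bits true e x ≡ core false s A τs (zipWith _xor_ σ bits) true e x
    core-γ bits e x σi with low s (action A x) ∧ half (∁ (control A x))
    ... | false = refl
    ... | true with key τs (∁ (control A x))
    ...   | nothing = refl
    ...   | just i  = trans (shift (lookup bits i) e) (cong (_xor (e xor false)) (sym (trans (lookup-zipWith _xor_ i σ bits) (cong (_xor lookup bits i) (σi i refl _)))))
      where
      shift : ∀ b e → b xor (e xor true) ≡ (true xor b) xor (e xor false)
      shift true  true  = refl
      shift true  false = refl
      shift false true  = refl
      shift false false = refl
    untouched : ∀ {p} → p ∈ qs → ∀ i → key τs (control A (x-of p)) ≡ just i →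
      T (low s (action A (x-of p)) ∧ half (control A (x-of p))) → lookup σ i ≡ false
    untouched {p} m i k t with lookup σ i in σi
    ... | false = refl
    ... | true  = contradiction (no-clash m (some-mono (γ-key i) (clash ℓ s A τs p) qs collide
                    (subst T (trans (sym σi) (lookup∘tabulate _ i)) _))) (λ ())
      where
      collide : ∀ p′ → T (γ-key i p′) → T (clash ℓ s A τs p p′)
      collide p′ g with Equivalence.to (T-∧ {isγ p′}) g
      ... | _ , g′ with Equivalence.to (T-∧ {low s (action A (x-of p′)) ∧ half (∁ (control A (x-of p′)))}) g′
      ...   | lh , sk with Equivalence.to (T-∧ {low s (action A (x-of p′))}) lh | Equivalence.to (T-∧ {low s (action A (x-of p))}) t
      ...     | l′ , h′ | l , h = Equivalence.from T-∧
        ( Equivalence.from T-∧ (Equivalence.from T-∧ (l , l′) , Equivalence.from T-∧ (h , h′))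
        , subst (λ k → T (sameKey k (key τs (∁ (control A (x-of p′)))))) (sym k) sk)
    touched : ∀ {p} → p ∈ qs → isγ p ≡ true → ∀ i → key τs (∁ (control A (x-of p))) ≡ just i →
      T (low s (action A (x-of p)) ∧ half (∁ (control A (x-of p)))) → lookup σ i ≡ true
    touched {p} m g i k t = trans (lookup∘tabulate _ i) (∈-some (γ-key i) m
      (Equivalence.to T-≡ (Equivalence.from (T-∧ {isγ p}) (Equivalence.from T-≡ g , Equivalence.from T-∧
        (t , subst (λ k → T (sameKey (just i) k)) (sym k) (⇒sameKey i))))))
    point : ∀ bits p → p ∈ qs → hard ℓ true s A τs bits p ≡ hard ℓ false s A τs (zipWith _xor_ σ bits) p
    point bits (w₁ ∷ false ∷ w₃ ∷ w₄ ∷ z) m = cong (((w₁ xor false) ∧ (w₃ xor w₄)) ∧_)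
      (core-α bits (w₄ xor false) (drop ℓ z) (untouched m))
    point bits (w₁ ∷ true ∷ w₃ ∷ w₄ ∷ z) m = cong (((w₁ xor true) ∧ (w₃ xor w₄)) ∧_)
      (core-γ bits (w₄ xor true) (drop ℓ z) (touched m refl))
    maps : ∀ bits → Vec.map (hard ℓ true s A τs bits) qs ≡ Vec.map (hard ℓ false s A τs (zipWith _xor_ σ bits)) qs
    maps bits = go qs id
      where
      go : ∀ {q} (ps : Vec X q) → (∀ {p} → p ∈ ps → p ∈ qs) →
           Vec.map (hard ℓ true s A τs bits) ps ≡ Vec.map (hard ℓ false s A τs (zipWith _xor_ σ bits)) ps
      go []       inc = refl
      go (p ∷ ps) inc = cong₂ _∷_ (point bits p (inc (here refl))) (go ps (inc ∘ there))

  clashes-mass : ∀ {q} ℓ s β x y .{{_ : NonZero s}} .{{_ : NonZero y}} → suc x ≡ 64 * s → suc y ≡ 2 * β →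
    let a = 16 * (s * s) ; b = suc (2 * y) ; m = a * b ; t = s * suc x ; Ω = vecs (terms m (suc t)) (2 ^ t) in
    ∀ (qs : Vec (Vec Bool (4 + (ℓ + a * suc b))) q) →
    2 ^ s * (∑[ A ← secrets a b ] ∑[ τs ← Ω ] clashes ℓ s A τs qs) ≤ q * (q * (2 * (length (secrets a b) * length Ω)))
  clashes-mass {q} ℓ s β x y x≡ y≡ qs = begin
    2 ^ s * (∑[ A ← secrets a b ] ∑[ τs ← Ω ] clashes ℓ s A τs qs)
      ≡⟨ cong (2 ^ s *_) (trans (∑-cong (secrets a b) (λ A → ∑-swap Ω Q (λ τs p → ∑[ p′ ← Q ] 𝟙 (clash ℓ s A τs p p′))))
           (∑-swap (secrets a b) Q (λ A p → ∑[ τs ← Ω ] ∑[ p′ ← Q ] 𝟙 (clash ℓ s A τs p p′)))) ⟩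
    2 ^ s * (∑[ p ← Q ] ∑[ A ← secrets a b ] ∑[ τs ← Ω ] ∑[ p′ ← Q ] 𝟙 (clash ℓ s A τs p p′))
      ≡⟨ cong (2 ^ s *_) (∑-cong Q (λ p → trans (∑-cong (secrets a b) (λ A → ∑-swap Ω Q (λ τs p′ → 𝟙 (clash ℓ s A τs p p′))))
           (∑-swap (secrets a b) Q (λ A p′ → ∑[ τs ← Ω ] 𝟙 (clash ℓ s A τs p p′))))) ⟩
    2 ^ s * (∑[ p ← Q ] ∑[ p′ ← Q ] ∑[ A ← secrets a b ] ∑[ τs ← Ω ] 𝟙 (clash ℓ s A τs p p′))
      ≡⟨ trans (sym (∑-*ˡ Q (2 ^ s) _)) (∑-cong Q (λ p → sym (∑-*ˡ Q (2 ^ s) (λ p′ → ∑[ A ← secrets a b ] ∑[ τs ← Ω ] 𝟙 (clash ℓ s A τs p p′))))) ⟩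
    ∑[ p ← Q ] ∑[ p′ ← Q ] 2 ^ s * (∑[ A ← secrets a b ] ∑[ τs ← Ω ] 𝟙 (clash ℓ s A τs p p′))
      ≤⟨ ∑-mono Q (λ p → ∑-mono Q (λ p′ → conflict-mass s β x y x≡ y≡ (drop ℓ (tailOf p)) (drop ℓ (tailOf p′)))) ⟩
    ∑[ p ← Q ] ∑[ p′ ← Q ] K
      ≡⟨ trans (∑-const Q _) (cong₂ _*_ (length-toList qs) (trans (∑-const Q K) (cong (_* K) (length-toList qs)))) ⟩
    q * (q * K) ∎
    where
    open ≤-Reasoning
    a = 16 * (s * s)
    b = suc (2 * y)
    m = a * b
    t = s * suc x
    Ω = vecs (terms m (suc t)) (2 ^ t)
    Q = toList qs
    K = 2 * (length (secrets a b) * length Ω)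

  -- Weighted testers

  accept : ∀ {n q} → List (ℕ × DetAlg n q) → BoolFun n → ℕ
  accept alg f = ∑[ p ← alg ] proj₁ p * 𝟙 (runDet (proj₂ p) f)

  total : ∀ {n q} → List (ℕ × DetAlg n q) → ℕ
  total alg = ∑[ p ← alg ] proj₁ p

  -- A tester with denominators cleared: ε is P / Q, and the total weight stands for probability 1.
  record WeightedTester (n q P Q : ℕ) : Set where
    field
      algs    : List (ℕ × DetAlg n q)
      total>0 : 0 < total algs
      sound   : ∀ f → Intersecting f → 2 * total algs ≤ 3 * accept algs f
      reject  : ∀ f → (∀ g → Intersecting g → P * 2 ^ n ≤ Q * diffCount f g) → 3 * accept algs f ≤ total algs

  -- Rows have length 32ρ, and ρ is also the width of the band used for the distance. J₀ is the
  -- width, about √n, of a comparison band of constant mass; ℓ coordinates are left over; `suc x` is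
  -- the h of `sameKey-mass`.
  module _ (P Q q ℓ s ρ J₀ x y : ℕ) .{{_ : NonZero s}} .{{_ : NonZero ρ}} .{{_ : NonZero y}}
           (x≡ : suc x ≡ 64 * s) (y≡ : suc y ≡ 16 * ρ) where
    private
      a b m t L H n : ℕ
      a = 16 * (s * s)
      b = suc (2 * y)
      m = a * b
      t = s * suc x
      L = 2 ^ t
      H = 8 * (s * s) * b
      n = 4 + (ℓ + a * suc b)

      𝔸 : List (Vec (Fin (suc b)) a)
      𝔸 = secrets a b

      Ω : List (Vec (Vec (Fin m) (suc t)) L)
      Ω = vecs (terms m (suc t)) L

      m≡2H : m ≡ 2 * H
      m≡2H = lemma s b
        where
        lemma : ∀ s b → 16 * (s * s) * b ≡ 2 * (8 * (s * s) * b)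
        lemma = solve-∀

      b≡ : suc b ≡ 32 * ρ
      b≡ = trans (lemma y) (trans (cong (2 *_) y≡) (sym (*-assoc 2 16 ρ)))
        where
        lemma : ∀ y → suc (suc (2 * y)) ≡ 2 * suc y
        lemma = solve-∀

      31ρ≤b : 31 * ρ ≤ b
      31ρ≤b = +-cancelˡ-≤ 1 _ _ (begin
        1 + 31 * ρ ≤⟨ +-monoˡ-≤ (31 * ρ) (>-nonZero⁻¹ ρ) ⟩
        ρ + 31 * ρ ≡⟨ sym b≡ ⟩
        suc b      ∎)
        where
        open ≤-Reasoning

      s²>0 : 0 < s * s
      s²>0 = *-mono-≤ (>-nonZero⁻¹ s) (>-nonZero⁻¹ s)

      m≢0 : NonZero m
      m≢0 = m*n≢0 a b {{>-nonZero (*-mono-≤ (s≤s (z≤n {15})) s²>0)}}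

      width : ℕ
      width = ∑[ v ← allPoints m ] 𝟙 (band H ρ v)

      keyed : Vec (Vec (Fin m) (suc t)) L → ℕ
      keyed τs = ∑[ v ← allPoints m ] 𝟙 (band H ρ v) * 𝟙 (is-just (key τs v))

      keyed≤width : ∀ τs → keyed τs ≤ width
      keyed≤width τs = ∑-mono (allPoints m) (λ v → ≤-trans (*-monoʳ-≤ (𝟙 (band H ρ v)) (𝟙≤1 (is-just (key τs v)))) (≤-reflexive (*-identityʳ _)))

      band-half : ∀ (v : Vec Bool m) → T (band H ρ v) → T (half v)
      band-half v t = ≤⇒≤ᵇ (≤-trans (*-monoʳ-≤ 2 (proj₁ (band⇒ H ρ v t))) (≤-reflexive (sym m≡2H)))

      keyed≤good : ∀ τs → keyed τs ≤ ∑[ v ← allPoints m ] 𝟙 (good τs v)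
      keyed≤good τs = ∑-mono (allPoints m) (λ v → ≤-trans (≤-reflexive (sym (𝟙-∧ (band H ρ v) (is-just (key τs v)))))
        (𝟙-elim (band H ρ v ∧ is-just (key τs v)) (λ t → ≤-reflexive (sym (𝟙-intro (isGood v t))))))
        where
        isGood : ∀ v → T (band H ρ v ∧ is-just (key τs v)) → T (good τs v)
        isGood v t with Equivalence.to (T-∧ {band H ρ v}) t
        ... | t₁ , t₂ = Equivalence.from T-∧ (band-half v t₁ , t₂)

      -- The band reaches ρ below the middle, whereas m is about 512 s²ρ and t = 64 s². Rows of
      -- length 32ρ make t times twice that depth at most m/2, as `unique-mass` asks.
      band-near : ∀ (v : Vec Bool m) → T (band H ρ v) → 2 * (suc t * (m ∸ 2 * wt v)) ≤ m
      band-near v bv = begin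
        2 * (suc t * (m ∸ 2 * wt v))         ≤⟨ *-monoʳ-≤ 2 (*-mono-≤ t≤ gap≤) ⟩
        2 * (65 * (s * s) * (2 * ρ))         ≤⟨ m≤m+n _ (236 * (s * s) * ρ) ⟩
        2 * (65 * (s * s) * (2 * ρ)) + 236 * (s * s) * ρ ≡⟨ lemma₁ (s * s) ρ ⟩
        16 * (s * s) * (31 * ρ)              ≤⟨ *-monoʳ-≤ (16 * (s * s)) 31ρ≤b ⟩
        m                                    ∎
        where
        open ≤-Reasoning
        lemma₁ : ∀ s ρ → 2 * (65 * s * (2 * ρ)) + 236 * s * ρ ≡ 16 * s * (31 * ρ)
        lemma₁ = solve-∀
        lemma₂ : ∀ s → s * s + s * (64 * s) ≡ 65 * (s * s)
        lemma₂ = solve-∀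
        t≤ : suc t ≤ 65 * (s * s)
        t≤ = begin
          1 + s * suc x          ≤⟨ +-monoˡ-≤ (s * suc x) s²>0 ⟩
          s * s + s * suc x      ≡⟨ cong (λ h → s * s + s * h) x≡ ⟩
          s * s + s * (64 * s)   ≡⟨ lemma₂ s ⟩
          65 * (s * s)           ∎
        gap≤ : m ∸ 2 * wt v ≤ 2 * ρ
        gap≤ = m≤n+o⇒m∸n≤o m (2 * wt v) (begin
          m                      ≡⟨ m≡2H ⟩
          2 * H                  ≤⟨ *-monoʳ-≤ 2 (<⇒≤ (proj₂ (band⇒ H ρ v bv))) ⟩
          2 * (wt v + ρ)         ≡⟨ *-distribˡ-+ 2 (wt v) ρ ⟩
          2 * wt v + 2 * ρ       ∎)

      -- Every band point has a key for at least 1/8 of the term families; exchanging the sums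
      -- gives, on average over the families, a keyed share of at least 1/8 of the band.
      keyed-mass : width * length Ω ≤ 8 * ∑ Ω keyed
      keyed-mass = begin
        width * length Ω
          ≡⟨ sym (∑-*ʳ (allPoints m) (𝟙 ∘ band H ρ) (length Ω)) ⟩
        ∑[ v ← allPoints m ] 𝟙 (band H ρ v) * length Ω
          ≤⟨ ∑-mono (allPoints m) (λ v → subst (_≤ 8 * (𝟙 (band H ρ v) * U v)) (*-comm (length Ω) _) (*-𝟙-elim (band H ρ v) (bound v))) ⟩
        ∑[ v ← allPoints m ] 8 * (𝟙 (band H ρ v) * U v)
          ≡⟨ ∑-*ˡ (allPoints m) 8 (λ v → 𝟙 (band H ρ v) * U v) ⟩
        8 * (∑[ v ← allPoints m ] 𝟙 (band H ρ v) * U v)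
          ≡⟨ cong (8 *_) (∑-cong (allPoints m) (λ v → sym (∑-*ˡ Ω (𝟙 (band H ρ v)) (λ τs → 𝟙 (is-just (key τs v)))))) ⟩
        8 * (∑[ v ← allPoints m ] ∑[ τs ← Ω ] 𝟙 (band H ρ v) * 𝟙 (is-just (key τs v)))
          ≡⟨ cong (8 *_) (∑-swap (allPoints m) Ω (λ v τs → 𝟙 (band H ρ v) * 𝟙 (is-just (key τs v)))) ⟩
        8 * ∑ Ω keyed ∎
        where
        open ≤-Reasoning
        U : Vec Bool m → ℕ
        U v = ∑[ τs ← Ω ] 𝟙 (is-just (key τs v))
        len : length Ω ≡ (m ^ suc t) ^ L
        len = trans (length-vecs (terms m (suc t)) L) (cong (_^ L) (length-terms m (suc t)))
        bound : ∀ v → T (band H ρ v) → length Ω ≤ 8 * (𝟙 (band H ρ v) * U v)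
        bound v bv = begin
          length Ω                        ≡⟨ len ⟩
          (m ^ suc t) ^ L                 ≤⟨ unique-mass m t v {{m≢0}} (half⇒ v (band-half v bv)) (band-near v bv) ⟩
          8 * U v                         ≡⟨ cong (8 *_) (sym (trans (cong (_* U v) (𝟙-intro bv)) (*-identityˡ (U v)))) ⟩
          8 * (𝟙 (band H ρ v) * U v)      ∎

      width-mass : ρ ≤ J₀ → m ≤ J₀ * J₀ → 3 * (ρ * 2 ^ m) ≤ 8 * (J₀ * width)
      width-mass ρ≤J₀ m≤J₀² = ≤-trans (transport m m≡2H m≤J₀²)
        (*-monoʳ-≤ 8 (*-monoʳ-≤ J₀ (≤-trans (∑-band-≤ m H ρ (λ _ → 1) (m≤n⇒m≤1+n ρ≤H))
          (≤-reflexive (∑-cong (allPoints m) (λ v → *-identityʳ _))))))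
        where
        open ≤-Reasoning
        transport : ∀ m → m ≡ 2 * H → m ≤ J₀ * J₀ → 3 * (ρ * 2 ^ m) ≤ 8 * (J₀ * ∑-band m H ρ (λ _ → 1))
        transport _ refl le = band-mass H ρ J₀ (≤-trans (>-nonZero⁻¹ ρ) ρ≤J₀) le ρ≤J₀
        ρ≤H : ρ ≤ H
        ρ≤H = begin
          ρ                 ≤⟨ m≤m+n ρ (30 * ρ) ⟩
          31 * ρ            ≤⟨ 31ρ≤b ⟩
          b                 ≡⟨ sym (*-identityˡ b) ⟩
          1 * b             ≤⟨ *-monoˡ-≤ b (*-mono-≤ (s≤s (z≤n {7})) s²>0) ⟩
          8 * (s * s) * b   ∎

      cube-size : 2 ^ n ≡ 16 * (2 ^ ℓ * (2 ^ a * 2 ^ m))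
      cube-size = begin
        2 ^ (4 + (ℓ + a * suc b))            ≡⟨ ^-distribˡ-+-* 2 4 (ℓ + a * suc b) ⟩
        16 * 2 ^ (ℓ + a * suc b)             ≡⟨ cong (16 *_) (^-distribˡ-+-* 2 ℓ (a * suc b)) ⟩
        16 * (2 ^ ℓ * 2 ^ (a * suc b))       ≡⟨ cong (λ e → 16 * (2 ^ ℓ * 2 ^ e)) (*-suc a b) ⟩
        16 * (2 ^ ℓ * 2 ^ (a + m))           ≡⟨ cong (λ e → 16 * (2 ^ ℓ * e)) (^-distribˡ-+-* 2 a m) ⟩
        16 * (2 ^ ℓ * (2 ^ a * 2 ^ m))       ∎
        where open ≡-Reasoning

    -- Yao's argument in counting form. The condition on J₀ says that ε is at most ρ / (8192 J₀),
    -- the distance guaranteed by the construction; the bound on q makes the average number of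
    -- clashes at most 2 q² / 2^s ≤ 1/64.
    no-tester : ρ ≤ J₀ → m ≤ J₀ * J₀ → J₀ * (8192 * P) ≤ ρ * Q → 128 * (q * q) ≤ 2 ^ s →
                WeightedTester n q P Q → ⊥
    no-tester ρ≤J₀ m≤J₀² J₀P≤ρQ 128q²≤2^s tester = <⇒≱ 3bad<W W≤3bad
      where
      open ≤-Reasoning
      open WeightedTester tester
      W = total algs

      bad : Vec (Fin (suc b)) a → Vec (Vec (Fin m) (suc t)) L → ℕ
      bad A τs = ∑[ p ← algs ] proj₁ p * clashes ℓ s A τs (DetAlg.queries (proj₂ p))

      N = length 𝔸 * length Ω

      bad-mass : 64 * (∑[ A ← 𝔸 ] ∑[ τs ← Ω ] bad A τs) ≤ W * N
      bad-mass = *-cancelˡ-≤ (2 ^ s) {{m^n≢0 2 s}} (begin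
        2 ^ s * (64 * (∑[ A ← 𝔸 ] ∑[ τs ← Ω ] bad A τs))
          ≡⟨ swap (2 ^ s) 64 _ ⟩
        64 * (2 ^ s * (∑[ A ← 𝔸 ] ∑[ τs ← Ω ] bad A τs))
          ≡⟨ cong (λ z → 64 * (2 ^ s * z)) (trans (∑-cong 𝔸 (λ A → ∑-swap Ω algs (λ τs p → c p A τs)))
               (∑-swap 𝔸 algs (λ A p → ∑[ τs ← Ω ] c p A τs))) ⟩
        64 * (2 ^ s * (∑[ p ← algs ] ∑[ A ← 𝔸 ] ∑[ τs ← Ω ] c p A τs))
          ≡⟨ cong (λ z → 64 * z) (sym (∑-*ˡ algs (2 ^ s) (λ p → ∑[ A ← 𝔸 ] ∑[ τs ← Ω ] c p A τs))) ⟩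
        64 * (∑[ p ← algs ] 2 ^ s * (∑[ A ← 𝔸 ] ∑[ τs ← Ω ] c p A τs))
          ≤⟨ *-monoʳ-≤ 64 (∑-mono algs each) ⟩
        64 * (∑[ p ← algs ] proj₁ p * (q * (q * (2 * N))))
          ≡⟨ cong (64 *_) (∑-*ʳ algs proj₁ (q * (q * (2 * N)))) ⟩
        64 * (W * (q * (q * (2 * N))))
          ≡⟨ lemma W q N ⟩
        128 * (q * q) * (W * N)
          ≤⟨ *-monoˡ-≤ (W * N) 128q²≤2^s ⟩
        2 ^ s * (W * N) ∎)
        where
        c : ℕ × DetAlg n q → Vec (Fin (suc b)) a → Vec (Vec (Fin m) (suc t)) L → ℕ
        c p A τs = proj₁ p * clashes ℓ s A τs (DetAlg.queries (proj₂ p))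
        swap : ∀ x y z → x * (y * z) ≡ y * (x * z)
        swap = solve-∀
        lemma : ∀ w q n → 64 * (w * (q * (q * (2 * n)))) ≡ 128 * (q * q) * (w * n)
        lemma = solve-∀
        each : ∀ p → 2 ^ s * (∑[ A ← 𝔸 ] ∑[ τs ← Ω ] c p A τs) ≤ proj₁ p * (q * (q * (2 * N)))
        each (w , alg) = begin
          2 ^ s * (∑[ A ← 𝔸 ] ∑[ τs ← Ω ] w * clashes ℓ s A τs qs)
            ≡⟨ cong (2 ^ s *_) (trans (∑-cong 𝔸 (λ A → ∑-*ˡ Ω w (λ τs → clashes ℓ s A τs qs)))
                 (∑-*ˡ 𝔸 w (λ A → ∑[ τs ← Ω ] clashes ℓ s A τs qs))) ⟩
          2 ^ s * (w * (∑[ A ← 𝔸 ] ∑[ τs ← Ω ] clashes ℓ s A τs qs))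
            ≡⟨ swap (2 ^ s) w _ ⟩
          w * (2 ^ s * (∑[ A ← 𝔸 ] ∑[ τs ← Ω ] clashes ℓ s A τs qs))
            ≤⟨ *-monoʳ-≤ w (clashes-mass ℓ s (8 * ρ) x y x≡ (trans y≡ (*-assoc 2 8 ρ)) qs) ⟩
          w * (q * (q * (2 * N))) ∎
          where qs = DetAlg.queries alg

      width>0 : 0 < width
      width>0 = pos width (≤-trans (*-mono-≤ (s≤s (z≤n {2})) (*-mono-≤ (>-nonZero⁻¹ ρ) (m^n>0 2 m))) (width-mass ρ≤J₀ m≤J₀²))
        where
        pos : ∀ w → 0 < 8 * (J₀ * w) → 0 < w
        pos zero    lt = contradiction lt (subst (λ z → ¬ (0 < 8 * z)) (sym (*-zeroʳ J₀)) λ ())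
        pos (suc w) lt = s≤s z≤n

      N>0 : 0 < N
      N>0 = subst (0 <_) (sym (cong₂ _*_ (length-secrets a b) (trans (length-vecs (terms m (suc t)) L) (cong (_^ L) (length-terms m (suc t))))))
        (*-mono-≤ (m^n>0 (suc b) a) (m^n>0 (m ^ suc t) {{m^n≢0 m (suc t) {{m≢0}}}} L))

      -- One inequality encodes both wishes for a single secret and term family. Divided by
      -- `width * W`, it reads 1 + 48 bad/W < 16 keyed/width. On average the left side is at most 1
      -- + 48/64 = 7/4 and the right side at least 16/8 = 2. Where it holds, dropping the second
      -- summand gives many keyed points, and bounding keyed by `width` gives 3 bad < W.
      before after : Vec (Fin (suc b)) a → Vec (Vec (Fin m) (suc t)) L → ℕ
      before A τs = width * W + 48 * width * bad A τs
      after  A τs = 16 * W * keyed τs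

      ∑before<∑after : ∑[ A ← 𝔸 ] ∑ Ω (before A) < ∑[ A ← 𝔸 ] ∑ Ω (after A)
      ∑before<∑after = *-cancelˡ-< 4 _ _ (begin-strict
        4 * (∑[ A ← 𝔸 ] ∑ Ω (before A))
          ≡⟨ cong (4 *_) (trans (∑-cong 𝔸 (λ A → trans (∑-+ Ω (λ _ → width * W) (λ τs → 48 * width * bad A τs))
               (cong₂ _+_ (∑-const Ω (width * W)) (∑-*ˡ Ω (48 * width) (bad A)))))
               (trans (∑-+ 𝔸 (λ _ → length Ω * (width * W)) (λ A → 48 * width * ∑ Ω (bad A)))
               (cong₂ _+_ (∑-const 𝔸 (length Ω * (width * W))) (∑-*ˡ 𝔸 (48 * width) (λ A → ∑ Ω (bad A)))))) ⟩
        4 * (length 𝔸 * (length Ω * (width * W)) + 48 * width * B)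
          ≡⟨ lemma₁ (length 𝔸) (length Ω) width W B ⟩
        4 * (N * (width * W)) + 3 * width * (64 * B)
          ≤⟨ +-monoʳ-≤ (4 * (N * (width * W))) (*-monoʳ-≤ (3 * width) bad-mass) ⟩
        4 * (N * (width * W)) + 3 * width * (W * N)
          ≡⟨ lemma₂ N width W ⟩
        7 * (N * (width * W))
          <⟨ *-monoˡ-< (N * (width * W)) {{>-nonZero (*-mono-≤ N>0 (*-mono-≤ width>0 total>0))}} (n<1+n 7) ⟩
        8 * (N * (width * W))
          ≡⟨ lemma₃ (length 𝔸) (length Ω) width W ⟩
        8 * (length 𝔸 * W) * (width * length Ω)
          ≤⟨ *-monoʳ-≤ (8 * (length 𝔸 * W)) keyed-mass ⟩
        8 * (length 𝔸 * W) * (8 * ∑ Ω keyed)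
          ≡⟨ lemma₄ (length 𝔸) W (∑ Ω keyed) ⟩
        4 * (length 𝔸 * (16 * W * ∑ Ω keyed))
          ≡⟨ cong (4 *_) (sym (trans (∑-const 𝔸 (∑[ τs ← Ω ] 16 * W * keyed τs)) (cong (length 𝔸 *_) (∑-*ˡ Ω (16 * W) keyed)))) ⟩
        4 * (∑[ A ← 𝔸 ] ∑ Ω (after A)) ∎)
        where
        B = ∑[ A ← 𝔸 ] ∑ Ω (bad A)
        lemma₁ : ∀ a o d w b → 4 * (a * (o * (d * w)) + 48 * d * b) ≡ 4 * (a * o * (d * w)) + 3 * d * (64 * b)
        lemma₁ = solve-∀
        lemma₂ : ∀ n d w → 4 * (n * (d * w)) + 3 * d * (w * n) ≡ 7 * (n * (d * w))
        lemma₂ = solve-∀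
        lemma₃ : ∀ a o d w → 8 * (a * o * (d * w)) ≡ 8 * (a * w) * (d * o)
        lemma₃ = solve-∀
        lemma₄ : ∀ a w k → 8 * (a * w) * (8 * k) ≡ 4 * (a * (16 * w * k))
        lemma₄ = solve-∀

      chosen-A = ∑-<⇒∃ 𝔸 (λ A → ∑ Ω (before A)) (λ A → ∑ Ω (after A)) ∑before<∑after
      A = proj₁ chosen-A
      chosen-τs = ∑-<⇒∃ Ω (before A) (after A) (proj₂ chosen-A)
      τs = proj₁ chosen-τs

      width≤16keyed : width ≤ 16 * keyed τs
      width≤16keyed = *-cancelʳ-≤ _ _ W {{>-nonZero total>0}} (begin
        width * W               ≤⟨ m≤m+n _ _ ⟩
        before A τs             ≤⟨ <⇒≤ (proj₂ chosen-τs) ⟩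
        16 * W * keyed τs       ≡⟨ lemma W (keyed τs) ⟩
        16 * keyed τs * W       ∎)
        where
        lemma : ∀ w k → 16 * w * k ≡ 16 * k * w
        lemma = solve-∀

      3bad<W : 3 * bad A τs < W
      3bad<W = *-cancelˡ-< (16 * width) _ _ (begin-strict
        16 * width * (3 * bad A τs)             ≡⟨ lemma₁ width (bad A τs) ⟩
        48 * width * bad A τs                   ≤⟨ m≤n+m _ (width * W) ⟩
        before A τs                             <⟨ proj₂ chosen-τs ⟩
        16 * W * keyed τs                       ≤⟨ *-monoʳ-≤ (16 * W) (keyed≤width τs) ⟩
        16 * W * width                          ≡⟨ lemma₂ W width ⟩
        16 * width * W                          ∎)
        where
        lemma₁ : ∀ d b → 16 * d * (3 * b) ≡ 48 * d * b
        lemma₁ = solve-∀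
        lemma₂ : ∀ w k → 16 * w * k ≡ 16 * k * w
        lemma₂ = solve-∀

      yes-instance no-instance : Vec Bool L → BoolFun n
      yes-instance bits = hard ℓ true s A τs bits
      no-instance  bits = hard ℓ false s A τs bits

      -- The constant 8192 is 16 · 12 · (8/3) · 16: the four marks, `low-mass`, `width-mass` and the
      -- keyed share of the band.
      far : ∀ bits g → Intersecting g → P * 2 ^ n ≤ Q * diffCount (no-instance bits) g
      far bits g inter = *-cancelˡ-≤ (3 * ρ) {{m*n≢0 3 ρ}} (begin
        3 * ρ * (P * 2 ^ n)
          ≡⟨ cong (λ z → 3 * ρ * (P * z)) cube-size ⟩
        3 * ρ * (P * (16 * (2 ^ ℓ * (2 ^ a * 2 ^ m))))
          ≡⟨ lemma₁ ρ P (2 ^ ℓ) (2 ^ a) (2 ^ m) ⟩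
        16 * P * 2 ^ ℓ * (2 ^ a * (3 * (ρ * 2 ^ m)))
          ≤⟨ *-monoʳ-≤ (16 * P * 2 ^ ℓ) (*-mono-≤ (low-mass s) (≤-trans (width-mass ρ≤J₀ m≤J₀²)
               (*-monoʳ-≤ 8 (*-monoʳ-≤ J₀ (≤-trans width≤16keyed (*-monoʳ-≤ 16 (keyed≤good τs))))))) ⟩
        16 * P * 2 ^ ℓ * (12 * Low * (8 * (J₀ * (16 * Good))))
          ≡⟨ lemma₂ 16 12 8 P (2 ^ ℓ) Low J₀ Good ⟩
        3 * 8192 * (P * 2 ^ ℓ * Low * J₀ * Good)
          ≡⟨ lemma₄ 3 8192 P (2 ^ ℓ) Low J₀ Good ⟩
        3 * (J₀ * (8192 * P)) * (2 ^ ℓ * (Good * Low))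
          ≤⟨ *-mono-≤ (*-monoʳ-≤ 3 J₀P≤ρQ) (hard-far ℓ s A τs bits g inter) ⟩
        3 * (ρ * Q) * diffCount (no-instance bits) g
          ≡⟨ lemma₃ ρ Q (diffCount (no-instance bits) g) ⟩
        3 * ρ * (Q * diffCount (no-instance bits) g) ∎)
        where
        Low = ∑[ u ← allPoints a ] 𝟙 (low s u)
        Good = ∑[ v ← allPoints m ] 𝟙 (good τs v)
        lemma₁ : ∀ ρ p l a m → 3 * ρ * (p * (16 * (l * (a * m)))) ≡ 16 * p * l * (a * (3 * (ρ * m)))
        lemma₁ = solve-∀
        lemma₂ : ∀ c d e p l w j g → c * p * l * (d * w * (e * (j * (c * g)))) ≡ c * d * e * c * (p * l * w * j * g)
        lemma₂ = solve-∀
        lemma₄ : ∀ c d p l w j g → c * d * (p * l * w * j * g) ≡ c * (j * (d * p)) * (l * (g * w))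
        lemma₄ = solve-∀
        lemma₃ : ∀ ρ q d → 3 * (ρ * q) * d ≡ 3 * ρ * (q * d)
        lemma₃ = solve-∀

      cube = allPoints L

      ∑accept : (Vec Bool L → BoolFun n) → ℕ
      ∑accept f = ∑[ p ← algs ] proj₁ p * (∑[ bits ← cube ] 𝟙 (runDet (proj₂ p) (f bits)))

      ∑-accept : ∀ f → ∑[ bits ← cube ] 3 * accept algs (f bits) ≡ 3 * ∑accept f
      ∑-accept f = trans (∑-*ˡ cube 3 (λ bits → accept algs (f bits))) (cong (3 *_)
        (trans (∑-swap cube algs (λ bits p → proj₁ p * 𝟙 (runDet (proj₂ p) (f bits))))
          (∑-cong algs (λ p → ∑-*ˡ cube (proj₁ p) (λ bits → 𝟙 (runDet (proj₂ p) (f bits)))))))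

      -- Averaged over the bits, acceptance must drop by W/3 from intersecting to far, but the
      -- coupling lets the two averages differ by at most `bad A τs`.
      W≤3bad : W ≤ 3 * bad A τs
      W≤3bad = *-cancelˡ-≤ (2 ^ L) {{m^n≢0 2 L}} (+-cancelˡ-≤ (2 ^ L * W) _ _ (begin
        2 ^ L * W + 2 ^ L * W                    ≡⟨ lemma₁ (2 ^ L) W ⟩
        2 ^ L * (2 * W)                          ≡⟨ sym (∑-cube-const L (2 * W)) ⟩
        ∑[ bits ← cube ] 2 * W                   ≤⟨ ∑-mono cube (λ bits → sound (yes-instance bits) (hard-intersecting ℓ s A τs bits)) ⟩
        ∑[ bits ← cube ] 3 * accept algs (yes-instance bits) ≡⟨ ∑-accept yes-instance ⟩
        3 * ∑accept yes-instance                 ≤⟨ *-monoʳ-≤ 3 (∑-mono algs (λ p → *-monoʳ-≤ (proj₁ p) (indistinguishable ℓ s A τs (proj₂ p)))) ⟩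
        3 * (∑[ p ← algs ] proj₁ p * (F p + 2 ^ L * C p))
          ≡⟨ cong (3 *_) (trans (∑-cong algs (λ p → lemma₂ (proj₁ p) (F p) (2 ^ L) (C p)))
               (trans (∑-+ algs (λ p → proj₁ p * F p) (λ p → 2 ^ L * (proj₁ p * C p))) (cong (∑accept no-instance +_) (∑-*ˡ algs (2 ^ L) (λ p → proj₁ p * C p))))) ⟩
        3 * (∑accept no-instance + 2 ^ L * bad A τs) ≡⟨ lemma₃ (∑accept no-instance) (2 ^ L) (bad A τs) ⟩
        3 * ∑accept no-instance + 2 ^ L * (3 * bad A τs)
          ≡⟨ cong (_+ 2 ^ L * (3 * bad A τs)) (sym (∑-accept no-instance)) ⟩
        (∑[ bits ← cube ] 3 * accept algs (no-instance bits)) + 2 ^ L * (3 * bad A τs)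
          ≤⟨ +-monoˡ-≤ (2 ^ L * (3 * bad A τs)) (∑-mono cube (λ bits → reject (no-instance bits) (far bits))) ⟩
        (∑[ bits ← cube ] W) + 2 ^ L * (3 * bad A τs) ≡⟨ cong (_+ 2 ^ L * (3 * bad A τs)) (∑-cube-const L W) ⟩
        2 ^ L * W + 2 ^ L * (3 * bad A τs)       ∎))
        where
        F C : ℕ × DetAlg n q → ℕ
        F p = ∑[ bits ← cube ] 𝟙 (runDet (proj₂ p) (no-instance bits))
        C p = clashes ℓ s A τs (DetAlg.queries (proj₂ p))
        lemma₁ : ∀ l w → l * w + l * w ≡ l * (2 * w)
        lemma₁ = solve-∀
        lemma₂ : ∀ w f l c → w * (f + l * c) ≡ w * f + l * (w * c)
        lemma₂ = solve-∀
        lemma₃ : ∀ f l b → 3 * (f + l * b) ≡ 3 * f + l * (3 * b)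
        lemma₃ = solve-∀

  -- Choice of parameters

  square-cancel-≤ : ∀ {m n} → m * m ≤ n * n → m ≤ n
  square-cancel-≤ m²≤n² = ≮⇒≥ λ n<m → <⇒≱ (*-mono-< n<m n<m) m²≤n²

  -- The power mean inequality. The construction uses k + 1 so that s is positive for k = 0, whereas
  -- the hypothesis of the theorem bounds k.
  [1+k]⁴≤8[k⁴+1] : ∀ k → suc k * suc k * (suc k * suc k) ≤ 8 * (k * k * (k * k) + 1)
  [1+k]⁴≤8[k⁴+1] k = begin
    suc k * suc k * (suc k * suc k)              ≤⟨ *-mono-≤ square square ⟩
    2 * (k * k + 1) * (2 * (k * k + 1))          ≡⟨ lemma₁ (k * k) ⟩
    4 * (2 * (k * k * 1)) + 4 * (k * k * (k * k) + 1) ≤⟨ +-monoˡ-≤ _ (*-monoʳ-≤ 4 (2xy≤x²+y² (k * k) 1)) ⟩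
    4 * (k * k * (k * k) + 1) + 4 * (k * k * (k * k) + 1) ≡⟨ lemma₂ (k * k * (k * k) + 1) ⟩
    8 * (k * k * (k * k) + 1)                    ∎
    where
    open ≤-Reasoning
    lemma₁ : ∀ x → 2 * (x + 1) * (2 * (x + 1)) ≡ 4 * (2 * (x * 1)) + 4 * (x * x + 1)
    lemma₁ = solve-∀
    lemma₂ : ∀ x → 4 * x + 4 * x ≡ 8 * x
    lemma₂ = solve-∀
    lemma₃ : ∀ k → suc k * suc k ≡ 2 * (k * 1) + (k * k + 1)
    lemma₃ = solve-∀
    lemma₄ : ∀ x → x + x ≡ 2 * x
    lemma₄ = solve-∀
    square : suc k * suc k ≤ 2 * (k * k + 1)
    square = begin
      suc k * suc k                  ≡⟨ lemma₃ k ⟩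
      2 * (k * 1) + (k * k + 1)      ≤⟨ +-monoˡ-≤ (k * k + 1) (2xy≤x²+y² k 1) ⟩
      (k * k + 1) + (k * k + 1)      ≡⟨ lemma₄ (k * k + 1) ⟩
      2 * (k * k + 1)                ∎

  -- Below u = 2¹⁵ and K = 8192, kept as variables so that no large numeral is ever normalised.
  module Parameters (u K k n P Q : ℕ) .{{_ : NonZero P}} .{{_ : NonZero K}} (u≡4K : u ≡ 4 * K) (5≤u : 5 ≤ u)
           (P≪Q : 4 * (u * u) * P ≤ Q) (Q²≤P²n : Q * Q ≤ P * P * n)
           (k⁴P²≤nQ² : 16 * (u * u * (u * u)) * (k * k * (k * k) * (P * P)) ≤ n * (Q * Q)) where
    open ≤-Reasoning
    private
      κ d : ℕ
      κ = suc k
      -- With s = 8κ, the a = 16 s² rows of length 32ρ take up 16 · 64 · 32 κ²ρ = 2¹⁵ κ²ρ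
      -- coordinates, that is ρ d; this is the origin of u.
      d = u * (κ * κ)

    instance
      Q≢0 : NonZero Q
      Q≢0 = >-nonZero (≤-trans (*-mono-≤ {1} {4 * (u * u)} (*-mono-≤ {1} {4} (s≤s z≤n) (*-mono-≤ 1≤u 1≤u)) (>-nonZero⁻¹ P)) P≪Q)
        where
        1≤u : 1 ≤ u
        1≤u = ≤-trans (s≤s z≤n) 5≤u

      u≢0 : NonZero u
      u≢0 = >-nonZero (≤-trans (s≤s z≤n) 5≤u)

      d≢0 : NonZero d
      d≢0 = m*n≢0 u (κ * κ)

      KP≢0 : NonZero (K * P)
      KP≢0 = m*n≢0 K P

      n≢0 : NonZero n
      n≢0 = m*n≢0⇒n≢0 (P * P) {{>-nonZero (≤-trans (*-mono-≤ (>-nonZero⁻¹ Q) (>-nonZero⁻¹ Q)) Q²≤P²n)}}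

    -- In the bound 8 (k⁴ + 1) for κ⁴, the first summand is paid by the hypothesis on k, the second
    -- by ε ≤ 1/(4u²). This is what fixes the two constants of the theorem.
    κ⁴P²≤nQ² : u * u * (u * u) * (κ * κ * (κ * κ) * (P * P)) ≤ n * (Q * Q)
    κ⁴P²≤nQ² = *-cancelˡ-≤ 2 (begin
      2 * (u * u * (u * u) * (κ * κ * (κ * κ) * (P * P)))
        ≤⟨ *-monoʳ-≤ 2 (*-monoʳ-≤ (u * u * (u * u)) (*-monoˡ-≤ (P * P) ([1+k]⁴≤8[k⁴+1] k))) ⟩
      2 * (u * u * (u * u) * (8 * (k * k * (k * k) + 1) * (P * P)))
        ≡⟨ lemma₁ (u * u) (k * k * (k * k)) P ⟩
      16 * (u * u * (u * u)) * (k * k * (k * k) * (P * P)) + 4 * (u * u) * P * (4 * (u * u) * P)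
        ≤⟨ +-mono-≤ k⁴P²≤nQ² (*-mono-≤ P≪Q P≪Q) ⟩
      n * (Q * Q) + Q * Q
        ≤⟨ +-monoʳ-≤ (n * (Q * Q)) (m≤n*m (Q * Q) n) ⟩
      n * (Q * Q) + n * (Q * Q)
        ≡⟨ cong (n * (Q * Q) +_) (sym (+-identityʳ _)) ⟩
      2 * (n * (Q * Q)) ∎)
      where
      lemma₁ : ∀ u k p → 2 * (u * u * (8 * (k + 1) * (p * p))) ≡ 16 * (u * u) * (k * (p * p)) + 4 * u * p * (4 * u * p)
      lemma₁ = solve-∀

    -- Here ε ≥ 1/√n is used: u⁴κ⁴ ≤ n/ε² ≤ n². It leaves room for at least one block of d
    -- coordinates beside the four marks.
    ud≤n : u * d ≤ n
    ud≤n = square-cancel-≤ (*-cancelʳ-≤ _ _ (Q * Q) {{m*n≢0 Q Q}} (begin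
      u * d * (u * d) * (Q * Q)
        ≤⟨ *-monoʳ-≤ (u * d * (u * d)) Q²≤P²n ⟩
      u * d * (u * d) * (P * P * n)
        ≡⟨ lemma u κ P n ⟩
      n * (u * u * (u * u) * (κ * κ * (κ * κ) * (P * P)))
        ≤⟨ *-monoʳ-≤ n κ⁴P²≤nQ² ⟩
      n * (n * (Q * Q))
        ≡⟨ sym (*-assoc n n (Q * Q)) ⟩
      n * n * (Q * Q) ∎))
      where
      lemma : ∀ u k p n → u * (u * (k * k)) * (u * (u * (k * k))) * (p * p * n) ≡ n * (u * u * (u * u) * (k * k * (k * k) * (p * p)))
      lemma = solve-∀

    4+d≤n : 4 + d ≤ n
    4+d≤n = begin
      4 + d            ≤⟨ +-monoˡ-≤ d (*-monoʳ-≤ 4 (>-nonZero⁻¹ d)) ⟩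
      4 * d + d        ≡⟨ +-comm (4 * d) d ⟩
      5 * d            ≤⟨ *-monoˡ-≤ d 5≤u ⟩
      u * d            ≤⟨ ud≤n ⟩
      n                ∎

    -- ρ is as large as the dimension permits, and J₀ is ρ / (K ε) rounded down, the widest
    -- comparison band for which the guaranteed distance is still ε.
    ρ ℓ J₀ : ℕ
    ρ  = (n ∸ 4) / d
    ℓ  = (n ∸ 4) % d
    J₀ = ρ * Q / (K * P)

    4≤n : 4 ≤ n
    4≤n = m+n≤o⇒m≤o 4 4+d≤n

    n≡ : n ≡ 4 + (ℓ + ρ * d)
    n≡ = trans (sym (m+[n∸m]≡n 4≤n)) (cong (4 +_) (m≡m%n+[m/n]*n (n ∸ 4) d))

    instance
      ρ≢0 : NonZero ρ
      ρ≢0 = ≢-nonZero λ ρ≡0 → <⇒≱ (m%n<n (n ∸ 4) d) (begin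
        d                ≤⟨ m+n≤o⇒m≤o∸n d (subst (_≤ n) (+-comm 4 d) 4+d≤n) ⟩
        n ∸ 4            ≡⟨ m≡m%n+[m/n]*n (n ∸ 4) d ⟩
        ℓ + ρ * d        ≡⟨ cong (λ z → ℓ + z * d) ρ≡0 ⟩
        ℓ + 0            ≡⟨ +-identityʳ ℓ ⟩
        ℓ                ∎)

    n≤4ρd : n ≤ 4 * (ρ * d)
    n≤4ρd = begin
      n                                        ≡⟨ n≡ ⟩
      4 + (ℓ + ρ * d)                          ≤⟨ +-mono-≤ 4≤ρd (+-monoˡ-≤ (ρ * d) (≤-trans (<⇒≤ (m%n<n (n ∸ 4) d)) (m≤n*m d ρ))) ⟩
      2 * (ρ * d) + (ρ * d + ρ * d)            ≡⟨ lemma (ρ * d) ⟩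
      4 * (ρ * d)                              ∎
      where
      lemma : ∀ x → 2 * x + (x + x) ≡ 4 * x
      lemma = solve-∀
      4≤ρd : 4 ≤ 2 * (ρ * d)
      4≤ρd = ≤-trans (≤-trans (n≤1+n 4) (≤-trans 5≤u (≤-trans (m≤m*n u (κ * κ)) (m≤n*m d ρ)))) (m≤n*m (ρ * d) 2)

    J₀KP≤ρQ : J₀ * (K * P) ≤ ρ * Q
    J₀KP≤ρQ = m/n*n≤m (ρ * Q) (K * P)

    ρ≤J₀ : ρ ≤ J₀
    ρ≤J₀ = begin
      ρ                          ≡⟨ sym (m*n/n≡m ρ (K * P)) ⟩
      ρ * (K * P) / (K * P)      ≤⟨ /-monoˡ-≤ (K * P) (*-monoʳ-≤ ρ KP≤Q) ⟩
      ρ * Q / (K * P)            ∎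
      where
      KP≤Q : K * P ≤ Q
      KP≤Q = ≤-trans (*-monoˡ-≤ P (begin
        K                 ≤⟨ m≤n*m K 4 ⟩
        4 * K             ≡⟨ sym u≡4K ⟩
        u                 ≤⟨ m≤m*n u u ⟩
        u * u             ≤⟨ m≤n*m (u * u) 4 ⟩
        4 * (u * u)       ∎)) P≪Q

    ρQ≤2J₀KP : ρ * Q ≤ 2 * (J₀ * (K * P))
    ρQ≤2J₀KP = begin
      ρ * Q                                  ≡⟨ m≡m%n+[m/n]*n (ρ * Q) (K * P) ⟩
      ρ * Q % (K * P) + J₀ * (K * P)         ≤⟨ +-monoˡ-≤ _ (≤-trans (<⇒≤ (m%n<n (ρ * Q) (K * P))) (m≤n*m (K * P) J₀ {{>-nonZero (≤-trans (>-nonZero⁻¹ ρ) ρ≤J₀)}})) ⟩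
      J₀ * (K * P) + J₀ * (K * P)            ≡⟨ cong (J₀ * (K * P) +_) (sym (+-identityʳ _)) ⟩
      2 * (J₀ * (K * P))                     ∎

    u³κ²P²≤4ρQ² : u * (u * u) * (κ * κ) * (P * P) ≤ 4 * (ρ * (Q * Q))
    u³κ²P²≤4ρQ² = *-cancelˡ-≤ d (begin
      d * (u * (u * u) * (κ * κ) * (P * P))                ≡⟨ lemma₁ u κ P ⟩
      u * u * (u * u) * (κ * κ * (κ * κ) * (P * P))        ≤⟨ κ⁴P²≤nQ² ⟩
      n * (Q * Q)                                          ≤⟨ *-monoˡ-≤ (Q * Q) n≤4ρd ⟩
      4 * (ρ * d) * (Q * Q)                                ≡⟨ lemma₂ ρ d Q ⟩
      d * (4 * (ρ * (Q * Q)))                              ∎)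
      where
      lemma₁ : ∀ u k p → u * (k * k) * (u * (u * u) * (k * k) * (p * p)) ≡ u * u * (u * u) * (k * k * (k * k) * (p * p))
      lemma₁ = solve-∀
      lemma₂ : ∀ r d q → 4 * (r * d) * (q * q) ≡ d * (4 * (r * (q * q)))
      lemma₂ = solve-∀

    -- Chebyshev needs J₀ ≥ √m. With J₀ about ρ/(Kε) and ρ about n/d this amounts to d²ε² = O(n),
    -- hence to κ = O(n^(1/4)/√ε): the exponent of the theorem is decided here.
    ρd≤J₀² : ρ * d ≤ J₀ * J₀
    ρd≤J₀² = *-cancelˡ-≤ (u * P * (u * P)) {{m*n≢0 _ _ {{m*n≢0 u P}} {{m*n≢0 u P}}}} (begin
      u * P * (u * P) * (ρ * d)                            ≡⟨ lemma₁ u P ρ κ ⟩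
      ρ * (u * (u * u) * (κ * κ) * (P * P))                ≤⟨ *-monoʳ-≤ ρ u³κ²P²≤4ρQ² ⟩
      ρ * (4 * (ρ * (Q * Q)))                              ≡⟨ lemma₂ ρ Q ⟩
      4 * (ρ * Q * (ρ * Q))                                ≤⟨ *-monoʳ-≤ 4 (*-mono-≤ ρQ≤2J₀KP ρQ≤2J₀KP) ⟩
      4 * (2 * (J₀ * (K * P)) * (2 * (J₀ * (K * P))))      ≡⟨ lemma₃ J₀ K P ⟩
      4 * K * P * (4 * K * P) * (J₀ * J₀)                  ≡⟨ cong (λ u → u * P * (u * P) * (J₀ * J₀)) (sym u≡4K) ⟩
      u * P * (u * P) * (J₀ * J₀)                          ∎)
      where
      lemma₁ : ∀ u p r k → u * p * (u * p) * (r * (u * (k * k))) ≡ r * (u * (u * u) * (k * k) * (p * p))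
      lemma₁ = solve-∀
      lemma₂ : ∀ r q → r * (4 * (r * (q * q))) ≡ 4 * (r * q * (r * q))
      lemma₂ = solve-∀
      lemma₃ : ∀ j k p → 4 * (2 * (j * (k * p)) * (2 * (j * (k * p)))) ≡ 4 * k * p * (4 * k * p) * (j * j)
      lemma₃ = solve-∀

  query-bound : ∀ u k n P Q q .{{_ : NonZero P}} → u ≡ 32768 →
    4 * (u * u) * P ≤ Q → Q * Q ≤ P * P * n →
    16 * (u * u * (u * u)) * (k * k * (k * k) * (P * P)) ≤ n * (Q * Q) →
    WeightedTester n q P Q → 2 ^ k ≤ q
  query-bound u k n P Q q refl P≪Q Q²≤P²n k⁴P²≤nQ² tester = ≮⇒≥ λ q<2^k →
    no-tester P Q q ℓ s ρ J₀ (pred (64 * s)) y {{_}} {{ρ≢0}} {{y≢0}} (suc-pred (64 * s)) y≡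
      ρ≤J₀
      (≤-trans (*-monoʳ-≤ (16 * (s * s)) (n≤1+n (suc (2 * y)))) (≤-trans (≤-reflexive size) ρd≤J₀²))
      J₀KP≤ρQ
      (few q<2^k)
      (subst (λ n → WeightedTester n q P Q) dimension tester)
    where
    5≤u : 5 ≤ u
    5≤u = s≤s (s≤s (s≤s (s≤s (s≤s z≤n))))
    s = 8 * suc k
    d = u * (suc k * suc k)
    open Parameters u 8192 k n P Q refl 5≤u P≪Q Q²≤P²n k⁴P²≤nQ²
    y = pred (16 * ρ)
    16ρ≢0 : NonZero (16 * ρ)
    16ρ≢0 = m*n≢0 16 ρ {{_}} {{ρ≢0}}
    y≡ : suc y ≡ 16 * ρ
    y≡ = suc-pred (16 * ρ) {{16ρ≢0}}
    y≢0 : NonZero y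
    y≢0 = >-nonZero (≤-pred (subst (2 ≤_) (sym y≡) (*-mono-≤ {2} {16} (s≤s (s≤s z≤n)) (>-nonZero⁻¹ ρ {{ρ≢0}}))))
    size : 16 * (s * s) * suc (suc (2 * y)) ≡ ρ * d
    size = begin
      16 * (s * s) * suc (suc (2 * y))                  ≡⟨ lemma₁ (s * s) y ⟩
      16 * (s * s) * (2 * suc y)                        ≡⟨ cong (λ z → 16 * (s * s) * (2 * z)) y≡ ⟩
      16 * (s * s) * (2 * (16 * ρ))                    ≡⟨ lemma₂ 16 8 2 (suc k) ρ ⟩
      ρ * (16 * (8 * 8) * (2 * 16) * (suc k * suc k))  ∎
      where
      open ≡-Reasoning
      lemma₁ : ∀ s y → 16 * s * suc (suc (2 * y)) ≡ 16 * s * (2 * suc y)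
      lemma₁ = solve-∀
      lemma₂ : ∀ a b c k r → a * (b * k * (b * k)) * (c * (a * r)) ≡ r * (a * (b * b) * (c * a) * (k * k))
      lemma₂ = solve-∀
    dimension : n ≡ 4 + (ℓ + 16 * (s * s) * suc (suc (2 * y)))
    dimension = trans (n≡) (cong (λ z → 4 + (ℓ + z)) (sym size))
    few : q < 2 ^ k → 128 * (q * q) ≤ 2 ^ s
    few q<2^k = begin
      128 * (q * q)            ≤⟨ *-monoʳ-≤ 128 (*-mono-≤ (<⇒≤ q<2^k) (<⇒≤ q<2^k)) ⟩
      2 ^ 7 * (2 ^ k * 2 ^ k)  ≡⟨ sym (trans (^-distribˡ-+-* 2 7 (k + k)) (cong (2 ^ 7 *_) (^-distribˡ-+-* 2 k k))) ⟩
      2 ^ (7 + (k + k))        ≤⟨ ^-monoʳ-≤ 2 (≤-trans (m≤m+n (7 + (k + k)) (1 + 6 * k)) (≤-reflexive (lemma k))) ⟩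
      2 ^ s                    ∎
      where
      open ≤-Reasoning
      lemma : ∀ k → 7 + (k + k) + (1 + 6 * k) ≡ 8 * suc k
      lemma = solve-∀

-- From rational probabilities to natural weights

module Fractions where
  open Counting
  open import Data.Bool using (Bool; true; false; if_then_else_)
  open import Data.Nat as ℕ using (ℕ; zero; suc; _+_; _*_; _^_; _≤_; _<_; z≤n; s≤s; NonZero)
  open import Data.Nat.Properties as ℕₚ using (≤-antisym; ≤-reflexive; *-comm; *-assoc; *-identityʳ; *-zeroʳ; *-mono-≤)
  open import Data.Nat.Tactic.RingSolver using (solve-∀)
  open import Data.Integer as ℤ using (+_; -[1+_])
  import Data.Integer.Properties as ℤₚ
  open import Data.Nat.Coprimality using (Coprime)
  open import Data.List as List using (List; []; _∷_; length)
  open import Data.List.Relation.Unary.All using (All; []; _∷_)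
  open import Data.Product using (Σ; ∃; _×_; _,_; proj₁; proj₂)
  open import Data.Rational as ℚ using (ℚ; 0ℚ; 1ℚ; mkℚ; toℚᵘ)
  import Data.Rational.Properties as ℚₚ
  open import Data.Rational.Unnormalised as ℚᵘ using (ℚᵘ; mkℚᵘ; _≃_; *≡*; *≤*)
  import Data.Rational.Unnormalised.Properties as ℚᵘₚ
  open import Function using (_∘_)
  open import Relation.Binary.PropositionalEquality

  toℚᵘ-ℕtoℚ : ∀ n → toℚᵘ (ℕtoℚ n) ≃ mkℚᵘ (+ n) 0
  toℚᵘ-ℕtoℚ n = ℚₚ.toℚᵘ-fromℚᵘ (mkℚᵘ (+ n) 0)

  ℕtoℚ-+ : ∀ m n → ℕtoℚ (m + n) ≡ ℕtoℚ m ℚ.+ ℕtoℚ n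
  ℕtoℚ-+ m n = ℚₚ.toℚᵘ-injective (begin
    toℚᵘ (ℕtoℚ (m + n))                   ≈⟨ toℚᵘ-ℕtoℚ (m + n) ⟩
    mkℚᵘ (+ (m + n)) 0                    ≈⟨ *≡* (cong (ℤ._* + 1) (cong₂ ℤ._+_ (sym (ℤₚ.*-identityʳ (+ m))) (sym (ℤₚ.*-identityʳ (+ n))))) ⟩
    mkℚᵘ (+ m) 0 ℚᵘ.+ mkℚᵘ (+ n) 0        ≈⟨ ℚᵘₚ.+-cong (ℚᵘₚ.≃-sym (toℚᵘ-ℕtoℚ m)) (ℚᵘₚ.≃-sym (toℚᵘ-ℕtoℚ n)) ⟩
    toℚᵘ (ℕtoℚ m) ℚᵘ.+ toℚᵘ (ℕtoℚ n)      ≈⟨ ℚᵘₚ.≃-sym (ℚₚ.toℚᵘ-homo-+ (ℕtoℚ m) (ℕtoℚ n)) ⟩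
    toℚᵘ (ℕtoℚ m ℚ.+ ℕtoℚ n)              ∎)
    where open import Relation.Binary.Reasoning.Setoid ℚᵘₚ.≃-setoid

  ℕtoℚ-* : ∀ m n → ℕtoℚ (m * n) ≡ ℕtoℚ m ℚ.* ℕtoℚ n
  ℕtoℚ-* m n = ℚₚ.toℚᵘ-injective (begin
    toℚᵘ (ℕtoℚ (m * n))                   ≈⟨ toℚᵘ-ℕtoℚ (m * n) ⟩
    mkℚᵘ (+ (m * n)) 0                    ≈⟨ *≡* (cong (ℤ._* + 1) (ℤₚ.pos-* m n)) ⟩
    mkℚᵘ (+ m) 0 ℚᵘ.* mkℚᵘ (+ n) 0        ≈⟨ ℚᵘₚ.*-cong (ℚᵘₚ.≃-sym (toℚᵘ-ℕtoℚ m)) (ℚᵘₚ.≃-sym (toℚᵘ-ℕtoℚ n)) ⟩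
    toℚᵘ (ℕtoℚ m) ℚᵘ.* toℚᵘ (ℕtoℚ n)      ≈⟨ ℚᵘₚ.≃-sym (ℚₚ.toℚᵘ-homo-* (ℕtoℚ m) (ℕtoℚ n)) ⟩
    toℚᵘ (ℕtoℚ m ℚ.* ℕtoℚ n)              ∎)
    where open import Relation.Binary.Reasoning.Setoid ℚᵘₚ.≃-setoid

  ℕtoℚ-mono-≤ : ∀ {m n} → m ≤ n → ℕtoℚ m ℚ.≤ ℕtoℚ n
  ℕtoℚ-mono-≤ {m} {n} m≤n = ℚₚ.toℚᵘ-cancel-≤ (ℚᵘₚ.≤-respˡ-≃ (ℚᵘₚ.≃-sym (toℚᵘ-ℕtoℚ m)) (ℚᵘₚ.≤-respʳ-≃ (ℚᵘₚ.≃-sym (toℚᵘ-ℕtoℚ n))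
    (*≤* (ℤₚ.*-monoʳ-≤-nonNeg (+ 1) (ℤ.+≤+ m≤n)))))

  ℕtoℚ-cancel-≤ : ∀ {m n} → ℕtoℚ m ℚ.≤ ℕtoℚ n → m ≤ n
  ℕtoℚ-cancel-≤ {m} {n} le with ℚᵘₚ.≤-respˡ-≃ (toℚᵘ-ℕtoℚ m) (ℚᵘₚ.≤-respʳ-≃ (toℚᵘ-ℕtoℚ n) (ℚₚ.toℚᵘ-mono-≤ le))
  ... | *≤* le′ = ℤₚ.drop‿+≤+ (subst₂ ℤ._≤_ (ℤₚ.*-identityʳ (+ m)) (ℤₚ.*-identityʳ (+ n)) le′)

  ℕtoℚ-injective : ∀ {m n} → ℕtoℚ m ≡ ℕtoℚ n → m ≡ n
  ℕtoℚ-injective e = ≤-antisym (ℕtoℚ-cancel-≤ (ℚₚ.≤-reflexive e)) (ℕtoℚ-cancel-≤ (ℚₚ.≤-reflexive (sym e)))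

  ℕtoℚ-nonNeg : ∀ n → ℚ.NonNegative (ℕtoℚ n)
  ℕtoℚ-nonNeg n = ℚ.nonNegative (ℕtoℚ-mono-≤ (z≤n {n}))

  ℕtoℚ-pos : ∀ n .{{_ : NonZero n}} → ℚ.Positive (ℕtoℚ n)
  ℕtoℚ-pos (suc n) = ℚ.positive (ℚₚ.<-≤-trans 0<1 (ℕtoℚ-mono-≤ (s≤s (z≤n {n}))))
    where
    0<1 : 0ℚ ℚ.< 1ℚ
    0<1 = ℚ.*<* (ℤ.+<+ (s≤s z≤n))

  -- p = a / b, free of normalisation.
  record _≐_/_ (p : ℚ) (a b : ℕ) : Set where
    constructor cross
    field scaled : p ℚ.* ℕtoℚ b ≡ ℕtoℚ a

  open _≐_/_

  ≐-mkℚ : ∀ P d .(c : Coprime P (suc d)) → mkℚ (+ P) d c ≐ P / suc d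
  ≐-mkℚ P d c = cross (ℚₚ.toℚᵘ-injective (begin
    toℚᵘ (mkℚ (+ P) d c ℚ.* ℕtoℚ (suc d))        ≈⟨ ℚₚ.toℚᵘ-homo-* (mkℚ (+ P) d c) (ℕtoℚ (suc d)) ⟩
    mkℚᵘ (+ P) d ℚᵘ.* toℚᵘ (ℕtoℚ (suc d))        ≈⟨ ℚᵘₚ.*-cong (ℚᵘₚ.≃-refl {mkℚᵘ (+ P) d}) (toℚᵘ-ℕtoℚ (suc d)) ⟩
    mkℚᵘ (+ P) d ℚᵘ.* mkℚᵘ (+ suc d) 0           ≈⟨ *≡* (trans (ℤₚ.*-identityʳ (+ P ℤ.* + suc d)) (cong (λ z → + P ℤ.* + z) (sym (*-identityʳ (suc d))))) ⟩
    mkℚᵘ (+ P) 0                                 ≈⟨ ℚᵘₚ.≃-sym (toℚᵘ-ℕtoℚ P) ⟩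
    toℚᵘ (ℕtoℚ P)                                ∎))
    where open import Relation.Binary.Reasoning.Setoid ℚᵘₚ.≃-setoid

  ℚ-interchange : ∀ p q r s → (p ℚ.* q) ℚ.* (r ℚ.* s) ≡ (p ℚ.* r) ℚ.* (q ℚ.* s)
  ℚ-interchange p q r s = begin
    (p ℚ.* q) ℚ.* (r ℚ.* s)   ≡⟨ ℚₚ.*-assoc p q (r ℚ.* s) ⟩
    p ℚ.* (q ℚ.* (r ℚ.* s))   ≡⟨ cong (p ℚ.*_) (sym (ℚₚ.*-assoc q r s)) ⟩
    p ℚ.* ((q ℚ.* r) ℚ.* s)   ≡⟨ cong (λ z → p ℚ.* (z ℚ.* s)) (ℚₚ.*-comm q r) ⟩
    p ℚ.* ((r ℚ.* q) ℚ.* s)   ≡⟨ cong (p ℚ.*_) (ℚₚ.*-assoc r q s) ⟩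
    p ℚ.* (r ℚ.* (q ℚ.* s))   ≡⟨ sym (ℚₚ.*-assoc p r (q ℚ.* s)) ⟩
    (p ℚ.* r) ℚ.* (q ℚ.* s)   ∎
    where open ≡-Reasoning

  ≐-* : ∀ {p q a b c d} → p ≐ a / b → q ≐ c / d → (p ℚ.* q) ≐ (a * c) / (b * d)
  ≐-* {p} {q} {a} {b} {c} {d} (cross ep) (cross eq) = cross (begin
    (p ℚ.* q) ℚ.* ℕtoℚ (b * d)               ≡⟨ cong ((p ℚ.* q) ℚ.*_) (ℕtoℚ-* b d) ⟩
    (p ℚ.* q) ℚ.* (ℕtoℚ b ℚ.* ℕtoℚ d)        ≡⟨ ℚ-interchange p q (ℕtoℚ b) (ℕtoℚ d) ⟩
    (p ℚ.* ℕtoℚ b) ℚ.* (q ℚ.* ℕtoℚ d)        ≡⟨ cong₂ ℚ._*_ ep eq ⟩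
    ℕtoℚ a ℚ.* ℕtoℚ c                        ≡⟨ sym (ℕtoℚ-* a c) ⟩
    ℕtoℚ (a * c)                             ∎)
    where open ≡-Reasoning

  ≐-ℕ : ∀ n → ℕtoℚ n ≐ n / 1
  ≐-ℕ n = cross (ℚₚ.*-identityʳ (ℕtoℚ n))

  ≐-expand : ∀ {p a b} d → p ≐ a / b → p ≐ (a * d) / (b * d)
  ≐-expand {p} {a} {b} d (cross e) = cross (begin
    p ℚ.* ℕtoℚ (b * d)           ≡⟨ cong (p ℚ.*_) (ℕtoℚ-* b d) ⟩
    p ℚ.* (ℕtoℚ b ℚ.* ℕtoℚ d)    ≡⟨ sym (ℚₚ.*-assoc p (ℕtoℚ b) (ℕtoℚ d)) ⟩
    p ℚ.* ℕtoℚ b ℚ.* ℕtoℚ d      ≡⟨ cong (ℚ._* ℕtoℚ d) e ⟩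
    ℕtoℚ a ℚ.* ℕtoℚ d            ≡⟨ sym (ℕtoℚ-* a d) ⟩
    ℕtoℚ (a * d)                 ∎)
    where open ≡-Reasoning

  ≐-≤⇒ : ∀ {p q a b c d} → p ≐ a / b → q ≐ c / d → p ℚ.≤ q → a * d ≤ c * b
  ≐-≤⇒ {p} {q} {a} {b} {c} {d} ep eq p≤q = ℕtoℚ-cancel-≤ (subst₂ ℚ._≤_ (scaled (≐-expand d ep))
    (trans (cong (λ z → q ℚ.* ℕtoℚ z) (*-comm b d)) (scaled (≐-expand b eq)))
    (ℚₚ.*-monoʳ-≤-nonNeg (ℕtoℚ (b * d)) {{ℕtoℚ-nonNeg (b * d)}} p≤q))

  ⇒≐-≤ : ∀ {p q a b c d} .{{_ : NonZero b}} .{{_ : NonZero d}} → p ≐ a / b → q ≐ c / d → a * d ≤ c * b → p ℚ.≤ q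
  ⇒≐-≤ {p} {q} {a} {b} {c} {d} ep eq le = ℚₚ.*-cancelʳ-≤-pos (ℕtoℚ (b * d)) {{ℕtoℚ-pos (b * d) {{ℕₚ.m*n≢0 b d}}}}
    (subst₂ ℚ._≤_ (sym (scaled (≐-expand d ep))) (sym (trans (cong (λ z → q ℚ.* ℕtoℚ z) (*-comm b d)) (scaled (≐-expand b eq)))) (ℕtoℚ-mono-≤ le))

  ≐-+ : ∀ {p q a b c} → p ≐ a / b → q ≐ c / b → (p ℚ.+ q) ≐ (a + c) / b
  ≐-+ {p} {q} {a} {b} {c} (cross ep) (cross eq) = cross (trans (ℚₚ.*-distribʳ-+ (ℕtoℚ b) p q) (trans (cong₂ ℚ._+_ ep eq) (sym (ℕtoℚ-+ a c))))

  ≐-expandˡ : ∀ {p a b} d → p ≐ a / b → p ≐ (d * a) / (d * b)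
  ≐-expandˡ {p} {a} {b} d e = subst₂ (λ a b → p ≐ a / b) (*-comm a d) (*-comm b d) (≐-expand d e)

  private
    mass : ∀ {n q} → List (ℚ × DetAlg n q) → ℚ
    mass = List.foldr (λ p s → proj₁ p ℚ.+ s) 0ℚ

    acceptance : ∀ {n q} → BoolFun n → List (ℚ × DetAlg n q) → ℚ
    acceptance f = List.foldr (λ p s → (if runDet (proj₂ p) f then proj₁ p else 0ℚ) ℚ.+ s) 0ℚ

  -- The product of all denominators serves. One D and one list of weights have to work for all f at
  -- once, since the two conditions on a tester quantify over f.
  common-denominator : ∀ {n q} (S : List (ℚ × DetAlg n q)) → All (λ p → 0ℚ ℚ.≤ proj₁ p) S →
    ∃ λ D → ∃ λ (ws : List (ℕ × DetAlg n q)) → NonZero D × mass S ≐ total ws / D × (∀ f → acceptance f S ≐ accept ws f / D)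
  common-denominator [] [] = 1 , [] , _ , cross refl , λ f → cross refl
  common-denominator ((mkℚ -[1+ _ ] d c , alg) ∷ S) (0≤w ∷ _) with ℚ.nonNegative 0≤w
  ... | ()
  common-denominator ((w@(mkℚ (+ P) d c) , alg) ∷ S) (_ ∷ 0≤S) with common-denominator S 0≤S
  ... | D , ws , D≢0 , mass≐ , acc≐ =
    suc d * D , (P * D , alg) ∷ rescaled , ℕₚ.m*n≢0 (suc d) D {{_}} {{D≢0}} ,
    ≐-+ w≐ (subst (λ z → mass S ≐ z / (suc d * D)) (sym (trans (∑-map rescale ws proj₁) (∑-*ˡ ws (suc d) proj₁)))
      (≐-expandˡ (suc d) mass≐)) ,
    λ f → ≐-+ (weight (runDet alg f)) (subst (λ z → acceptance f S ≐ z / (suc d * D)) (sym (rescaled-accept f)) (≐-expandˡ (suc d) (acc≐ f)))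
    where
    rescale : ∀ {A : Set} → ℕ × A → ℕ × A
    rescale p = suc d * proj₁ p , proj₂ p
    rescaled = List.map rescale ws
    rescaled-accept : ∀ f → accept rescaled f ≡ suc d * accept ws f
    rescaled-accept f = trans (∑-map rescale ws _)
      (trans (∑-cong ws (λ p → *-assoc (suc d) (proj₁ p) _)) (∑-*ˡ ws (suc d) (λ p → proj₁ p * 𝟙 (runDet (proj₂ p) f))))
    w≐ : w ≐ (P * D) / (suc d * D)
    w≐ = ≐-expand D (≐-mkℚ P d c)
    weight : ∀ b → (if b then w else 0ℚ) ≐ (P * D * 𝟙 b) / (suc d * D)
    weight true  = subst (λ z → w ≐ z / (suc d * D)) (sym (*-identityʳ (P * D))) w≐
    weight false = cross (trans (ℚₚ.*-zeroˡ (ℕtoℚ (suc d * D))) (cong ℕtoℚ (sym (*-zeroʳ (P * D)))))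

  weighted : ∀ {n q} P d .(c : Coprime P (suc d)) (R : RandAlg n q) → IsTester (mkℚ (+ P) d c) R → WeightedTester n q P (suc d)
  weighted {n} P d c (randAlg S 0≤S mass≡1) (accepts , rejects) with common-denominator S 0≤S
  ... | D , ws , D≢0 , mass≐ , acc≐ = record
    { algs    = ws
    ; total>0 = subst (0 <_) (sym total≡D) (ℕ.>-nonZero⁻¹ D {{D≢0}})
    ; sound   = λ f inter → subst₂ _≤_ (cong (2 *_) (sym total≡D)) (*-comm (accept ws f) 3)
                  (≐-≤⇒ (cross {a = 2} {3} refl) (acc≐ f) (accepts f inter))
    ; reject  = λ f far → subst₂ _≤_ (*-comm (accept ws f) 3) (trans (ℕₚ.*-identityˡ D) (sym total≡D))
                  (≐-≤⇒ (acc≐ f) (cross {a = 1} {3} refl) (rejects f (λ g inter →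
                    ⇒≐-≤ {{ℕₚ.m*n≢0 (suc d) 1}}
                      (≐-* (≐-mkℚ P d c) (≐-ℕ (2 ^ n))) (≐-ℕ (diffCount f g))
                      (subst₂ _≤_ (sym (*-identityʳ _)) (trans (*-comm (suc d) (diffCount f g)) (cong (diffCount f g *_) (sym (*-identityʳ (suc d)))))
                        (far g inter)))))
    }
    where
    total≡D : total ws ≡ D
    total≡D = ℕtoℚ-injective (sym (trans (sym (ℚₚ.*-identityˡ (ℕtoℚ D))) (trans (cong (ℚ._* ℕtoℚ D) (sym mass≡1)) (scaled mass≐))))

-- The bound for rational ε and explicit constants

open import Data.Bool using (false)
import Data.Nat.Properties as ℕₚ
open import Data.Nat.Coprimality using (1-coprimeTo)
open import Data.Nat.Tactic.RingSolver using (solve-∀)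
open import Data.Integer using (+_; -[1+_])
open import Data.Empty using (⊥; ⊥-elim)
open import Data.Product using (Σ; _×_; _,_)
open import Data.Rational using (ℚ; 0ℚ; 1ℚ; mkℚ; _/_; _*_; _≤_; _<_; _≤?_)
import Data.Rational.Properties as ℚₚ
open import Data.Unit using (tt)
open import Relation.Nullary.Decidable using (toWitnessFalse)
open import Relation.Binary.PropositionalEquality
open Counting using (query-bound)
open Fractions

-- For ε ≤ 0 every function is ε-far. The zero function is intersecting as well, so it would have to
-- be accepted with probability at least 2/3 and at most 1/3. The case arises because the lower
-- bound on ε is stated through ε².
no-tester-at-nonpositive : ∀ {n q} (ε : ℚ) → ε ≤ 0ℚ → (T : RandAlg n q) → IsTester ε T → ⊥
no-tester-at-nonpositive {n} ε ε≤0 T (accepts , rejects) =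
  toWitnessFalse {a? = + 2 / 3 ≤? + 1 / 3} tt (ℚₚ.≤-trans (accepts zero-fun (λ x y ())) (rejects zero-fun far))
  where
  zero-fun : BoolFun n
  zero-fun _ = false
  far : Far ε zero-fun
  far g _ = ℚₚ.≤-trans (ℚₚ.*-monoʳ-≤-nonNeg (ℕtoℚ (2 ℕ.^ n)) {{ℕtoℚ-nonNeg (2 ℕ.^ n)}} ε≤0)
    (ℚₚ.≤-trans (ℚₚ.≤-reflexive (ℚₚ.*-zeroˡ (ℕtoℚ (2 ℕ.^ n)))) (ℕtoℚ-mono-≤ (ℕ.z≤n {diffCount zero-fun g})))

private
  -- c = 1/(4u²) and c′ = 1/(2u) for u = 2¹⁵; the numerals stay abstract here because products
  -- of literals of this size must never be unfolded.
  bound : ∀ u c-1 c′-1 → u ≡ 32768 → suc c-1 ≡ 4 ℕ.* (u ℕ.* u) → suc c′-1 ≡ 2 ℕ.* u →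
    let c = mkℚ (+ 1) c-1 (1-coprimeTo (suc c-1)) ; c′ = mkℚ (+ 1) c′-1 (1-coprimeTo (suc c′-1)) in
    (n : ℕ) (ε : ℚ) → ε < c → 1ℚ ≤ ε * ε * ℕtoℚ n →
    (q : ℕ) (T : RandAlg n q) → IsTester ε T →
    (k : ℕ) → ℕtoℚ k * ℕtoℚ k * ℕtoℚ k * ℕtoℚ k * (ε * ε) ≤ c′ * c′ * c′ * c′ * ℕtoℚ n →
    2 ℕ.^ k ℕ.≤ q
  bound _ _ _ _ _ _ n ε@(mkℚ -[1+ _ ] _ _) _ _ q T tester _ _ =
    ⊥-elim (no-tester-at-nonpositive ε (ℚₚ.nonPositive⁻¹ ε) T tester)
  bound _ _ _ _ _ _ n ε@(mkℚ (+ 0) _ _) _ _ q T tester _ _ =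
    ⊥-elim (no-tester-at-nonpositive ε (ℚₚ.nonPositive⁻¹ ε) T tester)
  bound u c-1 c′-1 u≡ c≡ c′≡ n (mkℚ (+ P@(suc _)) d cop) ε<c 1≤ε²n q T tester k k⁴ε²≤c′⁴n =
    query-bound u k n P Q q u≡
      (subst₂ ℕ._≤_ (trans (ℕₚ.*-comm P (suc c-1)) (cong (ℕ._* P) c≡)) (ℕₚ.*-identityˡ Q)
        (≐-≤⇒ ε≐ (≐-mkℚ 1 c-1 (1-coprimeTo (suc c-1))) (ℚₚ.<⇒≤ ε<c)))
      (subst₂ ℕ._≤_ (lemma₁ Q) (ℕₚ.*-identityʳ (P ℕ.* P ℕ.* n))
        (≐-≤⇒ (≐-ℕ 1) (≐-* ε²≐ (≐-ℕ n)) 1≤ε²n))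
      (subst₂ ℕ._≤_ (trans (cong (λ u′ → k ℕ.* k ℕ.* k ℕ.* k ℕ.* (P ℕ.* P) ℕ.* (u′ ℕ.* u′ ℕ.* u′ ℕ.* u′ ℕ.* 1)) c′≡) (lemma₂ k P u)) (lemma₃ n Q)
        (≐-≤⇒ (≐-* (≐-* (≐-* (≐-* (≐-ℕ k) (≐-ℕ k)) (≐-ℕ k)) (≐-ℕ k)) ε²≐)
              (≐-* (≐-* (≐-* (≐-* c′≐ c′≐) c′≐) c′≐) (≐-ℕ n)) k⁴ε²≤c′⁴n))
      (weighted P d cop T tester)
    where
    Q = suc d
    ε≐ = ≐-mkℚ P d cop
    ε²≐ = ≐-* ε≐ ε≐
    c′≐ = ≐-mkℚ 1 c′-1 (1-coprimeTo (suc c′-1))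
    lemma₁ : ∀ q → 1 ℕ.* (q ℕ.* q ℕ.* 1) ≡ q ℕ.* q
    lemma₁ = solve-∀
    lemma₂ : ∀ k p u → k ℕ.* k ℕ.* k ℕ.* k ℕ.* (p ℕ.* p) ℕ.* (2 ℕ.* u ℕ.* (2 ℕ.* u) ℕ.* (2 ℕ.* u) ℕ.* (2 ℕ.* u) ℕ.* 1)
                       ≡ 16 ℕ.* (u ℕ.* u ℕ.* (u ℕ.* u)) ℕ.* (k ℕ.* k ℕ.* (k ℕ.* k) ℕ.* (p ℕ.* p))
    lemma₂ = solve-∀
    lemma₃ : ∀ n q → 1 ℕ.* 1 ℕ.* 1 ℕ.* 1 ℕ.* n ℕ.* (1 ℕ.* (q ℕ.* q)) ≡ n ℕ.* (q ℕ.* q)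
    lemma₃ = solve-∀

theorem1p2 : Σ ℚ λ c → Σ ℚ λ c′ → 0ℚ < c × 0ℚ < c′ ×
    ((n : ℕ) (ε : ℚ) → ε < c → 1ℚ ≤ ε * ε * ℕtoℚ n →
    (q : ℕ) (T : RandAlg n q) → IsTester ε T →
    (k : ℕ) → ℕtoℚ k * ℕtoℚ k * ℕtoℚ k * ℕtoℚ k * (ε * ε) ≤ c′ * c′ * c′ * c′ * ℕtoℚ n →
    2 ℕ.^ k ℕ.≤ q)
theorem1p2 =
  -- For u = 2¹⁵ the denominators are 4u² = 2³² and 2u = 2¹⁶; `mkℚ` stores them minus one.
  mkℚ (+ 1) 4294967295 (1-coprimeTo 4294967296) , mkℚ (+ 1) 65535 (1-coprimeTo 65536) ,
  ℚₚ.positive⁻¹ _ , ℚₚ.positive⁻¹ _ ,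
  bound 32768 4294967295 65535 refl refl refl
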